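{- There is an absolute constant $\delta'>0$ such that the online matching problem for general (not necessarily bipartite) graphs in the random edge arrival model admits a randomized online algorithm that is $\left(\frac12+\delta'\right)$-competitive.
   Context: Online matching in the random edge arrival model: a graph $G=(W,E)$ with $m=|E|$ is fixed adversarially; its edges are revealed one at a time in a uniformly random order. The algorithm knows $m$ but not the graph; upon arrival of an edge it must immediately and irrevocably decide whether to add it to its matching, and the picked edges must always form a matching. $\textsc{OPT}$ is a maximum matching of $G$. An algorithm is $c$-competitive if on every graph the expected size of its matching (over the random order and its internal coins) is at least $c\,|\textsc{OPT}|$. -}

module Defs where

open import Data.Bool.Base using (Bool; if_then_else_)
open import Data.Integer.Base using (+_)
open import Data.List.Base using (List; []; _∷_; length; foldr; map)
open import Data.List.Membership.Propositional using (_∈_)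
open import Data.List.NonEmpty.Base as List⁺ using (List⁺; [_]; _∷⁺_; toList)
open import Data.List.Relation.Binary.Permutation.Propositional using (_↭_)
open import Data.List.Relation.Binary.Subset.Propositional using (_⊆_)
open import Data.List.Relation.Unary.All using (All)
open import Data.List.Relation.Unary.AllPairs using (AllPairs)
open import Data.List.Relation.Unary.Unique.Propositional using (Unique)
open import Data.Nat.Base using (ℕ; _<_; _≤_)
open import Data.Product.Base using (_×_)
open import Data.Rational.Base as ℚ using (ℚ; 0ℚ; _/_)
open import Relation.Binary.PropositionalEquality.Core using (_≢_)

-- An unordered pair of distinct vertices, stored with the smaller label
-- first, so that propositional equality is equality of unordered pairs and
-- an edge carries no orientation that an algorithm could exploit.
record Edge : Set where
  constructor edge
  field
    lo hi  : ℕ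
    .lo<hi : lo < hi

open Edge public

Disjoint : Edge → Edge → Set
Disjoint e f = lo e ≢ lo f × lo e ≢ hi f × hi e ≢ lo f × hi e ≢ hi f

-- A finite simple graph whose vertices carry arbitrary natural-number labels.
-- Finite sets are duplicate-free lists; the order in which the edges are
-- listed is immaterial, as arrival orders range over all rearrangements.
record Graph : Set where
  field
    W         : List ℕ
    E         : List Edge
    W-unique  : Unique W
    E-unique  : Unique E
    endpoints : All (λ e → lo e ∈ W × hi e ∈ W) E

open Graph public

IsMatching : Graph → List Edge → Set
IsMatching G M = M ⊆ E G × AllPairs Disjoint M

IsMaximumMatching : Graph → List Edge → Set
IsMaximumMatching G M =
  IsMatching G M × (∀ N → IsMatching G N → length N ≤ length M)

module _ {A : Set} where

  -- Expected value of f at a uniformly random position of the list; an element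
  -- listed several times has proportionally larger probability.
  𝔼 : List⁺ A → (A → ℚ) → ℚ
  𝔼 xs f = foldr ℚ._+_ 0ℚ (map f (toList xs)) ℚ.* (+ 1 / List⁺.length xs)

  insertions : A → List A → List⁺ (List A)
  insertions x []       = [ x ∷ [] ]
  insertions x (y ∷ ys) = (x ∷ y ∷ ys) ∷⁺ List⁺.map (y ∷_) (insertions x ys)

  -- All (length xs)! rearrangements of xs, each listed once if xs has no
  -- duplicates.
  permutations : List A → List⁺ (List A)
  permutations []       = [ [] ]
  permutations (x ∷ xs) = List⁺.concatMap (insertions x) (permutations xs)

-- Decides whether to pick the arriving edge, given the edges that arrived
-- before it, most recent first. Earlier decisions are not passed, since they
-- can be recomputed from the earlier arrivals.
Policy : Set
Policy = List Edge → Edge → Bool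

picksAfter : Policy → List Edge → List Edge → List Edge
picksAfter p past []       = []
picksAfter p past (e ∷ es) =
  if p past e then e ∷ picksAfter p (e ∷ past) es
              else picksAfter p (e ∷ past) es

picks : Policy → List Edge → List Edge
picks p σ = picksAfter p [] σ

-- The argument m is the number of edges, the only thing known in advance.
-- The internal coins are drawn uniformly from the positions of coins m.
record OnlineAlgorithm : Set₁ where
  field
    Coin     : ℕ → Set
    coins    : ∀ m → List⁺ (Coin m)
    policy   : ∀ m → Coin m → Policy
    feasible : ∀ G (ω : Coin (length (E G))) σ → σ ↭ E G →
               IsMatching G (picks (policy (length (E G)) ω) σ)

expectedSize : OnlineAlgorithm → Graph → ℚ
expectedSize A G =
  𝔼 (permutations (E G)) λ σ →
  𝔼 (coins m) λ ω →
  + length (picks (policy m ω) σ) / 1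
  where
    open OnlineAlgorithm A
    m : ℕ
    m = length (E G)

Competitive : ℚ → OnlineAlgorithm → Set
Competitive c A = ∀ G OPT → IsMaximumMatching G OPT →
  c ℚ.* (+ length OPT / 1) ℚ.≤ expectedSize A G

{-# OPTIONS --safe #-}
module Submission where

-- Run greedy, except that with a small probability the following algorithm is
-- used. Let q be the expected number of edges of OPT that greedy picks; every
-- edge of OPT is touched and those are touched twice, so greedy picks at least
-- (|OPT| + q)/2 edges and only small q matters. An edge of OPT that greedy leaves
-- free on the first 1/64 of the order would have been picked had it arrived
-- there, so for small q the greedy matching T of that part touches almost all of
-- OPT, and almost every t ∈ T is the middle edge of an augmenting path whose outer
-- edges arrive later. Sacrifice each t ∈ T with a small probability 2/Z and match
-- its endpoints greedily with vertices outside T. Deleting a vertex changes the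
-- set of vertices that greedy occupies by at most one further vertex, so different
-- sacrificed edges rarely compete. Without such competition at least one endpoint
-- of t gets matched, which makes up for t. The endpoints of t may still compete
-- for the same vertex; therefore a random one of them declines each edge with
-- probability about 1/2, and then both get matched with constant probability.

open import Defs
open import Data.Bool.Base using (Bool; true; false; _∧_; if_then_else_)
open import Data.Empty using (⊥; ⊥-elim-irr)
import Data.Integer.Base as ℤ
import Data.Integer.Properties as ℤₚ
open import Data.Integer.Tactic.RingSolver using () renaming (solve-∀ to ℤ-solve-∀)
open import Data.List.Base using (List; []; _∷_; _++_; length; map; concatMap; filter; foldl; foldr; take; drop; reverse; replicate)
open import Data.List.Membership.DecPropositional as DecMembership using ()
open import Data.List.Membership.Propositional using (_∈_; _∉_; find; lose)
open import Data.List.Membership.Propositional.Properties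
  using (∈-++⁺ˡ; ∈-++⁺ʳ; ∈-++⁻; ∈-map⁺; ∈-map⁻; ∈-filter⁺; ∈-filter⁻; ∈-concatMap⁻; ∈-∃++; ∈-length)
open import Data.List.NonEmpty.Base as List⁺ using (List⁺; _∷_; toList)
open import Data.List.NonEmpty.Properties using (toList->>=)
open import Data.List.Properties
  using (length-++; length-map; length-take; ++-assoc; ++-identityʳ; foldl-++; filter-++;
         filter-all; map-cong; take++drop≡id; drop-all; unfold-reverse)
open import Data.List.Relation.Binary.Permutation.Propositional as Perm using (_↭_)
open import Data.List.Relation.Binary.Permutation.Propositional.Properties using (∈-resp-↭; ↭-length; shift)
open import Data.List.Relation.Binary.Subset.Propositional using (_⊆_)
open import Data.List.Relation.Unary.All as All using ([]; _∷_)
open import Data.List.Relation.Unary.AllPairs using (AllPairs; []; _∷_)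
import Data.List.Relation.Unary.AllPairs.Properties as AllPairsₚ
open import Data.List.Relation.Unary.Any as Any using (Any; here; there)
open import Data.List.Relation.Unary.Unique.Propositional using (Unique)
open import Data.Nat.Base using (ℕ; zero; suc; _+_; _*_; _∸_; _≤_; _<_; z≤n; s≤s; NonZero)
open import Data.Nat.DivMod using (_/_; _%_; m/n<m; m/n*n≤m; m≡m%n+[m/n]*n; m%n<n)
open import Data.Nat.Properties
open import Data.Nat.Tactic.RingSolver using (solve-∀)
open import Data.Product.Base using (_×_; _,_; proj₁; proj₂; ∃; Σ)
open import Data.Rational.Base as ℚ using (ℚ; 0ℚ; ½; toℚᵘ; fromℚᵘ)
import Data.Rational.Properties as ℚₚ
open import Data.Rational.Unnormalised.Base as ℚᵘ using (mkℚᵘ; *≡*; *≤*)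
import Data.Rational.Unnormalised.Properties as ℚᵘₚ
open import Data.Sum.Base using (_⊎_; inj₁; inj₂)
open import Function.Base using (_∘_; id)
open import Function.Bundles using (mk⇔)
open import Relation.Binary.PropositionalEquality hiding ([_])
open import Relation.Nullary
open import Relation.Nullary.Decidable using (¬?; _×-dec_; _⊎-dec_; map′; does-⇔; dec-true; dec-false)
open import Relation.Unary using (Decidable)

-- Finite sums

-- A sacrifice that gets one endpoint matched only breaks even, so all profit lies in the second
-- endpoint. With `Z = 2 + 2N` letters, a `t` without competitors has at least `2/Z + N²/Z³` matched
-- endpoints on average: the first summand repays the sacrifice, which has probability `2/Z`, and
-- the second is a profit of order `1/N`. Competition spoils at most a share `16/N` of `T` on
-- average, at a cost of order `1/N` each, hence `1/N²` in total; a large constant `N` leaves a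
-- surplus. The obstacle is dependence: whether `t` has competitors must not be influenced by the
-- letters that decide its fate. Competition is therefore measured on the second phase with both
-- endpoints of `t` deleted, which sees neither the letter of `t` nor those of the edges at `t`. Its
-- mean is then estimated while `t` is kept, since in that case the deletion removes nothing and one
-- set of vertices serves all `t` at once. Probabilities appear as counts: all estimates are
-- inequalities between natural numbers, summed over words of letters and over arrival orders, with
-- denominators multiplied out.

∑ : {A : Set} → List A → (A → ℕ) → ℕ
∑ []       f = 0
∑ (x ∷ xs) f = f x + ∑ xs f

module _ {A : Set} where

  ∑-mono : ∀ (xs : List A) {f g} → (∀ {x} → x ∈ xs → f x ≤ g x) → ∑ xs f ≤ ∑ xs g
  ∑-mono []       h = z≤n
  ∑-mono (x ∷ xs) h = +-mono-≤ (h (here refl)) (∑-mono xs (h ∘ there))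

  ∑-cong : ∀ (xs : List A) {f g} → (∀ {x} → x ∈ xs → f x ≡ g x) → ∑ xs f ≡ ∑ xs g
  ∑-cong []       h = refl
  ∑-cong (x ∷ xs) h = cong₂ _+_ (h (here refl)) (∑-cong xs (h ∘ there))

  ∑-+ : ∀ (xs : List A) f g → ∑ xs (λ x → f x + g x) ≡ ∑ xs f + ∑ xs g
  ∑-+ []       f g = refl
  ∑-+ (x ∷ xs) f g rewrite ∑-+ xs f g = interchange (f x) (g x) (∑ xs f) (∑ xs g)
    where
    interchange : ∀ a b c d → a + b + (c + d) ≡ a + c + (b + d)
    interchange = solve-∀

  ∑-*ˡ : ∀ (xs : List A) a f → ∑ xs (λ x → a * f x) ≡ a * ∑ xs f
  ∑-*ˡ []       a f = sym (*-zeroʳ a)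
  ∑-*ˡ (x ∷ xs) a f rewrite ∑-*ˡ xs a f = sym (*-distribˡ-+ a (f x) (∑ xs f))

  ∑-const : ∀ (xs : List A) a → ∑ xs (λ _ → a) ≡ length xs * a
  ∑-const []       a = refl
  ∑-const (x ∷ xs) a = cong (a +_) (∑-const xs a)

  ∑-zero : ∀ (xs : List A) → ∑ xs (λ _ → 0) ≡ 0
  ∑-zero xs = trans (∑-const xs 0) (*-zeroʳ (length xs))

  ∑-++ : ∀ (xs ys : List A) f → ∑ (xs ++ ys) f ≡ ∑ xs f + ∑ ys f
  ∑-++ []       ys f = refl
  ∑-++ (x ∷ xs) ys f rewrite ∑-++ xs ys f = sym (+-assoc (f x) _ _)

  term≤∑ : ∀ {xs : List A} {x} f → x ∈ xs → f x ≤ ∑ xs f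
  term≤∑ f (here refl) = m≤m+n (f _) _
  term≤∑ f (there p)   = ≤-trans (term≤∑ f p) (m≤n+m _ (f _))

  ∑-positive : ∀ (xs : List A) f → 1 ≤ ∑ xs f → ∃ λ x → x ∈ xs × 1 ≤ f x
  ∑-positive (x ∷ xs) f le with f x in eq
  ... | suc n = x , here refl , subst (1 ≤_) (sym eq) (s≤s z≤n)
  ... | zero  with y , y∈ , pos ← ∑-positive xs f le = y , there y∈ , pos

module _ {A B : Set} where

  ∑-map : ∀ (xs : List A) (h : A → B) f → ∑ (map h xs) f ≡ ∑ xs (f ∘ h)
  ∑-map []       h f = refl
  ∑-map (x ∷ xs) h f = cong (f (h x) +_) (∑-map xs h f)

  ∑-concatMap : ∀ (xs : List A) (h : A → List B) f →
                ∑ (concatMap h xs) f ≡ ∑ xs (λ x → ∑ (h x) f)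
  ∑-concatMap []       h f = refl
  ∑-concatMap (x ∷ xs) h f =
    trans (∑-++ (h x) (concatMap h xs) f) (cong (∑ (h x) f +_) (∑-concatMap xs h f))

  ∑-swap : ∀ (xs : List A) (ys : List B) (f : A → B → ℕ) →
           ∑ xs (λ x → ∑ ys (f x)) ≡ ∑ ys (λ y → ∑ xs (λ x → f x y))
  ∑-swap []       ys f = sym (∑-zero ys)
  ∑-swap (x ∷ xs) ys f =
    trans (cong (∑ ys (f x) +_) (∑-swap xs ys f)) (sym (∑-+ ys (f x) _))

opaque
  𝟙 : {P : Set} → Dec P → ℕ
  𝟙 p? = if does p? then 1 else 0

  𝟙-yes : {P : Set} (p? : Dec P) → P → 𝟙 p? ≡ 1
  𝟙-yes (yes _) p = refl
  𝟙-yes (no ¬p) p = contradiction p ¬p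

  𝟙-no : {P : Set} (p? : Dec P) → ¬ P → 𝟙 p? ≡ 0
  𝟙-no (yes p) ¬p = contradiction p ¬p
  𝟙-no (no _)  ¬p = refl

  𝟙≤1 : {P : Set} (p? : Dec P) → 𝟙 p? ≤ 1
  𝟙≤1 (yes _) = ≤-refl
  𝟙≤1 (no _)  = z≤n

  𝟙-witness : {P : Set} (p? : Dec P) → 1 ≤ 𝟙 p? → P
  𝟙-witness (yes p) _ = p

𝟙-mono : {P Q : Set} (p? : Dec P) (q? : Dec Q) → (P → Q) → 𝟙 p? ≤ 𝟙 q?
𝟙-mono (no ¬p) q? f = ≤-trans (≤-reflexive (𝟙-no (no ¬p) ¬p)) z≤n
𝟙-mono (yes p) q? f = ≤-trans (𝟙≤1 (yes p)) (≤-reflexive (sym (𝟙-yes q? (f p))))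

-- Greedy matching

data Side : Set where
  lower upper : Side

opposite : Side → Side
opposite lower = upper
opposite upper = lower

end : Side → Edge → ℕ
end lower = lo
end upper = hi

lo≢hi : ∀ e → lo e ≢ hi e
lo≢hi (edge l h l<h) eq = ⊥-elim-irr (<-irrefl eq l<h)

edge-ext : ∀ {e f} → lo e ≡ lo f → hi e ≡ hi f → e ≡ f
edge-ext {edge l h _} {edge .l .h _} refl refl = refl

opaque
  _≟ᵉ_ : (e f : Edge) → Dec (e ≡ f)
  e ≟ᵉ f = map′ (λ (p , q) → edge-ext p q) (λ { refl → refl , refl }) (lo e ≟ lo f ×-dec hi e ≟ hi f)

open DecMembership _≟_  using (_∈?_)
open DecMembership _≟ᵉ_ using () renaming (_∈?_ to _∈ᵉ?_)

hits : ℕ → Edge → ℕ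
hits w e = 𝟙 (lo e ≟ w) + 𝟙 (hi e ≟ w)

hits≤1 : ∀ w e → hits w e ≤ 1
hits≤1 w e with lo e ≟ w
... | no p rewrite 𝟙-no (no p) p = 𝟙≤1 (hi e ≟ w)
... | yes p rewrite 𝟙-yes (yes p) p | 𝟙-no (hi e ≟ w) (λ q → lo≢hi e (trans p (sym q))) = ≤-refl

hits-end : ∀ a e {w} → end a e ≡ w → 1 ≤ hits w e
hits-end lower e {w} p rewrite 𝟙-yes (lo e ≟ w) p = s≤s z≤n
hits-end upper e {w} p rewrite 𝟙-yes (hi e ≟ w) p = m≤n+m 1 _

hits-witness : ∀ w e → 1 ≤ hits w e → ∃ λ a → end a e ≡ w
hits-witness w e pos with lo e ≟ w
... | yes p = lower , p
... | no p rewrite 𝟙-no (no p) p = upper , 𝟙-witness (hi e ≟ w) pos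

-- The number of shared endpoints. An edge shares two with itself, which is why an edge of OPT
-- picked by greedy counts double.
link : Edge → Edge → ℕ
link e f = hits (lo e) f + hits (hi e) f

𝟙-≟-sym : ∀ m n → 𝟙 (n ≟ m) ≡ 𝟙 (m ≟ n)
𝟙-≟-sym m n = ≤-antisym (𝟙-mono (n ≟ m) (m ≟ n) sym) (𝟙-mono (m ≟ n) (n ≟ m) sym)

link-sym : ∀ e f → link e f ≡ link f e
link-sym e f
  rewrite 𝟙-≟-sym (lo e) (lo f) | 𝟙-≟-sym (lo e) (hi f) | 𝟙-≟-sym (hi e) (lo f) | 𝟙-≟-sym (hi e) (hi f)
  = interchange (𝟙 (lo e ≟ lo f)) (𝟙 (lo e ≟ hi f)) (𝟙 (hi e ≟ lo f)) (𝟙 (hi e ≟ hi f))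
  where
  interchange : ∀ a b c d → a + b + (c + d) ≡ a + c + (b + d)
  interchange = solve-∀

inc : List Edge → ℕ → ℕ
inc M w = ∑ M (hits w)

disjoint-ends : ∀ {e f} → Disjoint e f → ∀ a b → end a e ≢ end b f
disjoint-ends (p , _ , _ , _) lower lower = p
disjoint-ends (_ , p , _ , _) lower upper = p
disjoint-ends (_ , _ , p , _) upper lower = p
disjoint-ends (_ , _ , _ , p) upper upper = p

ends-disjoint : ∀ {e f} → (∀ a b → end a e ≢ end b f) → Disjoint e f
ends-disjoint h = h lower lower , h lower upper , h upper lower , h upper upper

inc≤1 : ∀ {M} → AllPairs Disjoint M → ∀ w → inc M w ≤ 1
inc≤1 [] w = z≤n
inc≤1 {e ∷ M} (d ∷ m) w with hits w e in eq
... | zero  = inc≤1 m w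
... | suc k with hits-witness w e (subst (1 ≤_) (sym eq) (s≤s z≤n))
... | a , refl = ≤-trans (≤-reflexive (cong₂ _+_ (sym eq) zeroes)) (≤-trans (≤-reflexive (+-identityʳ _)) (hits≤1 w e))
  where
  zeroes : inc M w ≡ 0
  zeroes = n<1⇒n≡0 (≰⇒> λ pos → let
      f , f∈ , p = ∑-positive M (hits w) pos
      b , q      = hits-witness w f p
    in disjoint-ends (All.lookup d f∈) a b (sym q))

inc-positive : ∀ {M e} a → e ∈ M → 1 ≤ inc M (end a e)
inc-positive {M} {e} a e∈ = ≤-trans (hits-end a e refl) (term≤∑ (hits (end a e)) e∈)

inc-witness : ∀ {M} w → 1 ≤ inc M w → ∃ λ e → e ∈ M × ∃ λ a → end a e ≡ w
inc-witness {M} w pos with e , e∈ , p ← ∑-positive M (hits w) pos = e , e∈ , hits-witness w e p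

matching-unique : ∀ {M} → AllPairs Disjoint M → ∀ {e f} → e ∈ M → f ∈ M →
                  ∀ a b → end a e ≡ end b f → e ≡ f
matching-unique (d ∷ m) (here refl) (here refl) a b p = refl
matching-unique (d ∷ m) (here refl) (there f∈)  a b p = contradiction p (disjoint-ends (All.lookup d f∈) a b)
matching-unique (d ∷ m) (there e∈)  (here refl) a b p = contradiction (sym p) (disjoint-ends (All.lookup d e∈) b a)
matching-unique (d ∷ m) (there e∈)  (there f∈)  a b p = matching-unique m e∈ f∈ a b p

Free : List ℕ → Edge → Set
Free U e = lo e ∉ U × hi e ∉ U

opaque
  free? : ∀ U e → Dec (Free U e)
  free? U e = ¬? (lo e ∈? U) ×-dec ¬? (hi e ∈? U)

occupy : Edge → List ℕ → List ℕ
occupy e U = lo e ∷ hi e ∷ U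

free-end : ∀ {U e} → Free U e → ∀ a → end a e ∉ U
free-end (p , q) lower = p
free-end (p , q) upper = q

blocked : ∀ {U e} → ¬ Free U e → ∃ λ a → end a e ∈ U
blocked {U} {e} nf with lo e ∈? U | hi e ∈? U
... | yes p | _     = lower , p
... | no _  | yes q = upper , q
... | no p  | no q  = contradiction (p , q) nf

∈-occupy⁻ : ∀ {w e U} → w ∈ occupy e U → (∃ λ a → end a e ≡ w) ⊎ w ∈ U
∈-occupy⁻ (here p)         = inj₁ (lower , sym p)
∈-occupy⁻ (there (here p)) = inj₁ (upper , sym p)
∈-occupy⁻ (there (there p)) = inj₂ p

end∈occupy : ∀ a {e U} → end a e ∈ occupy e U
end∈occupy lower = here refl
end∈occupy upper = there (here refl)

step : List ℕ → Edge → List ℕ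
step U e = if does (free? U e) then occupy e U else U

after : List ℕ → List Edge → List ℕ
after = foldl step

greedy : List ℕ → List Edge → List Edge
greedy U []       = []
greedy U (e ∷ es) =
  if does (free? U e) then e ∷ greedy (step U e) es else greedy (step U e) es

step-yes : ∀ {U e} → Free U e → step U e ≡ occupy e U
step-yes {U} {e} fr with free? U e
... | yes _ = refl
... | no nf = contradiction fr nf

step-no : ∀ {U e} → ¬ Free U e → step U e ≡ U
step-no {U} {e} nf with free? U e
... | yes fr = contradiction fr nf
... | no _   = refl

step-⊇ : ∀ {U e w} → w ∈ U → w ∈ step U e
step-⊇ {U} {e} p with free? U e
... | yes _ = there (there p)
... | no _  = p

after-⊇ : ∀ {U} es {w} → w ∈ U → w ∈ after U es
after-⊇ []       p = p
after-⊇ (e ∷ es) p = after-⊇ es (step-⊇ p)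

greedy-++ : ∀ U xs ys → greedy U (xs ++ ys) ≡ greedy U xs ++ greedy (after U xs) ys
greedy-++ U []       ys = refl
greedy-++ U (e ∷ xs) ys with free? U e
... | yes _ = cong (e ∷_) (greedy-++ (occupy e U) xs ys)
... | no _  = greedy-++ U xs ys

greedy-⊆ : ∀ U es {e} → e ∈ greedy U es → e ∈ es
greedy-⊆ U (x ∷ es) p with free? U x
greedy-⊆ U (x ∷ es) (here q)  | yes _ = here q
greedy-⊆ U (x ∷ es) (there p) | yes _ = there (greedy-⊆ (occupy x U) es p)
greedy-⊆ U (x ∷ es) p         | no _  = there (greedy-⊆ U es p)

after-witness : ∀ U es {w} → w ∈ after U es → w ∈ U ⊎ ∃ λ e → e ∈ greedy U es × ∃ λ a → end a e ≡ w
after-witness U []       p = inj₁ p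
after-witness U (x ∷ es) p with free? U x
after-witness U (x ∷ es) p | no _ = after-witness U es p
after-witness U (x ∷ es) p | yes _ with after-witness (occupy x U) es p
... | inj₂ (e , e∈ , q) = inj₂ (e , there e∈ , q)
... | inj₁ q with ∈-occupy⁻ {_} {x} {U} q
... | inj₁ r = inj₂ (x , here refl , r)
... | inj₂ r = inj₁ r

greedy-end∈after : ∀ U es {e} a → e ∈ greedy U es → end a e ∈ after U es
greedy-end∈after U (x ∷ es) a p with free? U x
greedy-end∈after U (x ∷ es) a (here refl) | yes _ = after-⊇ es (end∈occupy a {x} {U})
greedy-end∈after U (x ∷ es) a (there p)   | yes _ = greedy-end∈after (occupy x U) es a p
greedy-end∈after U (x ∷ es) a p           | no _  = greedy-end∈after U es a p

greedy-maximal : ∀ U es {e} → e ∈ es → ∃ λ a → end a e ∈ after U es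
greedy-maximal U (x ∷ es) (there p) = greedy-maximal (step U x) es p
greedy-maximal U (x ∷ es) (here refl) with free? U x
... | yes _ = lower , after-⊇ es (here refl)
... | no nf with a , q ← blocked {U} {x} nf = a , after-⊇ es q

greedy-free : ∀ U es {e} → e ∈ greedy U es → Free U e
greedy-free U (x ∷ es) p with free? U x
greedy-free U (x ∷ es) (here refl) | yes fr = fr
greedy-free U (x ∷ es) (there p)   | yes _ =
  let (q , r) = greedy-free (occupy x U) es p in q ∘ there ∘ there , r ∘ there ∘ there
greedy-free U (x ∷ es) p           | no _  = greedy-free U es p

greedy-matching : ∀ U es → AllPairs Disjoint (greedy U es)
greedy-matching U [] = []
greedy-matching U (x ∷ es) with free? U x
... | no _  = greedy-matching U es
... | yes _ = All.tabulate (λ {f} f∈ → ends-disjoint {x} {f} λ a b eq →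
                  free-end {occupy x U} {f} (greedy-free (occupy x U) es f∈) b (subst (_∈ occupy x U) eq (end∈occupy a {x} {U})))
              ∷ greedy-matching (occupy x U) es

length-after : ∀ U es → length (after U es) ≡ length U + 2 * length (greedy U es)
length-after U []       = sym (+-identityʳ _)
length-after U (x ∷ es) with free? U x
... | no _  = length-after U es
... | yes _ = trans (length-after (occupy x U) es) (double-suc (length U) (length (greedy (occupy x U) es)))
  where
  double-suc : ∀ m n → suc (suc m) + 2 * n ≡ m + 2 * suc n
  double-suc = solve-∀

-- Stability of greedy under the removal of a vertex

infix 4 _≋_

_≋_ : List ℕ → List ℕ → Set
U ≋ V = ∀ w → (w ∈ U → w ∈ V) × (w ∈ V → w ∈ U)

≋-trans : ∀ {U V W} → U ≋ V → V ≋ W → U ≋ W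
≋-trans p q w = proj₁ (q w) ∘ proj₁ (p w) , proj₂ (p w) ∘ proj₂ (q w)

∷-≋ : ∀ x {U V} → U ≋ V → x ∷ U ≋ x ∷ V
∷-≋ x p w = grow (proj₁ (p w)) , grow (proj₂ (p w))
  where
  grow : ∀ {U V} → (w ∈ U → w ∈ V) → w ∈ x ∷ U → w ∈ x ∷ V
  grow f (here q)  = here q
  grow f (there q) = there (f q)

swap-≋ : ∀ x y U → x ∷ y ∷ U ≋ y ∷ x ∷ U
swap-≋ x y U w = exchange , exchange
  where
  exchange : ∀ {a b} → w ∈ a ∷ b ∷ U → w ∈ b ∷ a ∷ U
  exchange (here q)          = there (here q)
  exchange (there (here q))  = here q
  exchange (there (there q)) = there (there q)

Free-≋ : ∀ {U V} e → U ≋ V → Free U e → Free V e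
Free-≋ e p (q , r) = q ∘ proj₂ (p (lo e)) , r ∘ proj₂ (p (hi e))

after-≋ : ∀ {U V} es → U ≋ V → after U es ≋ after V es
after-≋ []       p = p
after-≋ {U} {V} (e ∷ es) p with free? U e | free? V e
... | yes _ | yes _ = after-≋ es (∷-≋ (lo e) (∷-≋ (hi e) p))
... | no _  | no _  = after-≋ es p
... | yes f | no nf = contradiction (Free-≋ {U} {V} e p f) nf
... | no nf | yes f = contradiction (Free-≋ {V} {U} e (λ w → proj₂ (p w) , proj₁ (p w)) f) nf

Near : ℕ → List ℕ → List ℕ → Set
Near x U V = ∀ w → w ≢ x → (w ∈ U → w ∈ V) × (w ∈ V → w ∈ U)

Near-sym : ∀ {x U V} → Near x U V → Near x V U
Near-sym h w ne = proj₂ (h w ne) , proj₁ (h w ne)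

near-same : ∀ {x U V} e → Near x U V → Near x (occupy e U) (occupy e V)
near-same {x} e h w ne = grow (proj₁ (h w ne)) , grow (proj₂ (h w ne))
  where
  grow : ∀ {U V} → (w ∈ U → w ∈ V) → w ∈ occupy e U → w ∈ occupy e V
  grow f (here q)          = here q
  grow f (there (here q))  = there (here q)
  grow f (there (there q)) = there (there (f q))

-- The run that can take e catches up with the other one at the old difference
-- x, and the other endpoint of e becomes the new difference.
near-switch : ∀ {x U V} e → Free U e → ¬ Free V e → Near x U V → ∃ λ y → Near y (occupy e U) V
near-switch {x} {U} {V} e fr nf h with blocked {V} {e} nf
... | a , ∈V with end a e ≟ x
... | no ne    = contradiction (proj₂ (h (end a e) ne) ∈V) (free-end {U} {e} fr a)
... | yes refl = end (opposite a) e , λ w ne → forth w ne , back w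
  where
  other : ∀ a b → b ≡ a ⊎ b ≡ opposite a
  other lower lower = inj₁ refl
  other lower upper = inj₂ refl
  other upper lower = inj₂ refl
  other upper upper = inj₁ refl
  forth : ∀ w → w ≢ end (opposite a) e → w ∈ occupy e U → w ∈ V
  forth w ne w∈ with ∈-occupy⁻ {w} {e} {U} w∈
  ... | inj₂ ∈U = proj₁ (h w λ { refl → free-end {U} {e} fr a ∈U }) ∈U
  ... | inj₁ (b , refl) with other a b
  ... | inj₁ refl = ∈V
  ... | inj₂ refl = contradiction refl ne
  back : ∀ w → w ∈ V → w ∈ occupy e U
  back w w∈ with w ≟ end a e
  ... | yes refl = end∈occupy a {e} {U}
  ... | no ne    = there (there (proj₂ (h w ne) w∈))

-- The single difference between the two runs survives every edge; each time it moves, it advances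
-- along a path whose edges are picked alternately by one run and by the other.
near-after : ∀ {x U V} es → Near x U V → ∃ λ y → Near y (after U es) (after V es)
near-after {x} [] h = x , h
near-after {x} {U} {V} (e ∷ es) h with free? U e | free? V e
... | yes _ | yes _ = near-after es (near-same {x} {U} {V} e h)
... | no _  | no _  = near-after es h
... | yes f | no nf = near-after es (proj₂ (near-switch {x} {U} {V} e f nf h))
... | no nf | yes f with y , k ← near-switch {x} {V} {U} e f nf (Near-sym {x} {U} {V} h) =
  near-after es (Near-sym {y} {occupy e V} {U} k)

-- Every edge at `z` was rejected, since picking one would occupy `z`. Blocking `z` in advance
-- rejects the same edges again.
after-unused : ∀ {z} U es → z ∉ after U es → after (z ∷ U) es ≋ z ∷ after U es
after-unused U []       z∉ w = id , id
after-unused {z} U (e ∷ es) z∉ with free? U e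
... | yes (p , q)
  rewrite step-yes {z ∷ U} {e} ((λ { (here r) → z∉ (after-⊇ es (here (sym r))) ; (there r) → p r })
                              , (λ { (here r) → z∉ (after-⊇ es (there (here (sym r)))) ; (there r) → q r }))
  = ≋-trans (after-≋ es (≋-trans (∷-≋ (lo e) (swap-≋ (hi e) z U)) (swap-≋ (lo e) z (hi e ∷ U))))
            (after-unused (occupy e U) es z∉)
... | no nf
  rewrite step-no {z ∷ U} {e} (λ (p , q) → nf (p ∘ there , q ∘ there))
  = after-unused U es z∉

opaque
  incident? : ∀ v e → Dec (∃ λ a → end a e ≡ v)
  incident? v e with lo e ≟ v | hi e ≟ v
  ... | yes p | _     = yes (lower , p)
  ... | no _  | yes q = yes (upper , q)
  ... | no p  | no q  = no λ { (lower , r) → p r ; (upper , r) → q r }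

without : ℕ → List Edge → List Edge
without v = filter (¬? ∘ incident? v)

run-unmatched : ∀ {v} U es → v ∉ after U es →
                greedy U es ≡ greedy U (without v es) × after U es ≡ after U (without v es)
run-unmatched U [] v∉ = refl , refl
run-unmatched {v} U (e ∷ es) v∉ with incident? v e
run-unmatched {v} U (e ∷ es) v∉ | yes (a , p) with free? U e
... | yes _ = contradiction (after-⊇ es (subst (_∈ occupy e U) p (end∈occupy a {e} {U}))) v∉
... | no _  = run-unmatched U es v∉
run-unmatched {v} U (e ∷ es) v∉ | no p with free? U e
... | yes _ = let q , r = run-unmatched (occupy e U) es v∉ in cong (e ∷_) q , r
... | no _  = run-unmatched U es v∉

after-blocked : ∀ v U es → after (v ∷ U) es ≋ v ∷ after U (without v es)
after-blocked v U [] w = id , id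
after-blocked v U (e ∷ es) with incident? v e
... | yes (a , p)
  rewrite step-no {v ∷ U} {e} (λ fr → free-end {v ∷ U} {e} fr a (here p)) = after-blocked v U es
... | no p with free? U e
... | yes (q , r)
  rewrite step-yes {v ∷ U} {e} ((λ { (here s) → p (lower , s) ; (there s) → q s })
                              , (λ { (here s) → p (upper , s) ; (there s) → r s }))
  = ≋-trans (after-≋ es (≋-trans (∷-≋ (lo e) (swap-≋ (hi e) v U)) (swap-≋ (lo e) v (hi e ∷ U))))
            (after-blocked v (occupy e U) es)
... | no nf
  rewrite step-no {v ∷ U} {e} (λ (q , r) → nf (q ∘ there , r ∘ there)) = after-blocked v U es

-- Before `v` is matched to its mate, both are free and no edge at either has been picked, so
-- blocking both from the start changes nothing up to that moment; afterwards both are occupied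
-- anyway. The effect of `v` on the others is thus that of one blocked vertex, the mate.
run-matched : ∀ {v} U es → v ∉ U → v ∈ after U es →
              ∃ λ e → ∃ λ a → e ∈ greedy U es × end a e ≡ v × end (opposite a) e ∉ U ×
                after U es ≋ v ∷ after (end (opposite a) e ∷ U) (without v es)
run-matched U [] v∉ v∈ = contradiction v∈ v∉
run-matched {v} U (e ∷ es) v∉ v∈ with incident? v e
run-matched {v} U (e ∷ es) v∉ v∈ | yes (a , refl) with free? U e
... | no _  with f , b , f∈ , rest ← run-matched U es v∉ v∈ = f , b , f∈ , rest
... | yes fr = e , a , here refl , refl , free-end {U} {e} fr (opposite a) ,
      ≋-trans (after-≋ es (sort a)) (after-blocked v (end (opposite a) e ∷ U) es)
  where
  sort : ∀ a → occupy e U ≋ end a e ∷ end (opposite a) e ∷ U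
  sort lower w = id , id
  sort upper   = swap-≋ (lo e) (hi e) U
run-matched {v} U (e ∷ es) v∉ v∈ | no p with free? U e
... | yes (q , r)
  with f , b , f∈ , fb , z∉ , h ← run-matched (occupy e U) es
         (λ { (here s) → p (lower , sym s) ; (there (here s)) → p (upper , sym s) ; (there (there s)) → v∉ s }) v∈
  = f , b , there f∈ , fb , z∉ ∘ there ∘ there , ≋-trans h (∷-≋ v (same f b z∉))
  where
  same : ∀ f b → end (opposite b) f ∉ occupy e U →
         after (end (opposite b) f ∷ occupy e U) (without v es) ≋
         after (end (opposite b) f ∷ U) (e ∷ without v es)
  same f b z∉
    rewrite step-yes {end (opposite b) f ∷ U} {e}
              ((λ { (here s) → z∉ (here (sym s)) ; (there s) → q s })
             , (λ { (here s) → z∉ (there (here (sym s))) ; (there s) → r s }))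
    = after-≋ (without v es) (≋-trans (swap-≋ _ (lo e) (hi e ∷ U)) (∷-≋ (lo e) (swap-≋ _ (hi e) U)))
... | no nf
  with f , b , f∈ , fb , z∉ , h ← run-matched U es v∉ v∈
  = f , b , f∈ , fb , z∉ , subst (λ V → after U es ≋ v ∷ after V (without v es))
      (sym (step-no {end (opposite b) f ∷ U} {e} (λ (q , r) → nf (q ∘ there , r ∘ there)))) h

differing : List Edge → ℕ → ℕ
differing L z = proj₁ (near-after {z} {[]} {z ∷ []} L (λ w ne → (λ ()) , λ { (here p) → contradiction p ne }))

-- A vertex that joins the run takes some z away from the others; by near-after
-- they then occupy at most one more vertex, and it depends only on L and z.
reach : List Edge → List ℕ
reach L = after [] L ++ map (differing L) (after [] L)

∈-reach : ∀ L z f → z ∈ after [] L → f ∈ after (z ∷ []) L → f ∈ reach L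
∈-reach L z f z∈ f∈ with f ≟ differing L z
... | yes refl = ∈-++⁺ʳ (after [] L) (∈-map⁺ (differing L) z∈)
... | no ne    = ∈-++⁺ˡ (proj₂ (proj₂ (near-after {z} {[]} {z ∷ []} L _) f ne) f∈)

length-reach : ∀ L → length (reach L) ≡ 4 * length (greedy [] L)
length-reach L rewrite length-++ (after [] L) {map (differing L) (after [] L)}
                     | length-map (differing L) (after [] L) | length-after [] L
  = double (length (greedy [] L))
  where
  double : ∀ n → 2 * n + 2 * n ≡ 4 * n
  double = solve-∀

-- If f ∉ reach of the run without v and w, only an edge at the other vertex of
-- the pair can have kept v from taking f.
taken-by-partner : ∀ {v w L e} a → v ∉ after [] L → e ∈ L → end a e ≡ v → end (opposite a) e ≢ w →
                   end (opposite a) e ∉ reach (without w (without v L)) →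
                   ∃ λ e′ → e′ ∈ greedy [] L × ∃ λ b → end b e′ ≡ w × end (opposite b) e′ ≡ end (opposite a) e
taken-by-partner {v} {w} {L} {e} a v∉ e∈ refl f≢w f∉
  with greedy≡ , after≡ ← run-unmatched [] L v∉ = conclude (w ∈? after [] L₁)
  where
  L₁ L₀ : List Edge
  L₁ = without v L
  L₀ = without w L₁
  f : ℕ
  f = end (opposite a) e
  occupied : ∀ a → end a e ∉ after [] L → (∃ λ c → end c e ∈ after [] L) → end (opposite a) e ∈ after [] L
  occupied lower ∉ (lower , p) = contradiction p ∉
  occupied lower ∉ (upper , p) = p
  occupied upper ∉ (lower , p) = p
  occupied upper ∉ (upper , p) = contradiction p ∉
  f∈L₁ : f ∈ after [] L₁
  f∈L₁ = subst (f ∈_) after≡ (occupied a v∉ (greedy-maximal [] L e∈))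
  f∉L₀ : f ∉ after [] L₀
  f∉L₀ = f∉ ∘ ∈-++⁺ˡ
  conclude : Dec (w ∈ after [] L₁) → _
  conclude (no w∉) = contradiction (subst (f ∈_) (proj₂ (run-unmatched [] L₁ w∉)) f∈L₁) f∉L₀
  conclude (yes w∈) with e′ , b , e′∈ , p , _ , h ← run-matched [] L₁ (λ ()) w∈ =
    e′ , subst (e′ ∈_) (sym greedy≡) e′∈ , b , p , meets (proj₁ (h f) f∈L₁)
    where
    z : ℕ
    z = end (opposite b) e′
    meets : f ∈ w ∷ after (z ∷ []) L₀ → z ≡ f
    meets (here q) = contradiction q f≢w
    meets (there q) with z ∈? after [] L₀
    ... | yes z∈ = contradiction (∈-reach L₀ z f z∈ q) f∉
    -- No other vertex used `z`, so blocking it affects nobody, and the only vertex newly occupied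
    -- is `z` itself.
    ... | no z∉ with proj₁ (after-unused [] L₀ z∉ f) q
    ... | here r  = sym r
    ... | there r = contradiction r f∉L₀

-- Random letters

∑-length : ∀ {A : Set} (xs : List A) → ∑ xs (λ _ → 1) ≡ length xs
∑-length xs = trans (∑-const xs 1) (*-identityʳ _)

∑-concatMap⁺ : ∀ {A B : Set} (h : A → List⁺ B) xs f →
               ∑ (toList (List⁺.concatMap h xs)) f ≡ ∑ (toList xs) (λ x → ∑ (toList (h x)) f)
∑-concatMap⁺ h xs f =
  trans (cong (λ l → ∑ l f) (sym (toList->>= h xs))) (∑-concatMap (toList xs) (toList ∘ h) f)

∑-map⁺ : ∀ {A B : Set} (h : A → B) xs f → ∑ (toList (List⁺.map h xs)) f ≡ ∑ (toList xs) (f ∘ h)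
∑-map⁺ h (x ∷ xs) f = cong (f (h x) +_) (∑-map xs h f)

-- The letter of an edge of the first phase says whether greedy keeps it (pass,
-- skip) or sacrifices it, and then which endpoint is to be careful; the letter
-- of a later edge says whether a careful endpoint declines it (skip).
data Letter : Set where
  care      : Side → Letter
  pass skip : Letter

Colouring : Set
Colouring = Edge → Letter

paint : Edge → Letter → Colouring → Colouring
paint e c κ f = if does (f ≟ᵉ e) then c else κ f

-- The head overrides the tail, so an edge keeps the letter of its first occurrence and later
-- arrivals never recolour a prefix; an online policy can therefore work with the colouring of the
-- edges seen so far. `pass` is a default for edges without a letter.
colouring : List Edge → List Letter → Colouring
colouring []      _       = λ _ → pass
colouring (e ∷ σ) []      = λ _ → pass
colouring (e ∷ σ) (c ∷ ω) = paint e c (colouring σ ω)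

Ignores : Edge → (Colouring → ℕ) → Set
Ignores e F = ∀ κ κ′ → (∀ f → f ≢ e → κ f ≡ κ′ f) → F κ ≡ F κ′

paint-same : ∀ e c κ → paint e c κ e ≡ c
paint-same e c κ with e ≟ᵉ e
... | yes _ = refl
... | no ne = contradiction refl ne

paint-other : ∀ e c κ f → f ≢ e → paint e c κ f ≡ κ f
paint-other e c κ f ne with f ≟ᵉ e
... | yes p = contradiction p ne
... | no _  = refl

colouring-++ : ∀ xs ys ω {f} → f ∈ xs → colouring (xs ++ ys) ω f ≡ colouring xs ω f
colouring-++ (x ∷ xs) ys []      f∈ = refl
colouring-++ (x ∷ xs) ys (c ∷ ω) {f} f∈ with f ≟ᵉ x
... | yes _ = refl
colouring-++ (x ∷ xs) ys (c ∷ ω) {f} (here p)   | no ne = contradiction p ne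
colouring-++ (x ∷ xs) ys (c ∷ ω) {f} (there f∈) | no ne = colouring-++ xs ys ω f∈

module _ (N : ℕ) where

  letters : List⁺ Letter
  letters = care lower ∷ care upper ∷ replicate N pass ++ replicate N skip

  words : ℕ → List⁺ (List Letter)
  words zero    = [] ∷ []
  words (suc n) = List⁺.concatMap (λ c → List⁺.map (c ∷_) (words n)) letters

  -- Opaque, since the eta rule of List⁺ makes toList unfold eagerly.
  opaque
    size : ℕ
    size = 2 + (N + N)

    alphabet : List Letter
    alphabet = toList letters

    wordList : ℕ → List (List Letter)
    wordList n = toList (words n)

    ∑ᶜ : List Edge → (Colouring → ℕ) → ℕ
    ∑ᶜ σ F = ∑ (wordList (length σ)) (λ ω → F (colouring σ ω))

    size≡ : size ≡ 2 + (N + N)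
    size≡ = refl

    wordList≡ : ∀ n → wordList n ≡ toList (words n)
    wordList≡ n = refl

    ∑ᶜ≡ : ∀ σ F → ∑ᶜ σ F ≡ ∑ (wordList (length σ)) (λ ω → F (colouring σ ω))
    ∑ᶜ≡ σ F = refl

    ∑-alphabet : ∀ h → ∑ alphabet h ≡ h (care lower) + (h (care upper) + (N * h pass + N * h skip))
    ∑-alphabet h = cong (λ t → h (care lower) + (h (care upper) + t))
      (trans (∑-++ (replicate N pass) (replicate N skip) h)
             (cong₂ _+_ (∑-replicate N pass) (∑-replicate N skip)))
      where
      ∑-replicate : ∀ n c → ∑ (replicate n c) h ≡ n * h c
      ∑-replicate zero    c = refl
      ∑-replicate (suc n) c = cong (h c +_) (∑-replicate n c)

    ∑-wordList : ∀ n f → ∑ (wordList (suc n)) f ≡ ∑ alphabet (λ c → ∑ (wordList n) (λ ω → f (c ∷ ω)))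
    ∑-wordList n f = trans (∑-concatMap⁺ (λ c → List⁺.map (c ∷_) (words n)) letters f)
                           (∑-cong (toList letters) (λ {c} _ → ∑-map⁺ (c ∷_) (words n) f))

    ∑ᶜ-∷ : ∀ e σ F → ∑ᶜ (e ∷ σ) F ≡ ∑ alphabet (λ c → ∑ᶜ σ (F ∘ paint e c))
    ∑ᶜ-∷ e σ F = ∑-wordList (length σ) (λ ω → F (colouring (e ∷ σ) ω))

    ∑ᶜ-mono : ∀ σ {F G} → (∀ κ → F κ ≤ G κ) → ∑ᶜ σ F ≤ ∑ᶜ σ G
    ∑ᶜ-mono σ h = ∑-mono (wordList (length σ)) (λ _ → h _)

    ∑ᶜ-cong : ∀ σ {F G} → (∀ κ → F κ ≡ G κ) → ∑ᶜ σ F ≡ ∑ᶜ σ G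
    ∑ᶜ-cong σ h = ∑-cong (wordList (length σ)) (λ _ → h _)

    ∑ᶜ-*ˡ : ∀ σ a F → ∑ᶜ σ (λ κ → a * F κ) ≡ a * ∑ᶜ σ F
    ∑ᶜ-*ˡ σ a F = ∑-*ˡ (wordList (length σ)) a (F ∘ colouring σ)

    ∑ᶜ-+ : ∀ σ F G → ∑ᶜ σ (λ κ → F κ + G κ) ≡ ∑ᶜ σ F + ∑ᶜ σ G
    ∑ᶜ-+ σ F G = ∑-+ (wordList (length σ)) (F ∘ colouring σ) (G ∘ colouring σ)

    ∑ᶜ-swap : ∀ {A : Set} σ (xs : List A) (F : Colouring → A → ℕ) →
              ∑ᶜ σ (λ κ → ∑ xs (F κ)) ≡ ∑ xs (λ x → ∑ᶜ σ (λ κ → F κ x))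
    ∑ᶜ-swap σ xs F = ∑-swap (wordList (length σ)) xs (F ∘ colouring σ)

  ∑-alphabet-const : ∀ a → ∑ alphabet (λ _ → a) ≡ size * a
  ∑-alphabet-const a rewrite size≡ = trans (∑-alphabet (λ _ → a)) (collect N a)
    where
    collect : ∀ n a → a + (a + (n * a + n * a)) ≡ (2 + (n + n)) * a
    collect = solve-∀

  independent-head : ∀ e σ F h → Ignores e F →
                     size * ∑ᶜ (e ∷ σ) (λ κ → F κ * h (κ e)) ≡ ∑ alphabet h * ∑ᶜ (e ∷ σ) F
  independent-head e σ F h ig = begin
    size * ∑ᶜ (e ∷ σ) (λ κ → F κ * h (κ e))
      ≡⟨ cong (size *_) (∑ᶜ-∷ e σ _) ⟩
    size * ∑ alphabet (λ c → ∑ᶜ σ (λ κ → F (paint e c κ) * h (paint e c κ e)))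
      ≡⟨ cong (size *_) (∑-cong alphabet λ {c} _ → trans
           (∑ᶜ-cong σ λ κ → trans
             (cong₂ _*_ (ignore c κ) (cong h (paint-same e c κ))) (*-comm _ (h c)))
           (trans (∑ᶜ-*ˡ σ (h c) F) (*-comm (h c) _))) ⟩
    size * ∑ alphabet (λ c → ∑ᶜ σ F * h c)
      ≡⟨ cong (size *_) (∑-*ˡ alphabet (∑ᶜ σ F) h) ⟩
    size * (∑ᶜ σ F * ∑ alphabet h)
      ≡⟨ rotate size (∑ᶜ σ F) (∑ alphabet h) ⟩
    ∑ alphabet h * (size * ∑ᶜ σ F)
      ≡⟨ cong (∑ alphabet h *_) (∑-alphabet-const (∑ᶜ σ F)) ⟨
    ∑ alphabet h * ∑ alphabet (λ c → ∑ᶜ σ F)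
      ≡⟨ cong (∑ alphabet h *_) (∑-cong alphabet λ {c} _ →
           ∑ᶜ-cong σ (ignore c)) ⟨
    ∑ alphabet h * ∑ alphabet (λ c → ∑ᶜ σ (F ∘ paint e c))
      ≡⟨ cong (∑ alphabet h *_) (∑ᶜ-∷ e σ F) ⟨
    ∑ alphabet h * ∑ᶜ (e ∷ σ) F ∎
    where
    open ≡-Reasoning
    ignore : ∀ c κ → F (paint e c κ) ≡ F κ
    ignore c κ = ig (paint e c κ) κ (paint-other e c κ)
    rotate : ∀ a b c → a * (b * c) ≡ c * (a * b)
    rotate = solve-∀
  independent-tail : ∀ {e} e′ σ F h → e ≢ e′ → Ignores e F →
                     (∀ G → Ignores e G → size * ∑ᶜ σ (λ κ → G κ * h (κ e)) ≡ ∑ alphabet h * ∑ᶜ σ G) →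
                     size * ∑ᶜ (e′ ∷ σ) (λ κ → F κ * h (κ e)) ≡ ∑ alphabet h * ∑ᶜ (e′ ∷ σ) F
  independent-tail {e} e′ σ F h ne ig IH = begin
    size * ∑ᶜ (e′ ∷ σ) (λ κ → F κ * h (κ e))
      ≡⟨ cong (size *_) (∑ᶜ-∷ e′ σ _) ⟩
    size * ∑ alphabet (λ c → ∑ᶜ σ (λ κ → F (paint e′ c κ) * h (paint e′ c κ e)))
      ≡⟨ ∑-*ˡ alphabet size _ ⟨
    ∑ alphabet (λ c → size * ∑ᶜ σ (λ κ → F (paint e′ c κ) * h (paint e′ c κ e)))
      ≡⟨ ∑-cong alphabet (λ {c} _ → trans
           (cong (size *_) (∑ᶜ-cong σ λ κ → cong (λ l → F (paint e′ c κ) * h l) (paint-other e′ c κ e ne)))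
           (IH (F ∘ paint e′ c) (λ κ κ′ eq → ig _ _ (λ f fe → repaint c κ κ′ f (eq f fe))))) ⟩
    ∑ alphabet (λ c → ∑ alphabet h * ∑ᶜ σ (F ∘ paint e′ c))
      ≡⟨ ∑-*ˡ alphabet (∑ alphabet h) _ ⟩
    ∑ alphabet h * ∑ alphabet (λ c → ∑ᶜ σ (F ∘ paint e′ c))
      ≡⟨ cong (∑ alphabet h *_) (∑ᶜ-∷ e′ σ F) ⟨
    ∑ alphabet h * ∑ᶜ (e′ ∷ σ) F ∎
    where
    open ≡-Reasoning
    repaint : ∀ c κ κ′ f → κ f ≡ κ′ f → paint e′ c κ f ≡ paint e′ c κ′ f
    repaint c κ κ′ f eq with f ≟ᵉ e′
    ... | yes _ = refl
    ... | no _  = eq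

  -- Independence of the letter of `e` from `F`, as the product rule for expectations with the
  -- denominators multiplied out.
  independent : ∀ {e σ} F h → e ∈ σ → Ignores e F →
                size * ∑ᶜ σ (λ κ → F κ * h (κ e)) ≡ ∑ alphabet h * ∑ᶜ σ F
  independent F h (here refl) ig = independent-head _ _ F h ig
  -- The list may repeat `e`; then the letter at the head counts, although `e` was located in the
  -- tail.
  independent {e} {e′ ∷ σ} F h (there e∈) ig = split (e ≟ᵉ e′)
    where
    split : Dec (e ≡ e′) → size * ∑ᶜ (e′ ∷ σ) (λ κ → F κ * h (κ e)) ≡
                           ∑ alphabet h * ∑ᶜ (e′ ∷ σ) F
    split (yes refl) = independent-head e σ F h ig
    split (no ne)    = independent-tail e′ σ F h ne ig (λ G → independent G h e∈)

-- Augmenting a greedy matching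

module _ {A : Set} where

  filter-comm : {P Q : A → Set} (P? : Decidable P) (Q? : Decidable Q) → ∀ xs →
                filter P? (filter Q? xs) ≡ filter Q? (filter P? xs)
  filter-comm P? Q? [] = refl
  filter-comm P? Q? (x ∷ xs) with P? x in p | Q? x in q
  ... | no _  | no _  = filter-comm P? Q? xs
  ... | no ¬p | yes _ rewrite p = filter-comm P? Q? xs
  ... | yes _ | no ¬q rewrite q = filter-comm P? Q? xs
  ... | yes _ | yes _ rewrite p | q = cong (x ∷_) (filter-comm P? Q? xs)

  filter-cong : {P Q : A → Set} (P? : Decidable P) (Q? : Decidable Q) → ∀ xs →
                (∀ {x} → x ∈ xs → (P x → Q x) × (Q x → P x)) → filter P? xs ≡ filter Q? xs
  filter-cong P? Q? [] h = refl
  filter-cong P? Q? (x ∷ xs) h with P? x | Q? x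
  ... | yes _ | yes _ = cong (x ∷_) (filter-cong P? Q? xs (h ∘ there))
  ... | no _  | no _  = filter-cong P? Q? xs (h ∘ there)
  ... | yes p | no ¬q = contradiction (proj₁ (h (here refl)) p) ¬q
  ... | no ¬p | yes q = contradiction (proj₂ (h (here refl)) q) ¬p

opposite-≢ : ∀ a → opposite a ≢ a
opposite-≢ lower ()
opposite-≢ upper ()

opposite-opposite : ∀ a → opposite (opposite a) ≡ a
opposite-opposite lower = refl
opposite-opposite upper = refl

same-or-opposite : ∀ a b → b ≡ a ⊎ b ≡ opposite a
same-or-opposite lower lower = inj₁ refl
same-or-opposite lower upper = inj₂ refl
same-or-opposite upper lower = inj₂ refl
same-or-opposite upper upper = inj₁ refl

ends-≢ : ∀ a e → end a e ≢ end (opposite a) e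
ends-≢ lower e p = lo≢hi e p
ends-≢ upper e p = lo≢hi e (sym p)

uncrossed : ∀ e f → lo e ≡ hi f → hi e ≢ lo f
uncrossed (edge l h l<h) (edge .h .l h<l) refl refl = ⊥-elim-irr (<-asym l<h h<l)

_≟ˢ_ : (a b : Side) → Dec (a ≡ b)
lower ≟ˢ lower = yes refl
lower ≟ˢ upper = no λ ()
upper ≟ˢ lower = no λ ()
upper ≟ˢ upper = yes refl

_≟ˡ_ : (c d : Letter) → Dec (c ≡ d)
care a ≟ˡ care b = map′ (cong care) (λ { refl → refl }) (a ≟ˢ b)
care a ≟ˡ pass   = no λ ()
care a ≟ˡ skip   = no λ ()
pass ≟ˡ care b   = no λ ()
pass ≟ˡ pass     = yes refl
pass ≟ˡ skip     = no λ ()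
skip ≟ˡ care b   = no λ ()
skip ≟ˡ pass     = no λ ()
skip ≟ˡ skip     = yes refl

some-side? : {P : Side → Set} → Decidable P → Dec (∃ P)
some-side? {P} P? with P? lower | P? upper
... | yes p | _     = yes (lower , p)
... | no _  | yes q = yes (upper , q)
... | no p  | no q  = no λ { (lower , r) → p r ; (upper , r) → q r }

sacrificed : Letter → ℕ
sacrificed (care _) = 1
sacrificed pass     = 0
sacrificed skip     = 0

kept : Letter → ℕ
kept (care _) = 0
kept pass     = 1
kept skip     = 1

careful : Side → Letter → ℕ
careful a c = 𝟙 (c ≟ˡ care a)

skips passes : Letter → ℕ
skips c  = 𝟙 (c ≟ˡ skip)
passes c = 𝟙 (¬? (c ≟ˡ skip))

load : List ℕ → Edge → ℕ
load X g = ∑ X (λ w → hits w g)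

∑-load : ∀ {O} → AllPairs Disjoint O → ∀ X → ∑ O (load X) ≤ length X
∑-load {O} dO X = begin
  ∑ O (load X)    ≡⟨ ∑-swap O X (λ g w → hits w g) ⟩
  ∑ X (inc O)     ≤⟨ ∑-mono X (λ {w} _ → inc≤1 dO w) ⟩
  ∑ X (λ _ → 1)   ≡⟨ ∑-length X ⟩
  length X        ∎
  where open ≤-Reasoning

load-end : ∀ {X g} a → end a g ∈ X → 1 ≤ load X g
load-end {X} {g} a x∈ = ≤-trans (hits-end a g refl) (term≤∑ (λ w → hits w g) x∈)

without-none : ∀ {v} L → (∀ {e} → e ∈ L → ∀ a → end a e ≢ v) → without v L ≡ L
without-none {v} L h = filter-all (¬? ∘ incident? v) (All.tabulate λ e∈ (a , p) → h e∈ a p)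

product-positive : ∀ m n → 1 ≤ m * n → 1 ≤ m × 1 ≤ n
product-positive (suc m) (suc n) _ = s≤s z≤n , s≤s z≤n
product-positive (suc m) zero    p = contradiction (subst (1 ≤_) (*-zeroʳ m) p) λ ()

product≤1 : ∀ {m n} → m ≤ 1 → n ≤ 1 → m * n ≤ 1
product≤1 p q = *-mono-≤ p q

module FirstPhase (first : List Edge) where

  T : List Edge
  T = greedy [] first

  A : List ℕ
  A = after [] first

  T-matching : AllPairs Disjoint T
  T-matching = greedy-matching [] first

  T-end : ∀ {t} a → t ∈ T → end a t ∈ A
  T-end a = greedy-end∈after [] first a

  inc-outside : ∀ {w} → w ∉ A → inc T w ≡ 0
  inc-outside {w} w∉ = n<1⇒n≡0 (≰⇒> λ pos →
    let t , t∈ , a , p = inc-witness w pos in w∉ (subst (_∈ A) p (T-end a t∈)))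

  inc-inside : ∀ {w} → w ∈ A → 1 ≤ inc T w
  inc-inside w∈ with after-witness [] first w∈
  ... | inj₂ (t , t∈ , a , refl) = inc-positive a t∈

  ∑-link : ∀ e → ∑ T (λ t → link t e) ≡ inc T (lo e) + inc T (hi e)
  ∑-link e = trans (∑-cong T (λ {t} _ → link-sym t e)) (∑-+ T (hits (lo e)) (hits (hi e)))

  ∑-link≤2 : ∀ e → ∑ T (λ t → link t e) ≤ 2
  ∑-link≤2 e rewrite ∑-link e = +-mono-≤ (inc≤1 T-matching (lo e)) (inc≤1 T-matching (hi e))

  record Spoke (t : Edge) (b : Side) (x : ℕ) (e : Edge) : Set where
    constructor spoke
    field
      side    : Side
      hub     : end side e ≡ end b t
      tip     : end (opposite side) e ≡ x
      outside : x ∉ A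

  spoke? : ∀ t b x e → Dec (∃ λ p → end p e ≡ end b t × end (opposite p) e ≡ x)
  spoke? t b x e = some-side? λ p → end p e ≟ end b t ×-dec end (opposite p) e ≟ x

  spoke-link : ∀ {t b x e} → Spoke t b x e → 1 ≤ link t e
  spoke-link {t} {lower} {x} {e} s = ≤-trans (hits-end (Spoke.side s) e (Spoke.hub s)) (m≤m+n _ _)
  spoke-link {t} {upper} {x} {e} s = ≤-trans (hits-end (Spoke.side s) e (Spoke.hub s)) (m≤n+m _ (hits (lo t) e))

  -- Only the hub lies in `A`, which fixes the orientation of `e`; as `T` is a matching, the hub
  -- then fixes the owner and its side.
  spoke-same : ∀ {t t′ b b′ x x′ e} → t ∈ T → t′ ∈ T → Spoke t b x e → Spoke t′ b′ x′ e →
               t ≡ t′ × b ≡ b′ × x ≡ x′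
  spoke-same {t} {t′} {b} {b′} {x} {x′} {e} t∈ t′∈ (spoke p hub refl x∉) (spoke q hub′ refl _) with same-or-opposite p q
  ... | inj₂ refl = contradiction (subst (_∈ A) (sym hub′) (T-end b′ t′∈)) x∉
  ... | inj₁ refl with matching-unique T-matching t∈ t′∈ b b′ (trans (sym hub) hub′)
  ... | refl with same-or-opposite b b′
  ... | inj₁ refl = refl , refl , refl
  ... | inj₂ refl = contradiction (trans (sym hub) hub′) (ends-≢ b t)

  spoke-unique : ∀ {t b x e e′} → Spoke t b x e → Spoke t b x e′ → e ≡ e′
  spoke-unique {e = e} {e′} (spoke lower p q _) (spoke lower p′ q′ _) = edge-ext (trans p (sym p′)) (trans q (sym q′))
  spoke-unique {e = e} {e′} (spoke upper p q _) (spoke upper p′ q′ _) = edge-ext (trans q (sym q′)) (trans p (sym p′))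
  spoke-unique {e = e} {e′} (spoke lower p q _) (spoke upper p′ q′ _) =
    contradiction (trans q (sym q′)) (uncrossed e e′ (trans p (sym p′)))
  spoke-unique {e = e} {e′} (spoke upper p q _) (spoke lower p′ q′ _) =
    contradiction (trans q′ (sym q)) (uncrossed e′ e (trans p′ (sym p)))

  spoke-≢ : ∀ {t b x e} → t ∈ T → Spoke t b x e → e ≢ t
  spoke-≢ t∈ (spoke p _ refl x∉) refl = x∉ (T-end (opposite p) t∈)

  -- `a` is the careful endpoint of the sacrificed `t` and `b` the endpoint that `e` meets; only the
  -- careful endpoint heeds the letter of `e`. No letters besides those of `e` and `t` are read, so
  -- the condition can be decided when `e` arrives.
  Willing : Colouring → Edge → Edge → Set
  Willing κ e t = ∃ λ b → ∃ λ a → κ t ≡ care a × (a ≢ b ⊎ κ e ≢ skip) ×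
                  ∃ λ p → end p e ≡ end b t × end (opposite p) e ∉ A

  Admissible : Colouring → Edge → Set
  Admissible κ e = Any (Willing κ e) T

  opaque
    admissible? : ∀ κ → Decidable (Admissible κ)
    admissible? κ e = Any.any? (λ t →
      some-side? λ b → some-side? λ a →
        (κ t ≟ˡ care a) ×-dec (¬? (a ≟ˢ b) ⊎-dec ¬? (κ e ≟ˡ skip)) ×-dec
        some-side? λ p → (end p e ≟ end b t) ×-dec ¬? (end (opposite p) e ∈? A)) T

  admissible : ∀ {κ t a b x e} → t ∈ T → κ t ≡ care a → Spoke t b x e → a ≢ b ⊎ κ e ≢ skip →
               Admissible κ e
  admissible t∈ κt (spoke p hub refl x∉) ok = lose t∈ (_ , _ , κt , ok , p , hub , x∉)

  admissible⁻ : ∀ {κ e} → Admissible κ e →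
                ∃ λ t → t ∈ T × ∃ λ a → κ t ≡ care a × ∃ λ b → ∃ λ x → Spoke t b x e × (a ≢ b ⊎ κ e ≢ skip)
  admissible⁻ adm with t , t∈ , b , a , κt , ok , p , hub , x∉ ← find adm =
    t , t∈ , a , κt , b , _ , spoke p hub refl x∉ , ok

  admissible-cong : ∀ {κ κ′ e} → κ e ≡ κ′ e →
                    (∀ {t} → t ∈ T → ∀ b p → end p e ≡ end b t → κ t ≡ κ′ t) →
                    Admissible κ e → Admissible κ′ e
  admissible-cong {κ} {κ′} {e} e≡ t≡ adm
    with t , t∈ , a , κt , b , x , s , ok ← admissible⁻ adm =
    admissible t∈ (trans (sym (t≡ t∈ b (Spoke.side s) (Spoke.hub s))) κt) s (carry ok)
    where
    carry : ∀ {a b : Side} → a ≢ b ⊎ κ e ≢ skip → a ≢ b ⊎ κ′ e ≢ skip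
    carry (inj₁ p) = inj₁ p
    carry (inj₂ q) = inj₂ (q ∘ trans e≡)

  module SecondPhase (R : List Edge) where

    L : Colouring → List Edge
    L κ = filter (admissible? κ) R

    M : Colouring → List Edge
    M κ = greedy [] (L κ)

    ∈-L⁻ : ∀ {κ e} → e ∈ L κ → e ∈ R × Admissible κ e
    ∈-L⁻ {κ} = ∈-filter⁻ (admissible? κ) {xs = R}

    M⊆L : ∀ {κ e} → e ∈ M κ → e ∈ L κ
    M⊆L {κ} = greedy-⊆ [] (L κ)

    matched : Edge → Colouring → ℕ
    matched t κ = ∑ (M κ) (link t)

    -- An admissible edge has just one end in `A`, so it is counted for a single `t`.
    ∑-matched : ∀ κ → ∑ T (λ t → matched t κ) ≤ length (M κ)
    ∑-matched κ = begin
      ∑ T (λ t → matched t κ)              ≡⟨ ∑-swap T (M κ) link ⟩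
      ∑ (M κ) (λ e → ∑ T (λ t → link t e)) ≤⟨ ∑-mono (M κ) (one ∘ proj₂ ∘ ∈-L⁻ ∘ M⊆L {κ}) ⟩
      ∑ (M κ) (λ _ → 1)                    ≡⟨ ∑-length (M κ) ⟩
      length (M κ)                         ∎
      where
      open ≤-Reasoning
      one : ∀ {e} → Admissible κ e → ∑ T (λ t → link t e) ≤ 1
      one {e} adm with _ , _ , _ , _ , _ , _ , spoke p _ refl x∉ , _ ← admissible⁻ adm
        rewrite ∑-link e = single p x∉
        where
        single : ∀ p → end (opposite p) e ∉ A → inc T (lo e) + inc T (hi e) ≤ 1
        single lower x∉ rewrite inc-outside x∉ | +-identityʳ (inc T (lo e)) = inc≤1 T-matching (lo e)
        single upper x∉ rewrite inc-outside x∉ = inc≤1 T-matching (hi e)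

    matched≡ : ∀ t κ → matched t κ ≡ inc (M κ) (lo t) + inc (M κ) (hi t)
    matched≡ t κ = ∑-+ (M κ) (hits (lo t)) (hits (hi t))

    matched≤2 : ∀ t κ → matched t κ ≤ 2
    matched≤2 t κ rewrite matched≡ t κ = +-mono-≤ (inc≤1 dM (lo t)) (inc≤1 dM (hi t))
      where
      dM : AllPairs Disjoint (M κ)
      dM = greedy-matching [] (L κ)

    length-M : ∀ κ → length (M κ) ≤ 2 * ∑ T (λ t → sacrificed (κ t))
    length-M κ = begin
      length (M κ)                                              ≡⟨ ∑-length (M κ) ⟨
      ∑ (M κ) (λ _ → 1)                                         ≤⟨ ∑-mono (M κ) (some ∘ proj₂ ∘ ∈-L⁻ ∘ M⊆L {κ}) ⟩
      ∑ (M κ) (λ e → ∑ T (λ t → sacrificed (κ t) * link t e))   ≡⟨ ∑-swap (M κ) T (λ e t → sacrificed (κ t) * link t e) ⟩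
      ∑ T (λ t → ∑ (M κ) (λ e → sacrificed (κ t) * link t e))   ≡⟨ ∑-cong T (λ {t} _ → ∑-*ˡ (M κ) (sacrificed (κ t)) (link t)) ⟩
      ∑ T (λ t → sacrificed (κ t) * matched t κ)                ≤⟨ ∑-mono T (λ {t} _ → twice (sacrificed (κ t)) (matched≤2 t κ)) ⟩
      ∑ T (λ t → 2 * sacrificed (κ t))                          ≡⟨ ∑-*ˡ T 2 _ ⟩
      2 * ∑ T (λ t → sacrificed (κ t))                          ∎
      where
      open ≤-Reasoning
      twice : ∀ c {m} → m ≤ 2 → c * m ≤ 2 * c
      twice c {m} le = subst (c * m ≤_) (*-comm c 2) (*-monoʳ-≤ c le)
      some : ∀ {e} → Admissible κ e → 1 ≤ ∑ T (λ t → sacrificed (κ t) * link t e)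
      some {e} adm with t , t∈ , a , κt , b , x , s , _ ← admissible⁻ adm =
        ≤-trans (subst (λ c → 1 ≤ sacrificed c * link t e) (sym κt)
                  (≤-trans (spoke-link s) (≤-reflexive (sym (+-identityʳ _)))))
                (term≤∑ (λ t → sacrificed (κ t) * link t e) t∈)

    L₀ : Edge → Colouring → List Edge
    L₀ t κ = without (hi t) (without (lo t) (L κ))

    L₀-orient : ∀ t κ b → without (end (opposite b) t) (without (end b t) (L κ)) ≡ L₀ t κ
    L₀-orient t κ lower = refl
    L₀-orient t κ upper = filter-comm (¬? ∘ incident? (lo t)) (¬? ∘ incident? (hi t)) (L κ)

    L₀≡ : ∀ t κ → L₀ t κ ≡ filter (admissible? κ) (without (hi t) (without (lo t) R))
    L₀≡ t κ = trans (cong (without (hi t)) (filter-comm (¬? ∘ incident? (lo t)) (admissible? κ) R))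
                    (filter-comm (¬? ∘ incident? (hi t)) (admissible? κ) (without (lo t) R))

    -- A surviving edge meets no endpoint of `t`, so it differs from `e`, and any edge of `T` that
    -- it meets differs from `t`. Its admissibility therefore reads no letter at `t`. The choice
    -- `e = t` is covered too.
    L₀-cong : ∀ {t e κ κ′} → t ∈ T → (∃ λ a → ∃ λ b → end a e ≡ end b t) →
              (∀ f → f ≢ e → κ f ≡ κ′ f) → L₀ t κ ≡ L₀ t κ′
    L₀-cong {t} {e} {κ} {κ′} t∈ (a , b , touch) agree =
      trans (L₀≡ t κ) (trans (filter-cong (admissible? κ) (admissible? κ′) _ both) (sym (L₀≡ t κ′)))
      where
      apart : ∀ {f} → f ∈ without (hi t) (without (lo t) R) → ∀ c b → end c f ≢ end b t
      apart f∈ c lower p = proj₂ (∈-filter⁻ (¬? ∘ incident? (lo t)) {xs = R} (proj₁ (∈-filter⁻ (¬? ∘ incident? (hi t)) f∈))) (c , p)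
      apart f∈ c upper p = proj₂ (∈-filter⁻ (¬? ∘ incident? (hi t)) {xs = without (lo t) R} f∈) (c , p)
      f≢e : ∀ {f} → f ∈ without (hi t) (without (lo t) R) → f ≢ e
      f≢e f∈ refl = apart f∈ a b touch
      owner≢e : ∀ {f t′} → f ∈ without (hi t) (without (lo t) R) → t′ ∈ T → ∀ b′ p → end p f ≡ end b′ t′ → t′ ≢ e
      owner≢e f∈ t′∈ b′ p q refl with refl ← matching-unique T-matching t′∈ t∈ a b touch = apart f∈ p b′ q
      both : ∀ {f} → f ∈ without (hi t) (without (lo t) R) →
             (Admissible κ f → Admissible κ′ f) × (Admissible κ′ f → Admissible κ f)
      both {f} f∈ = admissible-cong (agree f (f≢e f∈)) (λ t′∈ b′ p q → agree _ (owner≢e f∈ t′∈ b′ p q))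
                  , admissible-cong (sym (agree f (f≢e f∈))) (λ t′∈ b′ p q → sym (agree _ (owner≢e f∈ t′∈ b′ p q)))

    -- A kept edge admits nothing at its endpoints, so the deletion is vacuous. This makes the lists
    -- of all kept `t` coincide.
    L₀-kept : ∀ {t κ} → t ∈ T → (∀ a → κ t ≢ care a) → L₀ t κ ≡ L κ
    L₀-kept {t} {κ} t∈ keep = trans (cong (without (hi t)) (without-none {lo t} (L κ) (λ e∈ a → apart e∈ a lower)))
                                    (without-none {hi t} (L κ) (λ e∈ a → apart e∈ a upper))
      where
      apart : ∀ {e} → e ∈ L κ → ∀ p b → end p e ≢ end b t
      apart {e} e∈ p b q
        with t′ , t′∈ , a , κt′ , b′ , x , spoke p′ hub refl x∉ , _ ← admissible⁻ (proj₂ (∈-L⁻ {κ} e∈))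
        with same-or-opposite p′ p
      ... | inj₂ refl = contradiction (subst (_∈ A) (sym q) (T-end b t∈)) x∉
      ... | inj₁ refl with refl ← matching-unique T-matching t′∈ t∈ b′ b (trans (sym hub) q) = keep a κt′

    taken : ∀ {t κ b x e} → t ∈ T → e ∈ L κ → Spoke t b x e → x ∉ reach (L₀ t κ) →
            end b t ∉ after [] (L κ) → ∃ λ e′ → e′ ∈ M κ × Spoke t (opposite b) x e′
    taken {t} {κ} {b} t∈ e∈ (spoke p hub refl x∉) x∉reach unmatched
      with e′ , e′∈ , q , hub′ , tip ← taken-by-partner {w = end (opposite b) t} p unmatched e∈ hub
             (λ eq → x∉ (subst (_∈ A) (sym eq) (T-end (opposite b) t∈)))
             (subst (λ l → _ ∉ reach l) (sym (L₀-orient t κ b)) x∉reach)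
      = e′ , e′∈ , spoke q hub′ tip x∉

two-events : ∀ {x y m} → x ≤ 1 → y ≤ 1 → (1 ≤ x → 1 ≤ m) → (1 ≤ y → 2 ≤ m) → x + y ≤ m
two-events {zero}  {zero}  _ _ f g = z≤n
two-events {zero}  {suc y} _ p f g = ≤-trans p (≤-trans (s≤s z≤n) (g (s≤s z≤n)))
two-events {suc x} {zero}  p _ f g = ≤-trans (≤-reflexive (+-identityʳ _)) (≤-trans p (f (s≤s z≤n)))
two-events {suc x} {suc y} p q f g = ≤-trans (+-mono-≤ p q) (g (s≤s z≤n))

-- Augmenting paths of length three and competition for their ends

module Analysis (first R O : List Edge) (dO : AllPairs Disjoint O) where

  open FirstPhase first
  open SecondPhase R

  Ready : Edge → Set
  Ready g = g ∈ R × ∃ λ a → end a g ∈ A × end (opposite a) g ∉ A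

  opaque
    ready? : Decidable Ready
    ready? g = (g ∈ᵉ? R) ×-dec some-side? λ a → (end a g ∈? A) ×-dec ¬? (end (opposite a) g ∈? A)

  ready untouched early : Edge → ℕ
  ready g     = 𝟙 (ready? g)
  untouched g = 𝟙 (free? A g)
  early g     = 𝟙 (g ∈ᵉ? first)

  touches : Edge → ℕ
  touches g = ∑ T (λ t → link t g)

  touches-end : ∀ {g} a → end a g ∈ A → 1 ≤ touches g
  touches-end {g} a p rewrite ∑-link g = at a p
    where
    at : ∀ a → end a g ∈ A → 1 ≤ inc T (lo g) + inc T (hi g)
    at lower p = ≤-trans (inc-inside p) (m≤m+n _ _)
    at upper p = ≤-trans (inc-inside p) (m≤n+m _ _)

  ∑-touches : ∑ O touches ≤ 2 * length T
  ∑-touches = begin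
    ∑ O touches                    ≡⟨ ∑-swap O T (λ g t → link t g) ⟩
    ∑ T (λ t → ∑ O (link t))       ≤⟨ ∑-mono T (λ {t} _ → ≤-trans (≤-reflexive (∑-+ O (hits (lo t)) (hits (hi t))))
                                                       (+-mono-≤ (inc≤1 dO (lo t)) (inc≤1 dO (hi t)))) ⟩
    ∑ T (λ _ → 2)                  ≡⟨ trans (∑-const T 2) (*-comm (length T) 2) ⟩
    2 * length T                   ∎
    where open ≤-Reasoning

  spokes : Side → Edge → ℕ
  spokes b t = ∑ O (λ g → ready g * hits (end b t) g)

  spokes≤1 : ∀ b t → spokes b t ≤ 1
  spokes≤1 b t = ≤-trans (∑-mono O λ {g} _ →
    ≤-trans (*-monoˡ-≤ (hits (end b t) g) (𝟙≤1 (ready? g))) (≤-reflexive (+-identityʳ _))) (inc≤1 dO (end b t))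

  augmentable : Edge → ℕ
  augmentable t = spokes lower t * spokes upper t

  length-O : length O ≤ 2 * length T + ∑ O untouched
  length-O = begin
    length O                                   ≡⟨ ∑-length O ⟨
    ∑ O (λ _ → 1)                              ≤⟨ ∑-mono O (λ {g} _ → one g) ⟩
    ∑ O (λ g → touches g + untouched g)        ≡⟨ ∑-+ O touches untouched ⟩
    ∑ O touches + ∑ O untouched                ≤⟨ +-monoˡ-≤ _ ∑-touches ⟩
    2 * length T + ∑ O untouched               ∎
    where
    open ≤-Reasoning
    one : ∀ g → 1 ≤ touches g + untouched g
    one g with free? A g
    ... | yes fr = ≤-trans (≤-reflexive (sym (𝟙-yes (yes fr) fr))) (m≤n+m _ (touches g))
    ... | no nf with a , p ← blocked {A} {g} nf = ≤-trans (touches-end a p) (m≤m+n _ _)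

  -- Each ready edge meets some `t`, and each `t` meets at most one at either end. For such 0/1
  -- counts `m + n ≤ 1 + m * n`, and the product indicates an augmenting path.
  ∑-ready : ∑ O ready ≤ length T + ∑ T augmentable
  ∑-ready = begin
    ∑ O ready                                                ≤⟨ ∑-mono O (λ {g} _ → reached g) ⟩
    ∑ O (λ g → ∑ T (λ t → ready g * link t g))               ≡⟨ ∑-swap O T (λ g t → ready g * link t g) ⟩
    ∑ T (λ t → ∑ O (λ g → ready g * link t g))               ≡⟨ ∑-cong T (λ {t} _ → trans
                                                                  (∑-cong O λ {g} _ → *-distribˡ-+ (ready g) (hits (lo t) g) _)
                                                                  (∑-+ O (λ g → ready g * hits (lo t) g) _)) ⟩
    ∑ T (λ t → spokes lower t + spokes upper t)              ≤⟨ ∑-mono T (λ {t} _ → both (spokes≤1 lower t) (spokes≤1 upper t)) ⟩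
    ∑ T (λ t → 1 + augmentable t)                            ≡⟨ ∑-+ T (λ _ → 1) augmentable ⟩
    ∑ T (λ _ → 1) + ∑ T augmentable                          ≡⟨ cong (_+ ∑ T augmentable) (∑-length T) ⟩
    length T + ∑ T augmentable                               ∎
    where
    open ≤-Reasoning
    both : ∀ {m n} → m ≤ 1 → n ≤ 1 → m + n ≤ 1 + m * n
    both z≤n               q                 = q
    both {n = zero}  (s≤s z≤n) z≤n           = s≤s z≤n
    both {n = suc _} (s≤s z≤n) (s≤s z≤n)     = ≤-refl
    reached : ∀ g → ready g ≤ ∑ T (λ t → ready g * link t g)
    reached g rewrite ∑-*ˡ T (ready g) (λ t → link t g) with ready? g
    ... | no nr rewrite 𝟙-no (no nr) nr = z≤n
    ... | yes r@(_ , a , p , _) rewrite 𝟙-yes (yes r) r | +-identityʳ (touches g) = touches-end a p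

  -- Every edge of `O` collects two units: twice as untouched, twice through two touched ends, or
  -- once through one touched end and once as ready or early. If greedy does badly, so that `T` has
  -- about half the size of `O`, nearly all of `T` must be augmentable.
  ∑-augmentable : (∀ {g} → g ∈ O → g ∈ first ⊎ g ∈ R) →
                  2 * length O ≤ ∑ T augmentable + 3 * length T + 2 * ∑ O untouched + ∑ O early
  ∑-augmentable cover = begin
    2 * length O
      ≡⟨ trans (*-comm 2 (length O)) (sym (∑-const O 2)) ⟩
    ∑ O (λ _ → 2)
      ≤⟨ ∑-mono O two ⟩
    ∑ O (λ g → ready g + (touches g + (2 * untouched g + early g)))
      ≡⟨ trans (∑-+ O ready _) (cong (∑ O ready +_) (trans (∑-+ O touches _) (cong (∑ O touches +_)
           (trans (∑-+ O (λ g → 2 * untouched g) early) (cong (_+ ∑ O early) (∑-*ˡ O 2 untouched)))))) ⟩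
    ∑ O ready + (∑ O touches + (2 * ∑ O untouched + ∑ O early))
      ≤⟨ +-mono-≤ ∑-ready (+-monoˡ-≤ _ ∑-touches) ⟩
    length T + ∑ T augmentable + (2 * length T + (2 * ∑ O untouched + ∑ O early))
      ≡⟨ regroup (length T) (∑ T augmentable) (∑ O untouched) (∑ O early) ⟩
    ∑ T augmentable + 3 * length T + 2 * ∑ O untouched + ∑ O early ∎
    where
    open ≤-Reasoning
    regroup : ∀ t g c d → t + g + (2 * t + (2 * c + d)) ≡ g + 3 * t + 2 * c + d
    regroup = solve-∀
    once : ∀ {g} a → end a g ∈ A → end (opposite a) g ∉ A → g ∈ first ⊎ g ∈ R →
           2 ≤ ready g + (touches g + (2 * untouched g + early g))
    once {g} a p q (inj₂ g∈R) = +-mono-≤ (≤-reflexive (sym (𝟙-yes (ready? g) (g∈R , a , p , q))))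
                                         (≤-trans (touches-end a p) (m≤m+n _ _))
    once {g} a p q (inj₁ g∈f) = ≤-trans (+-mono-≤ (touches-end a p)
                                          (≤-trans (≤-reflexive (sym (𝟙-yes (g ∈ᵉ? first) g∈f))) (m≤n+m _ (2 * untouched g))))
                                        (m≤n+m _ (ready g))
    two : ∀ {g} → g ∈ O → 2 ≤ ready g + (touches g + (2 * untouched g + early g))
    two {g} g∈ with lo g ∈? A | hi g ∈? A
    ... | no p | no q rewrite 𝟙-yes (free? A g) (p , q) =
      ≤-trans (m≤m+n 2 (early g)) (≤-trans (m≤n+m _ (touches g)) (m≤n+m _ (ready g)))
    ... | yes p | yes q = ≤-trans (≤-trans (+-mono-≤ (inc-inside p) (inc-inside q)) (≤-reflexive (sym (∑-link g))))
                                  (≤-trans (m≤m+n (touches g) _) (m≤n+m _ (ready g)))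
    ... | yes p | no q = once lower p q (cover g∈)
    ... | no p | yes q = once upper q p (cover g∈)

  contested : Edge → Colouring → ℕ
  contested t κ = ∑ O (λ g → ready g * (link t g * load (reach (L₀ t κ)) g))

  -- As `augmentable t` is 0 or 1, truncated subtraction yields the indicator of an augmentable `t`
  -- for which `contested` vanishes.
  good : Edge → Colouring → ℕ
  good t κ = augmentable t ∸ contested t κ

  -- The restriction to kept `t` replaces all the sets `reach (L₀ t κ)` by the one set
  -- `reach (L κ)`. Each of its entries lies on at most one edge of `O`, which shares at most 2
  -- endpoints with `T`; it has 4 entries per edge of `M κ`, and `M κ` has at most 2 edges per
  -- sacrificed edge: 16 in total.
  ∑-contested : ∀ κ → ∑ T (λ t → contested t κ * kept (κ t)) ≤ 16 * ∑ T (λ t → sacrificed (κ t))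
  ∑-contested κ = begin
    ∑ T (λ t → contested t κ * kept (κ t))
      ≤⟨ ∑-mono T bound ⟩
    ∑ T (λ t → ∑ O (λ g → load X g * link t g))
      ≡⟨ ∑-swap T O (λ t g → load X g * link t g) ⟩
    ∑ O (λ g → ∑ T (λ t → load X g * link t g))
      ≤⟨ ∑-mono O (λ {g} _ → ≤-trans (≤-reflexive (∑-*ˡ T (load X g) (λ t → link t g)))
                            (≤-trans (*-monoʳ-≤ (load X g) (∑-link≤2 g)) (≤-reflexive (*-comm (load X g) 2)))) ⟩
    ∑ O (λ g → 2 * load X g)
      ≡⟨ ∑-*ˡ O 2 (load X) ⟩
    2 * ∑ O (load X)
      ≤⟨ *-monoʳ-≤ 2 (∑-load dO X) ⟩
    2 * length X
      ≡⟨ cong (2 *_) (length-reach (L κ)) ⟩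
    2 * (4 * length (M κ))
      ≤⟨ *-monoʳ-≤ 2 (*-monoʳ-≤ 4 (length-M κ)) ⟩
    2 * (4 * (2 * ∑ T (λ t → sacrificed (κ t))))
      ≡⟨ sixteen (∑ T (λ t → sacrificed (κ t))) ⟩
    16 * ∑ T (λ t → sacrificed (κ t)) ∎
    where
    open ≤-Reasoning
    X : List ℕ
    X = reach (L κ)
    sixteen : ∀ n → 2 * (4 * (2 * n)) ≡ 16 * n
    sixteen = solve-∀
    uncontested : ∀ {t} → t ∈ T → (∀ a → κ t ≢ care a) → contested t κ ≤ ∑ O (λ g → load X g * link t g)
    uncontested {t} t∈ keep rewrite L₀-kept {t} {κ} t∈ keep = ∑-mono O λ {g} _ →
      ≤-trans (*-monoˡ-≤ (link t g * load X g) (𝟙≤1 (ready? g)))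
              (≤-reflexive (trans (+-identityʳ _) (*-comm (link t g) (load X g))))
    bound : ∀ {t} → t ∈ T → contested t κ * kept (κ t) ≤ ∑ O (λ g → load X g * link t g)
    bound {t} t∈ = at (κ t) refl
      where
      at : ∀ c → κ t ≡ c → contested t κ * kept c ≤ ∑ O (λ g → load X g * link t g)
      at (care a) eq = ≤-trans (≤-reflexive (*-zeroʳ (contested t κ))) z≤n
      at pass eq     = ≤-trans (≤-reflexive (*-identityʳ _)) (uncontested t∈ λ a p → case-pass a (trans (sym eq) p))
        where
        case-pass : ∀ a → pass ≢ care a
        case-pass a ()
      at skip eq     = ≤-trans (≤-reflexive (*-identityʳ _)) (uncontested t∈ λ a p → case-skip a (trans (sym eq) p))
        where
        case-skip : ∀ a → skip ≢ care a
        case-skip a ()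

  good-ignores : ∀ {t e} → t ∈ T → (∃ λ a → ∃ λ b → end a e ≡ end b t) → Ignores e (good t)
  good-ignores {t} t∈ touch κ κ′ agree =
    cong (λ l → augmentable t ∸ ∑ O (λ g → ready g * (link t g * load (reach l) g)))
         (L₀-cong t∈ touch agree)

  contested-ignores : ∀ {t} → t ∈ T → Ignores t (contested t)
  contested-ignores {t} t∈ κ κ′ agree =
    cong (λ l → ∑ O (λ g → ready g * (link t g * load (reach l) g)))
         (L₀-cong t∈ (lower , lower , refl) agree)

  good≤1 : ∀ t κ → good t κ ≤ 1
  good≤1 t κ = ≤-trans (m∸n≤m _ (contested t κ)) (product≤1 (spokes≤1 lower t) (spokes≤1 upper t))

  record Partner (t : Edge) (b : Side) : Set where
    field
      partner : Edge
      tip     : ℕ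
      arm     : Spoke t b tip partner
      ∈O      : partner ∈ O
      ∈R      : partner ∈ R
      isReady : 1 ≤ ready partner

  find-partner : ∀ {t b} → t ∈ T → 1 ≤ spokes b t → Partner t b
  find-partner {t} {b} t∈ pos
    with g , g∈ , p ← ∑-positive O (λ g → ready g * hits (end b t) g) pos
    with r , h ← product-positive (ready g) _ p
    with g∈R , a , in-A , out ← 𝟙-witness (ready? g) r
    with c , hub ← hits-witness (end b t) g h
    with same-or-opposite a c
  ... | inj₁ refl = record { arm = spoke a hub refl out ; ∈O = g∈ ; ∈R = g∈R ; isReady = r }
  ... | inj₂ refl = contradiction (subst (_∈ A) (sym hub) (T-end b t∈)) out

  -- A common tip would make the partners the same edge of the matching `O`, and that edge has only
  -- one hub.
  partners-apart : ∀ {t} → t ∈ T → ∀ b (p : Partner t b) (q : Partner t (opposite b)) →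
                   Partner.tip p ≢ Partner.tip q
  partners-apart {t} t∈ b p q eq
    with spoke s hub refl out ← Partner.arm p | spoke s′ hub′ tip′ out′ ← Partner.arm q
    with refl ← matching-unique dO (Partner.∈O p) (Partner.∈O q) (opposite s) (opposite s′) (trans eq (sym tip′))
    with _ , b≡ , _ ← spoke-same t∈ t∈ (Partner.arm p) (Partner.arm q) = opposite-≢ b (sym b≡)

  module Good {t : Edge} (t∈ : t ∈ T) (p : ∀ b → Partner t b) where

    g : Side → Edge
    g b = Partner.partner (p b)

    x : Side → ℕ
    x b = Partner.tip (p b)

    clear : ∀ {κ} → 1 ≤ good t κ → ∀ b → x b ∉ reach (L₀ t κ)
    clear {κ} pos b x∈ = <-irrefl refl (≤-trans (≤-trans (s≤s z≤n) pos) (≤-reflexive (m≤n⇒m∸n≡0 small)))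
      where
      small : augmentable t ≤ contested t κ
      small = begin
        augmentable t   ≤⟨ product≤1 (spokes≤1 lower t) (spokes≤1 upper t) ⟩
        1               ≤⟨ *-mono-≤ (Partner.isReady (p b)) (*-mono-≤ (spoke-link (Partner.arm (p b)))
                             (load-end (opposite (Spoke.side (Partner.arm (p b))))
                               (subst (_∈ reach (L₀ t κ)) (sym (Spoke.tip (Partner.arm (p b)))) x∈))) ⟩
        ready (g b) * (link t (g b) * load (reach (L₀ t κ)) (g b))
                        ≤⟨ term≤∑ (λ g → ready g * (link t g * load (reach (L₀ t κ)) g)) (Partner.∈O (p b)) ⟩
        contested t κ   ∎
        where open ≤-Reasoning

    enters-L : ∀ {κ a b y e} → e ∈ R → κ t ≡ care a → Spoke t b y e → a ≢ b ⊎ κ e ≢ skip → e ∈ L κ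
    enters-L {κ} e∈R κt s ok = ∈-filter⁺ (admissible? κ) e∈R (admissible t∈ κt s ok)

    dM : ∀ κ → AllPairs Disjoint (M κ)
    dM κ = greedy-matching [] (L κ)

    M-pos : ∀ {κ} b → end b t ∈ after [] (L κ) → 1 ≤ inc (M κ) (end b t)
    M-pos {κ} b ∈U with after-witness [] (L κ) ∈U
    ... | inj₂ (e , e∈ , c , hub) = subst (λ w → 1 ≤ inc (M κ) w) hub (inc-positive c e∈)

    matched-pair : ∀ a κ → matched t κ ≡ inc (M κ) (end a t) + inc (M κ) (end (opposite a) t)
    matched-pair lower κ = matched≡ t κ
    matched-pair upper κ = trans (matched≡ t κ) (+-comm (inc (M κ) (lo t)) _)

    steal : ∀ {κ} b c d {e} → c ≡ opposite b → 1 ≤ good t κ → e ∈ L κ → Spoke t b (x d) e →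
            end b t ∉ after [] (L κ) → ∃ λ e′ → e′ ∈ M κ × Spoke t c (x d) e′
    steal {κ} b c d refl pos e∈ s unmatched = taken t∈ e∈ s (clear {κ} pos d) unmatched

    -- The endpoint that is not careful admits its edge of `O` whatever the letter. If it stays
    -- unmatched, the tip of that edge went to the careful endpoint, which is then matched.
    one-matched : ∀ {κ a} → 1 ≤ good t κ → κ t ≡ care a → 1 ≤ matched t κ
    one-matched {κ} {a} pos κt rewrite matched-pair a κ with end (opposite a) t ∈? after [] (L κ)
    ... | yes ∈U = ≤-trans (M-pos {κ} (opposite a) ∈U) (m≤n+m _ (inc (M κ) (end a t)))
    ... | no ∉U
      with e′ , e′∈ , s ← steal {κ} (opposite a) a (opposite a) (sym (opposite-opposite a)) pos
             (enters-L {κ} (Partner.∈R (p (opposite a))) κt (Partner.arm (p (opposite a))) (inj₁ (opposite-≢ a ∘ sym)))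
             (Partner.arm (p (opposite a))) ∉U
      = ≤-trans (subst (λ w → 1 ≤ inc (M κ) w) (Spoke.hub s) (inc-positive (Spoke.side s) e′∈)) (m≤m+n _ _)

    both-matched : ∀ {κ} a → (end a t ∉ after [] (L κ) → ⊥) → (end (opposite a) t ∉ after [] (L κ) → ⊥) →
                   2 ≤ matched t κ
    both-matched {κ} a v u rewrite matched-pair a κ
      with end a t ∈? after [] (L κ) | end (opposite a) t ∈? after [] (L κ)
    ... | no ∉U | _      = contradiction ∉U v
    ... | yes _ | no ∉U  = contradiction ∉U u
    ... | yes v∈ | yes u∈ = +-mono-≤ (M-pos {κ} a v∈) (M-pos {κ} (opposite a) u∈)

    Cross : Side → Side → Set
    Cross b d = ∃ λ e → e ∈ R × Spoke t b (x d) e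

    cross? : ∀ b d → Dec (Cross b d)
    cross? b d with Any.any? (spoke? t b (x d)) R
    ... | yes any with e , e∈ , q , hub , tip ← find any = yes (e , e∈ , spoke q hub tip (Spoke.outside (Partner.arm (p d))))
    ... | no none = no λ (e , e∈ , s) → none (lose e∈ (Spoke.side s , Spoke.hub s , Spoke.tip s))

    -- A condition on three letters, those of `t`, `j₁` and `j₂`, under which both endpoints are
    -- matched. The edges are distinct, so the letters are independent and the condition holds with
    -- probability at least `1/Z * N/Z * N/Z`. Which side is careful and what is wished for `j₁`
    -- depend on the edges between the endpoints and the two tips.
    record Bonus : Set where
      field
        a          : Side
        j₁ j₂      : Edge
        b₁ b₂      : Side
        x₁ x₂      : ℕ
        s₁         : Spoke t b₁ x₁ j₁
        s₂         : Spoke t b₂ x₂ j₂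
        j₁∈R       : j₁ ∈ R
        j₂∈R       : j₂ ∈ R
        j₁≢j₂      : j₁ ≢ j₂
        wish       : Letter → ℕ
        wish-cases : wish ≡ skips ⊎ wish ≡ passes
        doubled    : ∀ κ → 1 ≤ good t κ → κ t ≡ care a → 1 ≤ wish (κ j₁) → 1 ≤ passes (κ j₂) →
                     2 ≤ matched t κ

    arm : ∀ b → Spoke t b (x b) (g b)
    arm b = Partner.arm (p b)

    g∈R : ∀ b → g b ∈ R
    g∈R b = Partner.∈R (p b)

    apart : ∀ b → x b ≢ x (opposite b)
    apart b = partners-apart t∈ b (p b) (p (opposite b))

    skips-witness : ∀ {c} → 1 ≤ skips c → c ≡ skip
    skips-witness {c} = 𝟙-witness (c ≟ˡ skip)

    passes-witness : ∀ {c} → 1 ≤ passes c → c ≢ skip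
    passes-witness {c} = 𝟙-witness (¬? (c ≟ˡ skip))

    -- The careful endpoint declines the only edge that could rob its partner.
    decline-bonus : ∀ a → ¬ Cross (opposite a) a → Bonus
    decline-bonus a none = choose (cross? a (opposite a))
      where
      u-side : ∀ κ → 1 ≤ good t κ → κ t ≡ care a → (∀ {e} → e ∈ M κ → ¬ Spoke t a (x (opposite a)) e) →
               end (opposite a) t ∉ after [] (L κ) → ⊥
      u-side κ pos κt absent ∉U
        with e′ , e′∈ , s ← steal {κ} (opposite a) a (opposite a) (sym (opposite-opposite a)) pos
               (enters-L {κ} (g∈R (opposite a)) κt (arm (opposite a)) (inj₁ (opposite-≢ a ∘ sym))) (arm (opposite a)) ∉U
        = absent e′∈ s
      v-side : ∀ κ → 1 ≤ good t κ → κ t ≡ care a → κ (g a) ≢ skip → end a t ∉ after [] (L κ) → ⊥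
      v-side κ pos κt keep ∉U
        with e′ , e′∈ , s ← steal {κ} a (opposite a) a refl pos (enters-L {κ} (g∈R a) κt (arm a) (inj₂ keep)) (arm a) ∉U
        = none (e′ , proj₁ (∈-L⁻ {κ} (M⊆L {κ} e′∈)) , s)
      choose : Dec (Cross a (opposite a)) → Bonus
      -- Without a cross edge there is nothing to decline. `j₁` is a default here, the edge of `O`
      -- at the endpoint that is not careful; asking it to be `skip` keeps the form of the other
      -- case.
      choose (no nc) = record
        { a = a ; j₁ = g (opposite a) ; j₂ = g a ; s₁ = arm (opposite a) ; s₂ = arm a
        ; j₁∈R = g∈R (opposite a) ; j₂∈R = g∈R a
        ; j₁≢j₂ = λ eq → opposite-≢ a (proj₁ (proj₂ (spoke-same t∈ t∈ (arm (opposite a)) (subst (Spoke t a (x a)) (sym eq) (arm a)))))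
        ; wish = skips ; wish-cases = inj₁ refl
        ; doubled = λ κ pos κt _ keep → both-matched {κ} a
            (v-side κ pos κt (passes-witness keep))
            (u-side κ pos κt (λ e∈ s → nc (_ , proj₁ (∈-L⁻ {κ} (M⊆L {κ} e∈)) , s))) }
      choose (yes (j , j∈ , s)) = record
        { a = a ; j₁ = j ; j₂ = g a ; s₁ = s ; s₂ = arm a ; j₁∈R = j∈ ; j₂∈R = g∈R a
        ; j₁≢j₂ = λ eq → apart a (sym (proj₂ (proj₂ (spoke-same t∈ t∈ s (subst (Spoke t a (x a)) (sym eq) (arm a))))))
        ; wish = skips ; wish-cases = inj₁ refl
        ; doubled = λ κ pos κt declined keep → both-matched {κ} a
            (v-side κ pos κt (passes-witness keep))
            (u-side κ pos κt (λ e∈ s′ → barred κ κt (skips-witness declined) (spoke-unique s′ s) (proj₂ (∈-L⁻ {κ} (M⊆L {κ} e∈))))) }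
        where
        barred : ∀ κ → κ t ≡ care a → κ j ≡ skip → ∀ {e} → e ≡ j → Admissible κ e → ⊥
        barred κ κt κj refl adm
          with t′ , t′∈ , a′ , κt′ , b′ , x′ , s′ , ok ← admissible⁻ adm
          with refl , refl , refl ← spoke-same t∈ t′∈ s s′
          with refl ← trans (sym κt) κt′
          with ok
        ... | inj₁ ne = ne refl
        ... | inj₂ ns = ns κj

    -- With both cross edges present a robbed endpoint would need its partner to
    -- take two edges.
    square-bonus : (∀ b → Cross b (opposite b)) → Bonus
    square-bonus cross = record
      { a = lower ; j₁ = c lower ; j₂ = g lower ; s₁ = c-spoke lower ; s₂ = arm lower
      ; j₁∈R = c∈R lower ; j₂∈R = g∈R lower
      ; j₁≢j₂ = λ eq → apart lower (sym (proj₂ (proj₂ (spoke-same t∈ t∈ (c-spoke lower)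
                  (subst (Spoke t lower (x lower)) (sym eq) (arm lower))))))
      ; wish = passes ; wish-cases = inj₂ refl
      ; doubled = λ κ pos κt keep₁ keep₂ → both-matched {κ} lower
          (λ ∉U → clash κ lower upper refl pos
             (enters-L {κ} (g∈R lower) κt (arm lower) (inj₂ (passes-witness keep₂)))
             (enters-L {κ} (c∈R lower) κt (c-spoke lower) (inj₂ (passes-witness keep₁))) ∉U)
          (λ ∉U → clash κ upper lower refl pos
             (enters-L {κ} (g∈R upper) κt (arm upper) (inj₁ λ ()))
             (enters-L {κ} (c∈R upper) κt (c-spoke upper) (inj₁ λ ())) ∉U) }
      where
      c : Side → Edge
      c b = proj₁ (cross b)
      c∈R : ∀ b → c b ∈ R
      c∈R b = proj₁ (proj₂ (cross b))
      c-spoke : ∀ b → Spoke t b (x (opposite b)) (c b)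
      c-spoke b = proj₂ (proj₂ (cross b))
      clash : ∀ κ b d → d ≡ opposite b → 1 ≤ good t κ → g b ∈ L κ → c b ∈ L κ → end b t ∉ after [] (L κ) → ⊥
      clash κ b d eq pos g∈ c∈ ∉U
        with e₁ , e₁∈ , s₁ ← steal {κ} b d b eq pos g∈ (arm b) ∉U
        with e₂ , e₂∈ , s₂ ← steal {κ} b d (opposite b) eq pos c∈ (c-spoke b) ∉U
        with refl ← matching-unique (dM κ) e₁∈ e₂∈ (Spoke.side s₁) (Spoke.side s₂) (trans (Spoke.hub s₁) (sym (Spoke.hub s₂)))
        = apart b (proj₂ (proj₂ (spoke-same t∈ t∈ s₁ s₂)))

    bonus : Bonus
    bonus with cross? upper lower | cross? lower upper
    ... | no none | _       = decline-bonus lower none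
    ... | yes _   | no none = decline-bonus upper none
    ... | yes c   | yes d   = square-bonus λ { lower → d ; upper → c }

-- Averages over the letters for a fixed arrival order

sacrificed≤1 : ∀ c → sacrificed c ≤ 1
sacrificed≤1 (care _) = ≤-refl
sacrificed≤1 pass     = z≤n
sacrificed≤1 skip     = z≤n

sacrificed-witness : ∀ c → 1 ≤ sacrificed c → ∃ λ a → c ≡ care a
sacrificed-witness (care a) _ = a , refl

module _ (N : ℕ) where

  ∑-sacrificed : ∑ (alphabet N) sacrificed ≡ 2
  ∑-sacrificed = trans (∑-alphabet N sacrificed) (cong (2 +_) (cong₂ _+_ (*-zeroʳ N) (*-zeroʳ N)))

  ∑-kept : ∑ (alphabet N) kept ≡ 2 * N
  ∑-kept = trans (∑-alphabet N kept) (double N)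
    where
    double : ∀ n → n * 1 + n * 1 ≡ 2 * n
    double = solve-∀

  ∑-careful : ∀ a → 1 ≤ ∑ (alphabet N) (careful a)
  ∑-careful lower = ≤-trans (≤-reflexive (sym (𝟙-yes (care lower ≟ˡ care lower) refl)))
    (≤-trans (m≤m+n _ _) (≤-reflexive (sym (∑-alphabet N (careful lower)))))
  ∑-careful upper = ≤-trans (≤-reflexive (sym (𝟙-yes (care upper ≟ˡ care upper) refl)))
    (≤-trans (≤-trans (m≤m+n _ _) (m≤n+m _ (careful upper (care lower)))) (≤-reflexive (sym (∑-alphabet N (careful upper)))))

  ∑-wish : ∀ {w} → w ≡ skips ⊎ w ≡ passes → N ≤ ∑ (alphabet N) w
  ∑-wish {w} cases = ≤-trans (large cases) (≤-reflexive (sym (∑-alphabet N w)))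
    where
    large : w ≡ skips ⊎ w ≡ passes → N ≤ w (care lower) + (w (care upper) + (N * w pass + N * w skip))
    large (inj₁ refl) rewrite 𝟙-yes (skip ≟ˡ skip) refl | *-identityʳ N =
      ≤-trans (m≤n+m N (N * skips pass)) (≤-trans (m≤n+m _ (skips (care upper))) (m≤n+m _ (skips (care lower))))
    large (inj₂ refl) rewrite 𝟙-yes (¬? (pass ≟ˡ skip)) (λ ()) | *-identityʳ N =
      ≤-trans (m≤m+n N (N * passes skip)) (≤-trans (m≤n+m _ (passes (care upper))) (m≤n+m _ (passes (care lower))))

-- For `z` letters, `B / z³ = 2/z + N²/z³` bounds from below the mean number of matched endpoints of
-- a good `t`. `D` is the common denominator, and `Q` is the numerator of the same fraction over
-- `D`. With `z = 2 + 2N`, `Y = z - 1` counts the first letters that select greedy.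
module Scale (N z : ℕ) where

  B D Q Y : ℕ
  B = 2 * (z * z) + N * N
  D = N * (z * z * z)
  Q = N * B
  Y = 1 + (N + N)

module Average (N : ℕ) (first R O : List Edge) (dO : AllPairs Disjoint O) where

  open FirstPhase first
  open SecondPhase R
  open Analysis first R O dO

  σ : List Edge
  σ = first ++ R

  Z Ω : ℕ
  Z = size N
  Ω = ∑ᶜ N σ (λ _ → 1)

  open Scale N Z public using (B)

  Eᶜ : (Colouring → ℕ) → ℕ
  Eᶜ = ∑ᶜ N σ

  T⊆σ : ∀ {t} → t ∈ T → t ∈ σ
  T⊆σ t∈ = ∈-++⁺ˡ (greedy-⊆ [] first t∈)

  R⊆σ : ∀ {e} → e ∈ R → e ∈ σ
  R⊆σ = ∈-++⁺ʳ first

  Eᶜ-const : ∀ a → Eᶜ (λ _ → a) ≡ a * Ω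
  Eᶜ-const a = trans (∑ᶜ-cong N σ (λ _ → sym (*-identityʳ a))) (∑ᶜ-*ˡ N σ a (λ _ → 1))

  Eᶜ-sacrificed : ∀ {t} → t ∈ T → Z * Eᶜ (λ κ → sacrificed (κ t)) ≡ 2 * Ω
  Eᶜ-sacrificed {t} t∈ = begin
    Z * Eᶜ (λ κ → sacrificed (κ t))       ≡⟨ cong (Z *_) (∑ᶜ-cong N σ (λ κ → sym (+-identityʳ _))) ⟩
    Z * Eᶜ (λ κ → 1 * sacrificed (κ t))   ≡⟨ independent N (λ _ → 1) sacrificed (T⊆σ t∈) (λ _ _ _ → refl) ⟩
    ∑ (alphabet N) sacrificed * Ω        ≡⟨ cong (_* Ω) (∑-sacrificed N) ⟩
    2 * Ω                                ∎
    where open ≡-Reasoning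

  ∑-Eᶜ-sacrificed : Z * Eᶜ (λ κ → ∑ T (λ t → sacrificed (κ t))) ≡ 2 * Ω * length T
  ∑-Eᶜ-sacrificed = begin
    Z * Eᶜ (λ κ → ∑ T (λ t → sacrificed (κ t)))     ≡⟨ cong (Z *_) (∑ᶜ-swap N σ T (λ κ t → sacrificed (κ t))) ⟩
    Z * ∑ T (λ t → Eᶜ (λ κ → sacrificed (κ t)))     ≡⟨ ∑-*ˡ T Z (λ t → Eᶜ (λ κ → sacrificed (κ t))) ⟨
    ∑ T (λ t → Z * Eᶜ (λ κ → sacrificed (κ t)))     ≡⟨ ∑-cong T Eᶜ-sacrificed ⟩
    ∑ T (λ _ → 2 * Ω)                              ≡⟨ trans (∑-const T (2 * Ω)) (*-comm (length T) _) ⟩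
    2 * Ω * length T                               ∎
    where open ≡-Reasoning

  -- `contested t` ignores the letter of `t`, so its mean may be taken over colourings that keep
  -- `t`. These have probability `2N/Z`, against `2/Z` for a sacrifice: the quotient is the factor
  -- `1/N` that makes competition rare.
  Eᶜ-contested : N * ∑ T (λ t → Eᶜ (contested t)) ≤ 16 * Ω * length T
  Eᶜ-contested = *-cancelˡ-≤ 2 (begin
    2 * (N * ∑ T (λ t → Eᶜ (contested t)))                     ≡⟨ trans (sym (*-assoc 2 N _)) (sym (∑-*ˡ T (2 * N) (λ t → Eᶜ (contested t)))) ⟩
    ∑ T (λ t → 2 * N * Eᶜ (contested t))                       ≡⟨ ∑-cong T (λ {t} t∈ → trans (cong (_* Eᶜ (contested t)) (sym (∑-kept N)))
                                                                   (sym (independent N (contested t) kept (T⊆σ t∈) (contested-ignores t∈)))) ⟩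
    ∑ T (λ t → Z * Eᶜ (λ κ → contested t κ * kept (κ t)))      ≡⟨ ∑-*ˡ T Z (λ t → Eᶜ (λ κ → contested t κ * kept (κ t))) ⟩
    Z * ∑ T (λ t → Eᶜ (λ κ → contested t κ * kept (κ t)))      ≡⟨ cong (Z *_) (∑ᶜ-swap N σ T (λ κ t → contested t κ * kept (κ t))) ⟨
    Z * Eᶜ (λ κ → ∑ T (λ t → contested t κ * kept (κ t)))      ≤⟨ *-monoʳ-≤ Z (∑ᶜ-mono N σ ∑-contested) ⟩
    Z * Eᶜ (λ κ → 16 * ∑ T (λ t → sacrificed (κ t)))           ≡⟨ cong (Z *_) (∑ᶜ-*ˡ N σ 16 (λ κ → ∑ T (λ t → sacrificed (κ t)))) ⟩
    Z * (16 * Eᶜ (λ κ → ∑ T (λ t → sacrificed (κ t))))         ≡⟨ exchange Z _ ⟩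
    16 * (Z * Eᶜ (λ κ → ∑ T (λ t → sacrificed (κ t))))         ≡⟨ cong (16 *_) ∑-Eᶜ-sacrificed ⟩
    16 * (2 * Ω * length T)                                   ≡⟨ regroup Ω (length T) ⟩
    2 * (16 * Ω * length T)                                   ∎)
    where
    open ≤-Reasoning
    exchange : ∀ z e → z * (16 * e) ≡ 16 * (z * e)
    exchange = solve-∀
    regroup : ∀ w t → 16 * (2 * w * t) ≡ 2 * (16 * w * t)
    regroup = solve-∀

  Eᶜ-doubled : ∀ {t} (t∈ : t ∈ T) (partners : ∀ b → Partner t b) → Good.Bonus t∈ partners →
               B * Eᶜ (good t) ≤ Z * Z * Z * Eᶜ (matched t)
  Eᶜ-doubled {t} t∈ partners bonus = begin
    B * Eᶜ (good t)
      ≡⟨ split Z N (Eᶜ (good t)) ⟩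
    Z * Z * (2 * Eᶜ (good t)) + N * (N * Eᶜ (good t))
      ≤⟨ +-mono-≤ (≤-reflexive (cong (Z * Z *_) (sym base))) (*-monoʳ-≤ N (*-monoʳ-≤ N stage₁)) ⟩
    Z * Z * (Z * Eᶜ F₀) + N * (N * (Z * Eᶜ F₁))
      ≤⟨ +-monoʳ-≤ (Z * Z * (Z * Eᶜ F₀)) (*-monoʳ-≤ N (≤-trans (≤-reflexive (exchange N Z _)) (*-monoʳ-≤ Z stage₂))) ⟩
    Z * Z * (Z * Eᶜ F₀) + N * (Z * (Z * Eᶜ F₂))
      ≤⟨ +-monoʳ-≤ (Z * Z * (Z * Eᶜ F₀)) (≤-trans (≤-reflexive (rotate N Z _)) (*-monoʳ-≤ Z (*-monoʳ-≤ Z stage₃))) ⟩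
    Z * Z * (Z * Eᶜ F₀) + Z * (Z * (Z * Eᶜ F₃))
      ≡⟨ collect Z (Eᶜ F₀) (Eᶜ F₃) ⟩
    Z * Z * Z * (Eᶜ F₀ + Eᶜ F₃)
      ≡⟨ cong (Z * Z * Z *_) (∑ᶜ-+ N σ F₀ F₃) ⟨
    Z * Z * Z * Eᶜ (λ κ → F₀ κ + F₃ κ)
      ≤⟨ *-monoʳ-≤ (Z * Z * Z) (∑ᶜ-mono N σ pointwise) ⟩
    Z * Z * Z * Eᶜ (matched t) ∎
    where
    open ≤-Reasoning
    open Good t∈ partners using (module Bonus; one-matched)
    open Bonus bonus
    -- `F₀` implies one matched endpoint and `F₃` implies two. From `F₁` to `F₃` one letter is
    -- prescribed at a time, each independent of everything prescribed before.
    F₀ F₁ F₂ F₃ : Colouring → ℕ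
    F₀ κ = good t κ * sacrificed (κ t)
    F₁ κ = good t κ * careful a (κ t)
    F₂ κ = F₁ κ * wish (κ j₁)
    F₃ κ = F₂ κ * passes (κ j₂)
    split : ∀ z n g → (2 * (z * z) + n * n) * g ≡ z * z * (2 * g) + n * (n * g)
    split = solve-∀
    exchange : ∀ n z f → n * (z * f) ≡ z * (n * f)
    exchange = solve-∀
    rotate : ∀ n z f → n * (z * (z * f)) ≡ z * (z * (n * f))
    rotate = solve-∀
    collect : ∀ z f g → z * z * (z * f) + z * (z * (z * g)) ≡ z * z * z * (f + g)
    collect = solve-∀
    touch₁ : ∃ λ c → ∃ λ b → end c j₁ ≡ end b t
    touch₁ = Spoke.side s₁ , b₁ , Spoke.hub s₁
    touch₂ : ∃ λ c → ∃ λ b → end c j₂ ≡ end b t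
    touch₂ = Spoke.side s₂ , b₂ , Spoke.hub s₂
    t≢j₁ : t ≢ j₁
    t≢j₁ = spoke-≢ t∈ s₁ ∘ sym
    t≢j₂ : t ≢ j₂
    t≢j₂ = spoke-≢ t∈ s₂ ∘ sym
    base : Z * Eᶜ F₀ ≡ 2 * Eᶜ (good t)
    base = trans (independent N (good t) sacrificed (T⊆σ t∈) (good-ignores t∈ (lower , lower , refl)))
                 (cong (_* Eᶜ (good t)) (∑-sacrificed N))
    stage₁ : Eᶜ (good t) ≤ Z * Eᶜ F₁
    stage₁ = begin
      Eᶜ (good t)                              ≡⟨ +-identityʳ _ ⟨
      1 * Eᶜ (good t)                          ≤⟨ *-monoˡ-≤ (Eᶜ (good t)) (∑-careful N a) ⟩
      ∑ (alphabet N) (careful a) * Eᶜ (good t) ≡⟨ independent N (good t) (careful a) (T⊆σ t∈) (good-ignores t∈ (lower , lower , refl)) ⟨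
      Z * Eᶜ F₁                                ∎
    stage₂ : N * Eᶜ F₁ ≤ Z * Eᶜ F₂
    stage₂ = ≤-trans (*-monoˡ-≤ (Eᶜ F₁) (∑-wish N wish-cases))
      (≤-reflexive (sym (independent N F₁ wish (R⊆σ j₁∈R) λ κ κ′ agree →
        cong₂ _*_ (good-ignores t∈ touch₁ κ κ′ agree) (cong (careful a) (agree t t≢j₁)))))
    stage₃ : N * Eᶜ F₂ ≤ Z * Eᶜ F₃
    stage₃ = ≤-trans (*-monoˡ-≤ (Eᶜ F₂) (∑-wish N (inj₂ refl)))
      (≤-reflexive (sym (independent N F₂ passes (R⊆σ j₂∈R) λ κ κ′ agree →
        cong₂ _*_ (cong₂ _*_ (good-ignores t∈ touch₂ κ κ′ agree) (cong (careful a) (agree t t≢j₂)))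
                  (cong wish (agree j₁ j₁≢j₂)))))
    wish≤1 : ∀ c → wish c ≤ 1
    wish≤1 c with wish-cases
    ... | inj₁ refl = 𝟙≤1 (c ≟ˡ skip)
    ... | inj₂ refl = 𝟙≤1 (¬? (c ≟ˡ skip))
    pointwise : ∀ κ → F₀ κ + F₃ κ ≤ matched t κ
    pointwise κ = two-events
      (product≤1 (good≤1 t κ) (sacrificed≤1 (κ t)))
      (product≤1 (product≤1 (product≤1 (good≤1 t κ) (𝟙≤1 (κ t ≟ˡ care a))) (wish≤1 (κ j₁))) (𝟙≤1 (¬? (κ j₂ ≟ˡ skip))))
      once twice
      where
      once : 1 ≤ F₀ κ → 1 ≤ matched t κ
      once ge with g≥1 , s≥1 ← product-positive (good t κ) _ ge
              with b , κt ← sacrificed-witness (κ t) s≥1 = one-matched {κ} g≥1 κt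
      twice : 1 ≤ F₃ κ → 2 ≤ matched t κ
      twice ge with f₂ , pass≥1 ← product-positive (F₂ κ) _ ge
               with f₁ , wish≥1 ← product-positive (F₁ κ) _ f₂
               with g≥1 , care≥1 ← product-positive (good t κ) _ f₁
               = doubled κ g≥1 (𝟙-witness (κ t ≟ˡ care a) care≥1) wish≥1 pass≥1

  Eᶜ-matched : ∀ {t} → t ∈ T → B * Eᶜ (good t) ≤ Z * Z * Z * Eᶜ (matched t)
  Eᶜ-matched {t} t∈ with 1 ≤? augmentable t
  ... | yes pos = Eᶜ-doubled t∈ partners (Good.bonus t∈ partners)
    where
    partners : ∀ b → Partner t b
    partners lower = find-partner t∈ (proj₁ (product-positive (spokes lower t) _ pos))
    partners upper = find-partner t∈ (proj₂ (product-positive (spokes lower t) _ pos))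
  ... | no none = ≤-trans (≤-reflexive (trans (cong (B *_) vanish) (*-zeroʳ B))) z≤n
    where
    vanish : Eᶜ (good t) ≡ 0
    vanish = trans (∑ᶜ-cong N σ (λ κ → trans (cong (_∸ contested t κ) (n<1⇒n≡0 (≰⇒> none))) (0∸n≡0 (contested t κ)))) (Eᶜ-const 0)

  Eᶜ-gain : N * B * Ω * ∑ T augmentable ≤ N * (Z * Z * Z) * Eᶜ (λ κ → length (M κ)) + 16 * B * Ω * length T
  Eᶜ-gain = begin
    N * B * Ω * ∑ T augmentable
      ≡⟨ trans (*-assoc (N * B) Ω _) (cong (N * B *_) (trans (sym (∑-*ˡ T Ω augmentable))
           (∑-cong T λ {t} _ → trans (*-comm Ω _) (sym (Eᶜ-const (augmentable t)))))) ⟩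
    N * B * ∑ T (λ t → Eᶜ (λ _ → augmentable t))
      ≤⟨ *-monoʳ-≤ (N * B) (∑-mono T λ {t} _ → ≤-trans
           (∑ᶜ-mono N σ λ κ → ≤-trans (m≤n+m∸n (augmentable t) (contested t κ)) (≤-reflexive (+-comm (contested t κ) _)))
           (≤-reflexive (∑ᶜ-+ N σ (good t) (contested t)))) ⟩
    N * B * ∑ T (λ t → Eᶜ (good t) + Eᶜ (contested t))
      ≡⟨ cong (N * B *_) (∑-+ T (λ t → Eᶜ (good t)) (λ t → Eᶜ (contested t))) ⟩
    N * B * (∑ T (λ t → Eᶜ (good t)) + ∑ T (λ t → Eᶜ (contested t)))
      ≡⟨ spread N B _ _ ⟩
    N * (B * ∑ T (λ t → Eᶜ (good t))) + B * (N * ∑ T (λ t → Eᶜ (contested t)))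
      ≤⟨ +-mono-≤ (*-monoʳ-≤ N main) (*-monoʳ-≤ B Eᶜ-contested) ⟩
    N * (Z * Z * Z * Eᶜ (λ κ → length (M κ))) + B * (16 * Ω * length T)
      ≡⟨ cong₂ _+_ (sym (*-assoc N _ _)) (regroup B Ω (length T)) ⟩
    N * (Z * Z * Z) * Eᶜ (λ κ → length (M κ)) + 16 * B * Ω * length T ∎
    where
    open ≤-Reasoning
    spread : ∀ n b g c → n * b * (g + c) ≡ n * (b * g) + b * (n * c)
    spread = solve-∀
    regroup : ∀ b w t → b * (16 * w * t) ≡ 16 * b * w * t
    regroup = solve-∀
    main : B * ∑ T (λ t → Eᶜ (good t)) ≤ Z * Z * Z * Eᶜ (λ κ → length (M κ))
    main = begin
      B * ∑ T (λ t → Eᶜ (good t))                 ≡⟨ ∑-*ˡ T B (λ t → Eᶜ (good t)) ⟨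
      ∑ T (λ t → B * Eᶜ (good t))                 ≤⟨ ∑-mono T Eᶜ-matched ⟩
      ∑ T (λ t → Z * Z * Z * Eᶜ (matched t))      ≡⟨ ∑-*ˡ T (Z * Z * Z) (λ t → Eᶜ (matched t)) ⟩
      Z * Z * Z * ∑ T (λ t → Eᶜ (matched t))      ≡⟨ cong (Z * Z * Z *_) (∑ᶜ-swap N σ T (λ κ t → matched t κ)) ⟨
      Z * Z * Z * Eᶜ (λ κ → ∑ T (λ t → matched t κ)) ≤⟨ *-monoʳ-≤ (Z * Z * Z) (∑ᶜ-mono N σ ∑-matched) ⟩
      Z * Z * Z * Eᶜ (λ κ → length (M κ))         ∎

-- Random arrival orders

module _ {A : Set} where

  opaque
    inserts : A → List A → List (List A)
    inserts x ys = toList (insertions x ys)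

    perms : List A → List (List A)
    perms xs = toList (permutations xs)

    perms≡ : ∀ xs → perms xs ≡ toList (permutations xs)
    perms≡ xs = refl

    inserts-[] : ∀ x → inserts x [] ≡ (x ∷ []) ∷ []
    inserts-[] x = refl

    inserts-∷ : ∀ x y ys → inserts x (y ∷ ys) ≡ (x ∷ y ∷ ys) ∷ map (y ∷_) (inserts x ys)
    inserts-∷ x y ys = refl

    perms-∷ : ∀ x xs → perms (x ∷ xs) ≡ concatMap (inserts x) (perms xs)
    perms-∷ x xs = sym (toList->>= (insertions x) (permutations xs))

    perms-[] : perms [] ≡ [] ∷ []
    perms-[] = refl

  ∑-inserts : ∀ x y ys f → ∑ (inserts x (y ∷ ys)) f ≡ f (x ∷ y ∷ ys) + ∑ (inserts x ys) (λ ρ → f (y ∷ ρ))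
  ∑-inserts x y ys f rewrite inserts-∷ x y ys = cong (f (x ∷ y ∷ ys) +_) (∑-map (inserts x ys) (y ∷_) f)

  ∑-perms : ∀ x xs f → ∑ (perms (x ∷ xs)) f ≡ ∑ (perms xs) (λ τ → ∑ (inserts x τ) f)
  ∑-perms x xs f rewrite perms-∷ x xs = ∑-concatMap (perms xs) (inserts x) f

  inserts-comm : ∀ x y zs f → ∑ (inserts y zs) (λ τ → ∑ (inserts x τ) f) ≡ ∑ (inserts x zs) (λ τ → ∑ (inserts y τ) f)
  inserts-comm x y [] f rewrite inserts-[] x | inserts-[] y | inserts-∷ x y [] | inserts-∷ y x [] | inserts-[] x | inserts-[] y =
    exchange (f (x ∷ y ∷ [])) (f (y ∷ x ∷ []))
    where
    exchange : ∀ a b → a + (b + 0) + 0 ≡ b + (a + 0) + 0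
    exchange = solve-∀
  inserts-comm x y (z ∷ zs) f = begin
    ∑ (inserts y (z ∷ zs)) (λ τ → ∑ (inserts x τ) f)   ≡⟨ unfold₂ x y ⟩
    a + (b + c) + (d + e)                              ≡⟨ cong (a + (b + c) +_) (cong (d +_) (inserts-comm x y zs (λ σ → f (z ∷ σ)))) ⟩
    a + (b + c) + (d + e′)                             ≡⟨ exchange a b c d e′ ⟩
    b + (a + d) + (c + e′)                             ≡⟨ unfold₂ y x ⟨
    ∑ (inserts x (z ∷ zs)) (λ τ → ∑ (inserts y τ) f)   ∎
    where
    open ≡-Reasoning
    a b c d e e′ : ℕ
    a  = f (x ∷ y ∷ z ∷ zs)
    b  = f (y ∷ x ∷ z ∷ zs)
    c  = ∑ (inserts x zs) (λ ρ → f (y ∷ z ∷ ρ))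
    d  = ∑ (inserts y zs) (λ τ → f (x ∷ z ∷ τ))
    e  = ∑ (inserts y zs) (λ τ → ∑ (inserts x τ) (λ σ → f (z ∷ σ)))
    e′ = ∑ (inserts x zs) (λ τ → ∑ (inserts y τ) (λ σ → f (z ∷ σ)))
    unfold₂ : ∀ x y → ∑ (inserts y (z ∷ zs)) (λ τ → ∑ (inserts x τ) f) ≡
              f (x ∷ y ∷ z ∷ zs) + (f (y ∷ x ∷ z ∷ zs) + ∑ (inserts x zs) (λ ρ → f (y ∷ z ∷ ρ)))
              + (∑ (inserts y zs) (λ τ → f (x ∷ z ∷ τ)) + ∑ (inserts y zs) (λ τ → ∑ (inserts x τ) (λ σ → f (z ∷ σ))))
    unfold₂ x y = trans (∑-inserts y z zs (λ τ → ∑ (inserts x τ) f)) (cong₂ _+_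
      (trans (∑-inserts x y (z ∷ zs) f) (cong (f (x ∷ y ∷ z ∷ zs) +_) (∑-inserts x z zs (λ ρ → f (y ∷ ρ)))))
      (trans (∑-cong (inserts y zs) (λ {τ} _ → ∑-inserts x z τ f))
             (∑-+ (inserts y zs) (λ τ → f (x ∷ z ∷ τ)) (λ τ → ∑ (inserts x τ) (λ σ → f (z ∷ σ))))))
    exchange : ∀ a b c d e → a + (b + c) + (d + e) ≡ b + (a + d) + (c + e)
    exchange = solve-∀

  -- This allows any chosen edge to be treated as the one inserted last, at a uniformly random
  -- position of a random order of the others.
  ∑-perms-↭ : ∀ {xs ys} f → xs ↭ ys → ∑ (perms xs) f ≡ ∑ (perms ys) f
  ∑-perms-↭ f Perm.refl = refl
  ∑-perms-↭ f (Perm.prep {xs} {ys} x p) =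
    trans (∑-perms x xs f) (trans (∑-perms-↭ (λ τ → ∑ (inserts x τ) f) p) (sym (∑-perms x ys f)))
  ∑-perms-↭ f (Perm.swap {xs} {ys} x y p) = begin
    ∑ (perms (x ∷ y ∷ xs)) f
      ≡⟨ trans (∑-perms x (y ∷ xs) f) (∑-perms y xs (λ τ → ∑ (inserts x τ) f)) ⟩
    ∑ (perms xs) (λ ρ → ∑ (inserts y ρ) (λ τ → ∑ (inserts x τ) f))
      ≡⟨ ∑-perms-↭ (λ ρ → ∑ (inserts y ρ) (λ τ → ∑ (inserts x τ) f)) p ⟩
    ∑ (perms ys) (λ ρ → ∑ (inserts y ρ) (λ τ → ∑ (inserts x τ) f))
      ≡⟨ ∑-cong (perms ys) (λ {ρ} _ → inserts-comm x y ρ f) ⟩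
    ∑ (perms ys) (λ ρ → ∑ (inserts x ρ) (λ τ → ∑ (inserts y τ) f))
      ≡⟨ trans (∑-perms y (x ∷ ys) f) (∑-perms x ys (λ τ → ∑ (inserts y τ) f)) ⟨
    ∑ (perms (y ∷ x ∷ ys)) f ∎
    where open ≡-Reasoning
  ∑-perms-↭ f (Perm.trans p q) = trans (∑-perms-↭ f p) (∑-perms-↭ f q)

  inserts-↭ : ∀ x ys {σ} → σ ∈ inserts x ys → σ ↭ x ∷ ys
  inserts-↭ x [] σ∈ with here refl ← subst (_ ∈_) (inserts-[] x) σ∈ = Perm.refl
  inserts-↭ x (y ∷ ys) σ∈ with subst (_ ∈_) (inserts-∷ x y ys) σ∈
  ... | here refl = Perm.refl
  ... | there σ∈′ with ρ , ρ∈ , refl ← ∈-map⁻ (y ∷_) σ∈′ =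
    Perm.trans (Perm.prep y (inserts-↭ x ys ρ∈)) (Perm.swap y x Perm.refl)

  perms-↭ : ∀ xs {σ} → σ ∈ perms xs → σ ↭ xs
  perms-↭ [] σ∈ with here refl ← subst (_ ∈_) perms-[] σ∈ = Perm.refl
  perms-↭ (x ∷ xs) σ∈
    with τ , τ∈ , σ∈′ ← find (∈-concatMap⁻ (inserts x) {perms xs} (subst (_ ∈_) (perms-∷ x xs) σ∈))
    = Perm.trans (inserts-↭ x τ σ∈′) (Perm.prep x (perms-↭ xs τ∈))

  length-inserts : ∀ x ys → length (inserts x ys) ≡ suc (length ys)
  length-inserts x [] rewrite inserts-[] x = refl
  length-inserts x (y ∷ ys) = trans (cong length (inserts-∷ x y ys))
    (cong suc (trans (length-map (y ∷_) (inserts x ys)) (length-inserts x ys)))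

  first-insert : ∀ x ys → (x ∷ ys) ∈ inserts x ys
  first-insert x []       rewrite inserts-[] x = here refl
  first-insert x (y ∷ ys) rewrite inserts-∷ x y ys = here refl

  later-inserts : ∀ {x y ys σ} → σ ∈ inserts x (y ∷ ys) →
                  σ ≡ x ∷ y ∷ ys ⊎ ∃ λ ρ → ρ ∈ inserts x ys × σ ≡ y ∷ ρ
  later-inserts {x} {y} {ys} σ∈ with subst (_ ∈_) (inserts-∷ x y ys) σ∈
  ... | here eq    = inj₁ eq
  ... | there σ∈′ = inj₂ (∈-map⁻ (y ∷_) σ∈′)

-- The position of a fixed edge in a random order

picked open-at seen : ℕ → Edge → List Edge → ℕ
picked s g σ  = 𝟙 (g ∈ᵉ? greedy [] (take s σ))
open-at s g σ = 𝟙 (free? (after [] (take s σ)) g)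
seen s g σ    = 𝟙 (g ∈ᵉ? take s σ)

not-free : ∀ U es {e} → e ∈ es → ¬ Free (after U es) e
not-free U es {e} e∈ fr with a , p ← greedy-maximal U es e∈ = free-end {after U es} {e} fr a p

-- An edge that has arrived is never free afterwards, so `g` was inserted beyond the first `s` edges
-- and these are the same in `σ` and `τ`.
insert-free : ∀ s U {g} τ {σ} → σ ∈ inserts g τ → Free (after U (take s σ)) g → Free (after U (take s τ)) g
insert-free zero    U τ σ∈ fr = fr
insert-free (suc s) U {g} [] σ∈ fr with here refl ← subst (_ ∈_) (inserts-[] g) σ∈ =
  contradiction fr (not-free U (take (suc s) (g ∷ [])) (here refl))
insert-free (suc s) U {g} (y ∷ ys) σ∈ fr with later-inserts σ∈
... | inj₁ refl = contradiction fr (not-free U (take (suc s) (g ∷ y ∷ ys)) (here refl))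
... | inj₂ (ρ , ρ∈ , refl) = insert-free s (step U y) ys ρ∈ fr

greedy-head : ∀ U e es → Free U e → e ∈ greedy U (e ∷ es)
greedy-head U e es fr with free? U e
... | yes _ = here refl
... | no nf = contradiction fr nf

greedy-tail : ∀ U e es {f} → f ∈ greedy (step U e) es → f ∈ greedy U (e ∷ es)
greedy-tail U e es f∈ with free? U e
... | yes _ = there f∈
... | no _  = f∈

-- If g is still free after the first s edges of τ, then greedy picks it
-- wherever it is inserted among them.
insert-picked : ∀ s U g τ → s ≤ suc (length τ) → Free (after U (take s τ)) g →
                s ≤ ∑ (inserts g τ) (λ σ → 𝟙 (g ∈ᵉ? greedy U (take s σ)))
insert-picked zero U g τ _ _ = z≤n
insert-picked (suc s) U g τ le fr = at τ le fr
  where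
  free-before : ∀ es → Free (after U es) g → Free U g
  free-before es (p , q) = p ∘ after-⊇ es , q ∘ after-⊇ es
  head-picked : ∀ es → Free U g → 1 ≤ 𝟙 (g ∈ᵉ? greedy U (g ∷ es))
  head-picked es fr = ≤-reflexive (sym (𝟙-yes (g ∈ᵉ? greedy U (g ∷ es)) (greedy-head U g es fr)))
  at : ∀ τ → suc s ≤ suc (length τ) → Free (after U (take (suc s) τ)) g →
       suc s ≤ ∑ (inserts g τ) (λ σ → 𝟙 (g ∈ᵉ? greedy U (take (suc s) σ)))
  at [] (s≤s z≤n) fr rewrite inserts-[] g = ≤-trans (head-picked [] fr) (m≤m+n _ 0)
  at (y ∷ ys) (s≤s le) fr rewrite ∑-inserts g y ys (λ σ → 𝟙 (g ∈ᵉ? greedy U (take (suc s) σ))) =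
    +-mono-≤ (head-picked (take s (y ∷ ys)) (free-before (take (suc s) (y ∷ ys)) fr))
             (≤-trans (insert-picked s (step U y) g ys le fr)
                      (∑-mono (inserts g ys) λ {ρ} _ → 𝟙-mono (g ∈ᵉ? greedy (step U y) (take s ρ)) (g ∈ᵉ? greedy U (y ∷ take s ρ))
                                                              (greedy-tail U y (take s ρ))))

insert-seen : ∀ s g τ → g ∉ τ → ∑ (inserts g τ) (seen s g) ≤ s
insert-seen zero g τ g∉ = ≤-reflexive (trans (∑-cong (inserts g τ) (λ _ → 𝟙-no (g ∈ᵉ? []) λ ())) (∑-zero (inserts g τ)))
insert-seen (suc s) g [] g∉ rewrite inserts-[] g = ≤-trans (≤-reflexive (+-identityʳ _)) (≤-trans (𝟙≤1 (g ∈ᵉ? take (suc s) (g ∷ []))) (s≤s z≤n))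
insert-seen (suc s) g (y ∷ ys) g∉ rewrite ∑-inserts g y ys (seen (suc s) g) =
  +-mono-≤ (𝟙≤1 (g ∈ᵉ? take (suc s) (g ∷ y ∷ ys)))
           (≤-trans (∑-mono (inserts g ys) λ {ρ} _ → 𝟙-mono (g ∈ᵉ? (y ∷ take s ρ)) (g ∈ᵉ? take s ρ)
                       λ { (here p) → contradiction (here p) g∉ ; (there p) → p })
                    (insert-seen s g ys (g∉ ∘ there)))

module _ (s m : ℕ) (s≤m : suc s ≤ m) (m≤64s : m ≤ 64 * suc s) (64s≤64+m : 64 * suc s ≤ 64 + m) where

  -- The order of the other edges decides alone. Either `g` is blocked after their prefix and is
  -- never open, or it is picked at each of the `suc s` early positions, at least one in 64 of all
  -- positions.
  insert-hasty : ∀ g τ → suc (length τ) ≡ m →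
                 ∑ (inserts g τ) (open-at (suc s) g) ≤ 64 * ∑ (inserts g τ) (picked (suc s) g)
  insert-hasty g τ len with free? (after [] (take (suc s) τ)) g
  ... | no nf = ≤-trans (≤-reflexive (trans (∑-cong (inserts g τ) λ {σ} σ∈ →
                  𝟙-no (free? (after [] (take (suc s) σ)) g) (nf ∘ insert-free (suc s) [] τ σ∈)) (∑-zero (inserts g τ)))) z≤n
  ... | yes fr = begin
    ∑ (inserts g τ) (open-at (suc s) g)         ≤⟨ ∑-mono (inserts g τ) (λ {σ} _ → 𝟙≤1 (free? (after [] (take (suc s) σ)) g)) ⟩
    ∑ (inserts g τ) (λ _ → 1)                   ≡⟨ trans (∑-length (inserts g τ)) (trans (length-inserts g τ) len) ⟩
    m                                           ≤⟨ m≤64s ⟩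
    64 * suc s                                  ≤⟨ *-monoʳ-≤ 64 (insert-picked (suc s) [] g τ (≤-trans s≤m (≤-reflexive (sym len))) fr) ⟩
    64 * ∑ (inserts g τ) (picked (suc s) g)     ∎
    where open ≤-Reasoning

  -- Rounding the prefix up costs an excess of at most 64, even if there are few edges. The
  -- insertion at the very front pays for it, since greedy always picks the first edge.
  insert-early : ∀ g τ → suc (length τ) ≡ m → g ∉ τ →
                 64 * ∑ (inserts g τ) (seen (suc s) g) ≤ 64 * ∑ (inserts g τ) (picked (suc s) g) + ∑ (inserts g τ) (λ _ → 1)
  insert-early g τ len g∉ = begin
    64 * ∑ (inserts g τ) (seen (suc s) g)       ≤⟨ *-monoʳ-≤ 64 (insert-seen (suc s) g τ g∉) ⟩
    64 * suc s                                  ≤⟨ 64s≤64+m ⟩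
    64 + m                                      ≤⟨ +-mono-≤ (*-monoʳ-≤ 64 {1} (≤-trans first (term≤∑ (picked (suc s) g) (first-insert g τ))))
                                                            (≤-reflexive (sym (trans (∑-length (inserts g τ)) (trans (length-inserts g τ) len)))) ⟩
    64 * ∑ (inserts g τ) (picked (suc s) g) + ∑ (inserts g τ) (λ _ → 1) ∎
    where
    open ≤-Reasoning
    first : 1 ≤ picked (suc s) g (g ∷ τ)
    first = ≤-reflexive (sym (𝟙-yes (g ∈ᵉ? greedy [] (g ∷ take s τ)) (greedy-head [] g (take s τ) ((λ ()) , (λ ())))))

-- A first phase of fraction `f` costs `2 * f * Q` through edges of OPT that arrive too early. For
-- large `N` the remaining `(1 - 2f) * Q` must exceed `2 * N * Z²`, where `Q` is about `9N³` and `Z`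
-- about `2N`, so any `f` below 1/18 would do. Rounding up ensures `m ≤ 64 * cut m`.
cut : ℕ → ℕ
cut m = suc (m / 64)

module _ {es : List Edge} (unique : Unique es) {g : Edge} (g∈ : g ∈ es) where

  private
    m : ℕ
    m = length es

  Splits : Set
  Splits = ∃ λ rest → es ↭ g ∷ rest × g ∉ rest

  splits : Splits
  splits with ys , zs , refl ← ∈-∃++ g∈ = ys ++ zs , shift g ys zs , absent ys unique
    where
    absent : ∀ ys → Unique (ys ++ g ∷ zs) → g ∉ ys ++ zs
    absent []       (h ∷ _) g∈   = All.lookup h g∈ refl
    absent (y ∷ ys) (h ∷ _) (here refl) = All.lookup h (∈-++⁺ʳ ys (here refl)) refl
    absent (y ∷ ys) (_ ∷ u) (there g∈)  = absent ys u g∈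

  nonempty : 1 ≤ m
  nonempty = ∈-length g∈

  cut≤m : cut m ≤ m
  cut≤m with m | nonempty
  ... | suc k | _ = m/n<m (suc k) 64 (s≤s (s≤s z≤n))

  m≤64cut : m ≤ 64 * cut m
  m≤64cut = begin
    m                       ≡⟨ m≡m%n+[m/n]*n m 64 ⟩
    m % 64 + m / 64 * 64    ≤⟨ +-monoˡ-≤ _ (<⇒≤ (m%n<n m 64)) ⟩
    64 + m / 64 * 64        ≡⟨ cong (64 +_) (*-comm (m / 64) 64) ⟩
    64 + 64 * (m / 64)      ≡⟨ *-suc 64 (m / 64) ⟨
    64 * cut m              ∎
    where open ≤-Reasoning

  64cut≤64+m : 64 * cut m ≤ 64 + m
  64cut≤64+m = ≤-trans (≤-reflexive (trans (*-suc 64 (m / 64)) (cong (64 +_) (*-comm 64 (m / 64)))))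
                       (+-monoʳ-≤ 64 (m/n*n≤m m 64))

  hasty : ∑ (perms es) (open-at (cut m) g) ≤ 64 * ∑ (perms es) (picked (cut m) g)
  hasty with rest , p , g∉ ← splits = begin
    ∑ (perms es) (open-at (cut m) g)
      ≡⟨ trans (∑-perms-↭ _ p) (∑-perms g rest _) ⟩
    ∑ (perms rest) (λ τ → ∑ (inserts g τ) (open-at (cut m) g))
      ≤⟨ ∑-mono (perms rest) (λ {τ} τ∈ → insert-hasty (m / 64) m cut≤m m≤64cut 64cut≤64+m g τ
           (trans (cong suc (↭-length (perms-↭ rest τ∈))) (sym (↭-length p)))) ⟩
    ∑ (perms rest) (λ τ → 64 * ∑ (inserts g τ) (picked (cut m) g))
      ≡⟨ ∑-*ˡ (perms rest) 64 (λ τ → ∑ (inserts g τ) (picked (cut m) g)) ⟩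
    64 * ∑ (perms rest) (λ τ → ∑ (inserts g τ) (picked (cut m) g))
      ≡⟨ cong (64 *_) (trans (∑-perms-↭ _ p) (∑-perms g rest _)) ⟨
    64 * ∑ (perms es) (picked (cut m) g) ∎
    where open ≤-Reasoning

  rarely-early : 64 * ∑ (perms es) (seen (cut m) g) ≤ 64 * ∑ (perms es) (picked (cut m) g) + length (perms es)
  rarely-early with rest , p , g∉ ← splits = begin
    64 * ∑ (perms es) (seen (cut m) g)
      ≡⟨ cong (64 *_) (trans (∑-perms-↭ _ p) (∑-perms g rest _)) ⟩
    64 * ∑ (perms rest) (λ τ → ∑ (inserts g τ) (seen (cut m) g))
      ≡⟨ ∑-*ˡ (perms rest) 64 (λ τ → ∑ (inserts g τ) (seen (cut m) g)) ⟨
    ∑ (perms rest) (λ τ → 64 * ∑ (inserts g τ) (seen (cut m) g))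
      ≤⟨ ∑-mono (perms rest) (λ {τ} τ∈ → insert-early (m / 64) m cut≤m m≤64cut 64cut≤64+m g τ
           (trans (cong suc (↭-length (perms-↭ rest τ∈))) (sym (↭-length p))) (g∉ ∘ ∈-resp-↭ (perms-↭ rest τ∈))) ⟩
    ∑ (perms rest) (λ τ → 64 * ∑ (inserts g τ) (picked (cut m) g) + ∑ (inserts g τ) (λ _ → 1))
      ≡⟨ trans (∑-+ (perms rest) (λ τ → 64 * ∑ (inserts g τ) (picked (cut m) g)) (λ τ → ∑ (inserts g τ) (λ _ → 1)))
               (cong (_+ _) (∑-*ˡ (perms rest) 64 (λ τ → ∑ (inserts g τ) (picked (cut m) g)))) ⟩
    64 * ∑ (perms rest) (λ τ → ∑ (inserts g τ) (picked (cut m) g)) + ∑ (perms rest) (λ τ → ∑ (inserts g τ) (λ _ → 1))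
      ≡⟨ cong₂ _+_ (cong (64 *_) (trans (∑-perms-↭ _ p) (∑-perms g rest _)))
                   (trans (sym (∑-length (perms es))) (trans (∑-perms-↭ (λ _ → 1) p) (∑-perms g rest _))) ⟨
    64 * ∑ (perms es) (picked (cut m) g) + length (perms es) ∎
    where open ≤-Reasoning

greedy-bound : ∀ {O} → AllPairs Disjoint O → ∀ s σ → (∀ {g} → g ∈ O → g ∈ σ) →
               ∑ O (λ g → 1 + picked s g σ) ≤ 2 * length (greedy [] σ)
greedy-bound {O} dO s σ O⊆ = ≤-trans (∑-mono O two) ∑-touches
  where
  open FirstPhase σ using (∑-link)
  -- The whole order plays the first phase and nothing follows it.
  open Analysis σ [] O dO using (touches; touches-end; ∑-touches)
  prefix : ∀ {g} → g ∈ greedy [] (take s σ) → g ∈ greedy [] σ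
  prefix {g} g∈ = subst (λ l → g ∈ greedy [] l) (take++drop≡id s σ)
    (subst (g ∈_) (sym (greedy-++ [] (take s σ) (drop s σ))) (∈-++⁺ˡ g∈))
  two : ∀ {g} → g ∈ O → 1 + picked s g σ ≤ touches g
  two {g} g∈ with g ∈ᵉ? greedy [] (take s σ)
  ... | no ng rewrite 𝟙-no (no ng) ng with a , p ← greedy-maximal [] σ (O⊆ g∈) = touches-end a p
  ... | yes pg rewrite 𝟙-yes (yes pg) pg =
    ≤-trans (+-mono-≤ (hits-end lower g refl) (hits-end upper g refl)) (term≤∑ (λ t → link t g) (prefix pg))

-- The online algorithm

kept-letter : ∀ c → kept c ≡ 1 → sacrificed c ≡ 0
kept-letter pass _ = refl
kept-letter skip _ = refl

lost-letter : ∀ c → kept c ≢ 1 → sacrificed c ≡ 1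
lost-letter (care _) _ = refl
lost-letter pass nk    = contradiction refl nk
lost-letter skip nk    = contradiction refl nk

-- Unlike a Policy, a rule sees the earlier edges in order of arrival.
Rule : Set
Rule = List Edge → Edge → Bool

policyOf : Rule → Policy
policyOf q past e = q (reverse past) e

run : Rule → List Edge → List Edge → List Edge
run q pre []       = []
run q pre (e ∷ es) = if q pre e then e ∷ run q (pre ++ e ∷ []) es else run q (pre ++ e ∷ []) es

picksAfter≡run : ∀ q past es → picksAfter (policyOf q) past es ≡ run q (reverse past) es
picksAfter≡run q past [] = refl
picksAfter≡run q past (e ∷ es)
  rewrite picksAfter≡run q (e ∷ past) es | unfold-reverse e past = refl

run-++ : ∀ q pre xs ys → run q pre (xs ++ ys) ≡ run q pre xs ++ run q (pre ++ xs) ys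
run-++ q pre [] ys rewrite ++-identityʳ pre = refl
run-++ q pre (x ∷ xs) ys
  rewrite run-++ q (pre ++ x ∷ []) xs ys | ++-assoc pre (x ∷ []) xs with q pre x
... | true  = refl
... | false = refl

after-snoc : ∀ pre e → after [] (pre ++ e ∷ []) ≡ step (after [] pre) e
after-snoc pre e = foldl-++ step [] pre (e ∷ [])

opaque
  before? : ∀ s (pre : List Edge) → Dec (length pre < s)
  before? s pre = length pre <? s

  keeps? : ∀ c → Dec (kept c ≡ 1)
  keeps? c = kept c ≟ 1

greedyRule : Rule
greedyRule pre e = does (free? (after [] pre) e)

-- The simulated greedy of the first phase occupies the endpoints of sacrificed edges too, so `T`
-- does not depend on the letters. The second greedy starts with no occupied vertices: admissible
-- edges avoid the kept edges by definition, so only conflicts among themselves matter.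
augmentRule : ℕ → List Letter → Rule
augmentRule s ω pre e =
  if does (before? s pre)
  then does (free? (after [] pre) e) ∧ does (keeps? (κ e))
  else does (admissible? κ e) ∧ does (free? (after [] (filter (admissible? κ) (drop s pre))) e)
  where
  open FirstPhase (take s pre)
  κ : Colouring
  κ = colouring (pre ++ e ∷ []) ω

run-greedy : ∀ pre es → run greedyRule pre es ≡ greedy (after [] pre) es
run-greedy pre [] = refl
run-greedy pre (e ∷ es) rewrite run-greedy (pre ++ e ∷ []) es | after-snoc pre e = refl

length-snoc : ∀ (pre : List Edge) e (es : List Edge) → length (pre ++ e ∷ []) + length es ≡ length pre + suc (length es)
length-snoc []        e es = refl
length-snoc (x ∷ pre) e es = cong suc (length-snoc pre e es)

-- `rest` extends the list to the full order, so that one colouring serves every step although the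
-- rule only knows that of the current prefix.
first-phase : ∀ s ω pre es rest → length pre + length es ≤ s →
              let κ = colouring (pre ++ es ++ rest) ω in
              run (augmentRule s ω) pre es ≡ filter (keeps? ∘ κ) (greedy (after [] pre) es)
first-phase s ω pre [] rest le = refl
first-phase s ω pre (e ∷ es) rest le
  rewrite dec-true (before? s pre) (≤-trans (m<m+n (length pre) {suc (length es)} (s≤s z≤n)) le)
        | sym (++-assoc pre (e ∷ []) (es ++ rest))
        | first-phase s ω (pre ++ e ∷ []) es rest (≤-trans (≤-reflexive (length-snoc pre e es)) le)
        | sym (colouring-++ (pre ++ e ∷ []) (es ++ rest) ω {e} (∈-++⁺ʳ pre (here refl)))
        | after-snoc pre e
  with free? (after [] pre) e
... | no _ = refl
... | yes _ with keeps? (colouring ((pre ++ e ∷ []) ++ es ++ rest) ω e)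
... | yes _ = refl
... | no _  = refl

take-length : ∀ {A : Set} {s} (xs ys : List A) → length xs ≡ s → take s (xs ++ ys) ≡ xs
take-length []       ys refl = refl
take-length (x ∷ xs) ys refl = cong (x ∷_) (take-length xs ys refl)

drop-length : ∀ {A : Set} {s} (xs ys : List A) → length xs ≡ s → drop s (xs ++ ys) ≡ ys
drop-length []       ys refl = refl
drop-length (x ∷ xs) ys refl = drop-length xs ys refl


module _ (first : List Edge) where

  open FirstPhase first

  admissible-prefix : ∀ xs ys ω {e} → (∀ {f} → f ∈ first → f ∈ xs) → e ∈ xs →
                      (Admissible (colouring xs ω) e → Admissible (colouring (xs ++ ys) ω) e) ×
                      (Admissible (colouring (xs ++ ys) ω) e → Admissible (colouring xs ω) e)
  admissible-prefix xs ys ω {e} first⊆ e∈ =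
      admissible-cong (sym (colouring-++ xs ys ω e∈)) (λ t∈ _ _ _ → sym (agree t∈))
    , admissible-cong (colouring-++ xs ys ω e∈) (λ t∈ _ _ _ → agree t∈)
    where
    agree : ∀ {t} → t ∈ T → colouring (xs ++ ys) ω t ≡ colouring xs ω t
    agree t∈ = colouring-++ xs ys ω (first⊆ (greedy-⊆ [] first t∈))

  second-rule : ∀ {s σ} ω mid e es → length first ≡ s → σ ≡ ((first ++ mid) ++ e ∷ []) ++ es →
                augmentRule s ω (first ++ mid) e ≡
                does (admissible? (colouring σ ω) e) ∧
                does (free? (after [] (filter (admissible? (colouring σ ω)) mid)) e)
  second-rule {s} ω mid e es len refl
    rewrite dec-false (before? s (first ++ mid)) (≤⇒≯ (≤-trans (≤-reflexive (sym len))
              (≤-trans (m≤m+n (length first) (length mid)) (≤-reflexive (sym (length-++ first))))))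
          | take-length first mid len | drop-length first mid len
    = cong₂ _∧_ (does-⇔ (mk⇔ (proj₁ (here-ok e∈)) (proj₂ (here-ok e∈))) (admissible? κ′ e) (admissible? κ e))
        (cong (λ l → does (free? (after [] l) e))
              (filter-cong (admissible? κ′) (admissible? κ) mid (λ f∈ → here-ok (∈-++⁺ˡ (∈-++⁺ʳ first f∈)))))
    where
    xs : List Edge
    xs = (first ++ mid) ++ e ∷ []
    κ κ′ : Colouring
    κ = colouring (xs ++ es) ω
    κ′ = colouring xs ω
    e∈ : e ∈ xs
    e∈ = ∈-++⁺ʳ (first ++ mid) (here refl)
    here-ok : ∀ {f} → f ∈ xs → (Admissible κ′ f → Admissible κ f) × (Admissible κ f → Admissible κ′ f)
    here-ok = admissible-prefix xs es ω (λ f∈ → ∈-++⁺ˡ (∈-++⁺ˡ f∈))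

  after-filter-snoc : ∀ κ mid e → after [] (filter (admissible? κ) (mid ++ e ∷ [])) ≡
                      (if does (admissible? κ e) then step (after [] (filter (admissible? κ) mid)) e
                                                 else after [] (filter (admissible? κ) mid))
  after-filter-snoc κ mid e rewrite filter-++ (admissible? κ) mid (e ∷ []) with admissible? κ e
  ... | yes _ = after-snoc (filter (admissible? κ) mid) e
  ... | no _  = cong (after []) (++-identityʳ (filter (admissible? κ) mid))

  second-phase : ∀ {s σ} ω mid es → length first ≡ s → σ ≡ (first ++ mid) ++ es →
                 run (augmentRule s ω) (first ++ mid) es ≡
                 greedy (after [] (filter (admissible? (colouring σ ω)) mid)) (filter (admissible? (colouring σ ω)) es)
  second-phase ω mid [] len eq = refl
  second-phase {s} {σ} ω mid (e ∷ es) len eq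
    rewrite second-rule ω mid e es len (trans eq (sym (++-assoc (first ++ mid) (e ∷ []) es)))
          | ++-assoc first mid (e ∷ [])
          | second-phase {s} {σ} ω (mid ++ e ∷ []) es len
              (trans eq (trans (sym (++-assoc (first ++ mid) (e ∷ []) es)) (cong (_++ es) (++-assoc first mid (e ∷ [])))))
          | after-filter-snoc (colouring σ ω) mid e
    with admissible? (colouring σ ω) e
  ... | no _  = refl
  ... | yes _ with free? (after [] (filter (admissible? (colouring σ ω)) mid)) e
  ... | yes _ = refl
  ... | no _  = refl

module Augment (s : ℕ) (ω : List Letter) (σ : List Edge) where

  open FirstPhase (take s σ)
  open SecondPhase (drop s σ)

  κ : Colouring
  κ = colouring σ ω

  saved : List Edge
  saved = filter (keeps? ∘ κ) T

  first-run : run (augmentRule s ω) [] (take s σ) ≡ saved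
  first-run = subst (λ l → run (augmentRule s ω) [] (take s σ) ≡ filter (keeps? ∘ colouring l ω) T)
    (take++drop≡id s σ) (first-phase s ω [] (take s σ) (drop s σ) (≤-trans (≤-reflexive (length-take s σ)) (m⊓n≤m s (length σ))))

  second-run : run (augmentRule s ω) (take s σ) (drop s σ) ≡ M κ
  second-run with s ≤? length σ
  -- The order ends within the first phase; both sides are empty.
  ... | no s≰ rewrite drop-all s σ (<⇒≤ (≰⇒> s≰)) = refl
  ... | yes s≤ = subst (λ l → run (augmentRule s ω) l (drop s σ) ≡ M κ) (++-identityʳ (take s σ))
    (second-phase (take s σ) ω [] (drop s σ) (trans (length-take s σ) (m≤n⇒m⊓n≡m s≤))
       (sym (trans (cong (_++ drop s σ) (++-identityʳ (take s σ))) (take++drop≡id s σ))))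

  picks≡ : picks (policyOf (augmentRule s ω)) σ ≡ saved ++ M κ
  picks≡ = begin
    picks (policyOf (augmentRule s ω)) σ
      ≡⟨ picksAfter≡run (augmentRule s ω) [] σ ⟩
    run (augmentRule s ω) [] σ
      ≡⟨ cong (run (augmentRule s ω) []) (take++drop≡id s σ) ⟨
    run (augmentRule s ω) [] (take s σ ++ drop s σ)
      ≡⟨ run-++ (augmentRule s ω) [] (take s σ) (drop s σ) ⟩
    run (augmentRule s ω) [] (take s σ) ++ run (augmentRule s ω) (take s σ) (drop s σ)
      ≡⟨ cong₂ _++_ first-run second-run ⟩
    saved ++ M κ ∎
    where open ≡-Reasoning

  ∈-saved : ∀ {e} → e ∈ saved → e ∈ T × kept (κ e) ≡ 1
  ∈-saved = ∈-filter⁻ (keeps? ∘ κ) {xs = T}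

  saved-apart : ∀ {e f} → e ∈ saved → f ∈ M κ → Disjoint e f
  saved-apart {e} {f} e∈ f∈ = ends-disjoint λ a b eq → clash a b eq (proj₁ (∈-saved e∈)) (proj₂ (∈-saved e∈))
    where
    clash : ∀ a b → end a e ≡ end b f → e ∈ T → kept (κ e) ≡ 1 → ⊥
    clash a b eq e∈T kept≡1
      with t , t∈ , c , κt , b′ , x , spoke q hub refl x∉ , _ ← admissible⁻ {κ} (proj₂ (∈-L⁻ {κ} (M⊆L {κ} f∈)))
      with same-or-opposite q b
    ... | inj₂ refl = x∉ (subst (_∈ A) eq (T-end a e∈T))
    ... | inj₁ refl with refl ← matching-unique T-matching e∈T t∈ a b′ (trans eq hub)
      with () ← trans (sym (cong kept κt)) kept≡1

  picks-matching : AllPairs Disjoint (saved ++ M κ)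
  picks-matching = AllPairsₚ.++⁺ (AllPairsₚ.filter⁺ (keeps? ∘ κ) T-matching) (greedy-matching [] (L κ))
    (All.tabulate λ e∈ → All.tabulate λ f∈ → saved-apart e∈ f∈)

  picks⊆ : ∀ {e} → e ∈ saved ++ M κ → e ∈ σ
  picks⊆ {e} e∈ = subst (e ∈_) (take++drop≡id s σ) (at (∈-++⁻ saved e∈))
    where
    at : e ∈ saved ⊎ e ∈ M κ → e ∈ take s σ ++ drop s σ
    at (inj₁ p) = ∈-++⁺ˡ (greedy-⊆ [] (take s σ) (proj₁ (∈-saved p)))
    at (inj₂ p) = ∈-++⁺ʳ (take s σ) (proj₁ (∈-L⁻ {κ} (M⊆L {κ} p)))

  length-picks : length (picks (policyOf (augmentRule s ω)) σ) + ∑ T (λ t → sacrificed (κ t)) ≡ length T + length (M κ)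
  length-picks rewrite picks≡ | length-++ saved {M κ} =
    trans (swap-last (length saved) (length (M κ)) _) (cong (_+ length (M κ)) (partition T))
    where
    swap-last : ∀ a b c → a + b + c ≡ a + c + b
    swap-last = solve-∀
    partition : ∀ ts → length (filter (keeps? ∘ κ) ts) + ∑ ts (λ t → sacrificed (κ t)) ≡ length ts
    partition [] = refl
    partition (t ∷ ts) with keeps? (κ t)
    ... | yes k rewrite kept-letter (κ t) k = cong suc (partition ts)
    ... | no nk rewrite lost-letter (κ t) nk = trans (+-suc _ _) (cong suc (partition ts))

-- Up to the factor `Ω`, `D * a` is `D * T - 2 * P * T + D * m`. Inserting the bounds on `m` and on
-- `Γ` leaves `α * T + 2 * Q * k` minus terms in `u` and `d`; `α` is what remains of the coefficient
-- of `T`, and `2 * T ≥ k - u` finishes. The resulting coefficient of `k` is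
-- `α + 4 * Q = D + Q - 2 * P - 16 * B`; as `P` is `N * Z²` in the application, `Q - 2 * P = N³` is
-- the profit from second endpoints.
combine : ∀ {D P B Q α Ω a S T m Γ u d k} →
          a + S ≡ Ω * T + m → D * S ≡ 2 * P * (Ω * T) → Q * Ω * Γ ≤ D * m + 16 * B * Ω * T →
          2 * k ≤ Γ + 3 * T + 2 * u + d → k ≤ 2 * T + u → α + (2 * P + 16 * B + 3 * Q) ≡ D →
          Ω * ((α + 4 * Q) * k) ≤ 2 * (D * a) + Ω * ((α + 4 * Q) * u + 2 * Q * d)
combine {D} {P} {B} {Q} {α} {Ω} {a} {S} {T} {m} {Γ} {u} {d} {k} count loss gain many cover α≡ =
  +-cancelʳ-≤ X _ _ (begin
    Ω * ((α + 4 * Q) * k) + X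
      ≡⟨ split α Q Ω k X ⟩
    α * Ω * k + 2 * Q * Ω * (2 * k) + X
      ≤⟨ +-monoˡ-≤ X (+-mono-≤ (*-monoʳ-≤ (α * Ω) cover) (*-monoʳ-≤ (2 * Q * Ω) many)) ⟩
    α * Ω * (2 * T + u) + 2 * Q * Ω * (Γ + 3 * T + 2 * u + d) + X
      ≡⟨ regroup α P B Q Ω T u d Γ ⟩
    2 * (Q * Ω * Γ) + (2 * (Ω * T) * (α + (2 * P + 16 * B + 3 * Q)) + V)
      ≡⟨ cong (λ e → 2 * (Q * Ω * Γ) + (2 * (Ω * T) * e + V)) α≡ ⟩
    2 * (Q * Ω * Γ) + (2 * (Ω * T) * D + V)
      ≤⟨ +-monoˡ-≤ _ (*-monoʳ-≤ 2 gain) ⟩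
    2 * (D * m + 16 * B * Ω * T) + (2 * (Ω * T) * D + V)
      ≡⟨ fold D B Ω T m V ⟩
    2 * (D * (Ω * T + m)) + (32 * B * (Ω * T) + V)
      ≡⟨ cong (λ e → 2 * (D * e) + (32 * B * (Ω * T) + V)) count ⟨
    2 * (D * (a + S)) + (32 * B * (Ω * T) + V)
      ≡⟨ expand D a S (32 * B * (Ω * T)) V ⟩
    2 * (D * a) + V + (2 * (D * S) + 32 * B * (Ω * T))
      ≡⟨ cong (λ e → 2 * (D * a) + V + (2 * e + 32 * B * (Ω * T))) loss ⟩
    2 * (D * a) + V + X ∎)
  where
  open ≤-Reasoning
  V X : ℕ
  V = Ω * ((α + 4 * Q) * u + 2 * Q * d)
  X = 2 * (2 * P * (Ω * T)) + 32 * B * (Ω * T)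
  split : ∀ α Q Ω k X → Ω * ((α + 4 * Q) * k) + X ≡ α * Ω * k + 2 * Q * Ω * (2 * k) + X
  split = solve-∀
  regroup : ∀ α P B Q Ω T u d Γ →
            α * Ω * (2 * T + u) + 2 * Q * Ω * (Γ + 3 * T + 2 * u + d) + (2 * (2 * P * (Ω * T)) + 32 * B * (Ω * T)) ≡
            2 * (Q * Ω * Γ) + (2 * (Ω * T) * (α + (2 * P + 16 * B + 3 * Q)) + Ω * ((α + 4 * Q) * u + 2 * Q * d))
  regroup = solve-∀
  fold : ∀ D B Ω T m V → 2 * (D * m + 16 * B * Ω * T) + (2 * (Ω * T) * D + V) ≡ 2 * (D * (Ω * T + m)) + (32 * B * (Ω * T) + V)
  fold = solve-∀
  expand : ∀ D a S Y V → 2 * (D * (a + S)) + (Y + V) ≡ 2 * (D * a) + V + (2 * (D * S) + Y)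
  expand = solve-∀

-- The losses `u` and `d` are charged to `Π`, the early picks of OPT edges by greedy. Since greedy
-- runs with weight `Y`, its surplus `D * Y * Ω * Π` absorbs them all once `Y` is somewhat above 64;
-- this is why the augmenting algorithm is chosen only rarely. Of `d` a share `K / 64` remains,
-- visible as `2 * Q`.
average-out : ∀ {D Y Q α Ω K Π u d total} →
              Ω * ((α + 4 * Q) * K) + D * Y * Ω * (K + Π) ≤ 2 * (D * total) + Ω * ((α + 4 * Q) * u + 2 * Q * d) →
              u ≤ 64 * Π → 64 * d ≤ 64 * Π + K → 64 * (64 * (α + 4 * Q)) + 128 * Q ≤ 64 * (D * Y) →
              Ω * K * (64 * (α + 4 * Q) + 64 * (D * Y)) ≤ 128 * (D * total) + Ω * K * (2 * Q)
average-out {D} {Y} {Q} {α} {Ω} {K} {Π} {u} {d} {total} main u≤ d≤ Y-large =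
  +-cancelʳ-≤ X _ _ (begin
    Ω * K * (64 * (α + 4 * Q) + 64 * (D * Y)) + X
      ≡⟨ pack α Q D Y Ω K Π ⟩
    64 * (Ω * ((α + 4 * Q) * K) + D * Y * Ω * (K + Π))
      ≤⟨ *-monoʳ-≤ 64 main ⟩
    64 * (2 * (D * total) + Ω * ((α + 4 * Q) * u + 2 * Q * d))
      ≡⟨ unpack α Q D Ω u d total ⟩
    128 * (D * total) + Ω * (64 * (α + 4 * Q) * u + 2 * Q * (64 * d))
      ≤⟨ +-monoʳ-≤ (128 * (D * total)) (*-monoʳ-≤ Ω (+-mono-≤ (*-monoʳ-≤ (64 * (α + 4 * Q)) u≤) (*-monoʳ-≤ (2 * Q) d≤))) ⟩
    128 * (D * total) + Ω * (64 * (α + 4 * Q) * (64 * Π) + 2 * Q * (64 * Π + K))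
      ≡⟨ gather α Q Ω K Π (128 * (D * total)) ⟩
    128 * (D * total) + Ω * K * (2 * Q) + Ω * Π * (64 * (64 * (α + 4 * Q)) + 128 * Q)
      ≤⟨ +-monoʳ-≤ _ (*-monoʳ-≤ (Ω * Π) Y-large) ⟩
    128 * (D * total) + Ω * K * (2 * Q) + X ∎)
  where
  open ≤-Reasoning
  X : ℕ
  X = Ω * Π * (64 * (D * Y))
  pack : ∀ α Q D Y Ω K Π → Ω * K * (64 * (α + 4 * Q) + 64 * (D * Y)) + Ω * Π * (64 * (D * Y)) ≡
                           64 * (Ω * ((α + 4 * Q) * K) + D * Y * Ω * (K + Π))
  pack = solve-∀
  unpack : ∀ α Q D Ω u d t → 64 * (2 * (D * t) + Ω * ((α + 4 * Q) * u + 2 * Q * d)) ≡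
                             128 * (D * t) + Ω * (64 * (α + 4 * Q) * u + 2 * Q * (64 * d))
  unpack = solve-∀
  gather : ∀ α Q Ω K Π t → t + Ω * (64 * (α + 4 * Q) * (64 * Π) + 2 * Q * (64 * Π + K)) ≡
                           t + Ω * K * (2 * Q) + Ω * Π * (64 * (64 * (α + 4 * Q)) + 128 * Q)
  gather = solve-∀

-- An extra first letter is the coin between the two algorithms, so the augmenting one has
-- probability `1/Z` without a second source of randomness.
choose : ℕ → List Letter → Rule
choose s []                  = greedyRule
choose s (care lower ∷ ω)    = augmentRule s ω
choose s (care upper ∷ ω)    = greedyRule
choose s (pass ∷ ω)          = greedyRule
choose s (skip ∷ ω)          = greedyRule

picks-greedy : ∀ σ → picks (policyOf greedyRule) σ ≡ greedy [] σ
picks-greedy σ = trans (picksAfter≡run greedyRule [] σ) (run-greedy [] σ)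

choose-matching : ∀ s ω σ → picks (policyOf (choose s ω)) σ ⊆ σ × AllPairs Disjoint (picks (policyOf (choose s ω)) σ)
choose-matching s ω σ = at ω
  where
  greedy-case : picks (policyOf greedyRule) σ ⊆ σ × AllPairs Disjoint (picks (policyOf greedyRule) σ)
  greedy-case rewrite picks-greedy σ = greedy-⊆ [] σ , greedy-matching [] σ
  at : ∀ ω → picks (policyOf (choose s ω)) σ ⊆ σ × AllPairs Disjoint (picks (policyOf (choose s ω)) σ)
  at [] = greedy-case
  at (care lower ∷ ω) rewrite Augment.picks≡ s ω σ = Augment.picks⊆ s ω σ , Augment.picks-matching s ω σ
  at (care upper ∷ ω) = greedy-case
  at (pass ∷ ω) = greedy-case
  at (skip ∷ ω) = greedy-case

algorithm : ℕ → OnlineAlgorithm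
algorithm N = record
  { Coin     = λ _ → List Letter
  ; coins    = λ m → words N (suc m)
  ; policy   = λ m ω → policyOf (choose (cut m) ω)
  ; feasible = λ G ω σ σ↭E → let (sub , disj) = choose-matching (cut (length (E G))) ω σ
                              in (λ e∈ → ∈-resp-↭ σ↭E (sub e∈)) , disj
  }

-- The mean size for one arrival order

module PerOrder (N : ℕ) (s : ℕ) (σ O : List Edge) (dO : AllPairs Disjoint O) (O⊆σ : ∀ {g} → g ∈ O → g ∈ σ) where

  open FirstPhase (take s σ)
  open SecondPhase (drop s σ)
  open Analysis (take s σ) (drop s σ) O dO
  open Average N (take s σ) (drop s σ) O dO using (Z; B; Eᶜ-gain; ∑-Eᶜ-sacrificed)

  ω-sum : (List Letter → ℕ) → ℕ
  ω-sum = ∑ (wordList N (length σ))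

  Ω : ℕ
  Ω = length (wordList N (length σ))

  augment-size : ℕ
  augment-size = ω-sum (λ ω → length (picks (policyOf (augmentRule s ω)) σ))

  ∑ᶜ-split : ∀ F → ∑ᶜ N (take s σ ++ drop s σ) F ≡ ω-sum (λ ω → F (colouring σ ω))
  ∑ᶜ-split F = trans (cong (λ l → ∑ᶜ N l F) (take++drop≡id s σ)) (∑ᶜ≡ N σ F)

  S m : ℕ
  S = ω-sum (λ ω → ∑ T (λ t → sacrificed (colouring σ ω t)))
  m = ω-sum (λ ω → length (M (colouring σ ω)))

  Ω≡ : ∑ᶜ N (take s σ ++ drop s σ) (λ _ → 1) ≡ Ω
  Ω≡ = trans (∑ᶜ-split (λ _ → 1)) (∑-length (wordList N (length σ)))

  count : augment-size + S ≡ Ω * length T + m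
  count = begin
    augment-size + S
      ≡⟨ ∑-+ (wordList N (length σ)) (λ ω → length (picks (policyOf (augmentRule s ω)) σ)) _ ⟨
    ω-sum (λ ω → length (picks (policyOf (augmentRule s ω)) σ) + ∑ T (λ t → sacrificed (colouring σ ω t)))
      ≡⟨ ∑-cong (wordList N (length σ)) (λ {ω} _ → Augment.length-picks s ω σ) ⟩
    ω-sum (λ ω → length T + length (M (colouring σ ω)))
      ≡⟨ ∑-+ (wordList N (length σ)) (λ _ → length T) _ ⟩
    ω-sum (λ _ → length T) + m
      ≡⟨ cong (_+ m) (∑-const (wordList N (length σ)) (length T)) ⟩
    Ω * length T + m ∎
    where open ≡-Reasoning

  loss : N * (Z * Z * Z) * S ≡ 2 * (N * (Z * Z)) * (Ω * length T)
  loss = begin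
    N * (Z * Z * Z) * S                      ≡⟨ pull N Z S ⟩
    N * (Z * Z) * (Z * S)                    ≡⟨ cong (λ x → N * (Z * Z) * (Z * x)) (∑ᶜ-split _) ⟨
    N * (Z * Z) * (Z * ∑ᶜ N (take s σ ++ drop s σ) (λ κ → ∑ T (λ t → sacrificed (κ t))))
                                             ≡⟨ cong (N * (Z * Z) *_) ∑-Eᶜ-sacrificed ⟩
    N * (Z * Z) * (2 * ∑ᶜ N (take s σ ++ drop s σ) (λ _ → 1) * length T)
                                             ≡⟨ cong (λ x → N * (Z * Z) * (2 * x * length T)) Ω≡ ⟩
    N * (Z * Z) * (2 * Ω * length T)         ≡⟨ push (N * (Z * Z)) Ω (length T) ⟩
    2 * (N * (Z * Z)) * (Ω * length T)       ∎
    where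
    open ≡-Reasoning
    pull : ∀ n z s → n * (z * z * z) * s ≡ n * (z * z) * (z * s)
    pull = solve-∀
    push : ∀ p w t → p * (2 * w * t) ≡ 2 * p * (w * t)
    push = solve-∀

  gain : N * B * Ω * ∑ T augmentable ≤ N * (Z * Z * Z) * m + 16 * B * Ω * length T
  gain = subst₂ (λ w x → N * B * w * ∑ T augmentable ≤ N * (Z * Z * Z) * x + 16 * B * w * length T)
           Ω≡ (∑ᶜ-split (λ κ → length (M κ))) Eᶜ-gain

  cover : ∀ {g} → g ∈ O → g ∈ take s σ ⊎ g ∈ drop s σ
  cover {g} g∈ = ∈-++⁻ (take s σ) (subst (g ∈_) (sym (take++drop≡id s σ)) (O⊆σ g∈))

  augment-bound : ∀ α → α + (2 * (N * (Z * Z)) + 16 * B + 3 * (N * B)) ≡ N * (Z * Z * Z) →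
                  Ω * ((α + 4 * (N * B)) * length O) ≤
                  2 * (N * (Z * Z * Z) * augment-size) +
                  Ω * ((α + 4 * (N * B)) * ∑ O (λ g → open-at s g σ) + 2 * (N * B) * ∑ O (λ g → seen s g σ))
  augment-bound α = combine {N * (Z * Z * Z)} {N * (Z * Z)} {B} {N * B} {α} {Ω} {augment-size} {S} {length T} {m}
                      {∑ T augmentable} {∑ O untouched} {∑ O early} {length O} count loss gain (∑-augmentable cover) length-O

runSize : ℕ → ℕ → List Edge → ℕ
runSize N m σ = ∑ (wordList N (suc m)) (λ ω → length (picks (policyOf (choose (cut m) ω)) σ))

runSize≡ : ∀ N σ → let Ω = length (wordList N (length σ)) in
           runSize N (length σ) σ ≡
           ∑ (wordList N (length σ)) (λ ω → length (picks (policyOf (augmentRule (cut (length σ)) ω)) σ)) +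
           (1 + (N + N)) * (Ω * length (greedy [] σ))
runSize≡ N σ = begin
  runSize N (length σ) σ
    ≡⟨ ∑-wordList N (length σ) _ ⟩
  ∑ (alphabet N) (λ c → ∑ (wordList N (length σ)) (λ ω → length (picks (policyOf (choose (cut (length σ)) (c ∷ ω))) σ)))
    ≡⟨ ∑-alphabet N _ ⟩
  a + (r + (N * r + N * r))
    ≡⟨ collect N a r ⟩
  a + (1 + (N + N)) * r
    ≡⟨ cong (λ r → a + (1 + (N + N)) * r) (trans (∑-const (wordList N (length σ)) _)
         (cong (λ l → length (wordList N (length σ)) * length l) (picks-greedy σ))) ⟩
  a + (1 + (N + N)) * (length (wordList N (length σ)) * length (greedy [] σ)) ∎
  where
  open ≡-Reasoning
  a r : ℕ
  a = ∑ (wordList N (length σ)) (λ ω → length (picks (policyOf (augmentRule (cut (length σ)) ω)) σ))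
  r = ∑ (wordList N (length σ)) (λ _ → length (picks (policyOf greedyRule) σ))
  collect : ∀ n a r → a + (r + (n * r + n * r)) ≡ a + (1 + (n + n)) * r
  collect = solve-∀

-- Summation over all arrival orders

module Totals (N α : ℕ) (es O : List Edge) (unique : Unique es) (dO : AllPairs Disjoint O) (O⊆es : ∀ {g} → g ∈ O → g ∈ es) where

  Z m Ω k : ℕ
  Z = size N
  m = length es
  Ω = length (wordList N m)
  k = length O

  open Scale N Z public

  u d π : List Edge → ℕ
  u σ = ∑ O (λ g → open-at (cut m) g σ)
  d σ = ∑ O (λ g → seen (cut m) g σ)
  π σ = ∑ O (λ g → picked (cut m) g σ)

  per-order : α + (2 * (N * (Z * Z)) + 16 * B + 3 * Q) ≡ D → ∀ {σ} → σ ∈ perms es →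
              Ω * ((α + 4 * Q) * k) + D * Y * Ω * (k + π σ) ≤
              2 * (D * runSize N m σ) + Ω * ((α + 4 * Q) * u σ + 2 * Q * d σ)
  per-order α≡ {σ} σ∈ = begin
    Ω * ((α + 4 * Q) * k) + D * Y * Ω * (k + π σ)
      ≤⟨ +-mono-≤ bound (*-monoʳ-≤ (D * Y * Ω) greedy-half) ⟩
    2 * (D * a) + V + D * Y * Ω * (2 * gr)
      ≡⟨ regroup D a V Y Ω gr ⟩
    2 * (D * (a + Y * (Ω * gr))) + V
      ≡⟨ cong (λ x → 2 * (D * x) + V) size≡′ ⟨
    2 * (D * runSize N m σ) + V ∎
    where
    open ≤-Reasoning
    p : σ ↭ es
    p = perms-↭ es σ∈
    O⊆σ : ∀ {g} → g ∈ O → g ∈ σ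
    O⊆σ g∈ = ∈-resp-↭ (Perm.↭-sym p) (O⊆es g∈)
    a gr V : ℕ
    a  = ∑ (wordList N m) (λ ω → length (picks (policyOf (augmentRule (cut m) ω)) σ))
    gr = length (greedy [] σ)
    V  = Ω * ((α + 4 * Q) * u σ + 2 * Q * d σ)
    size≡′ : runSize N m σ ≡ a + Y * (Ω * gr)
    size≡′ = subst (λ m → runSize N m σ ≡ ∑ (wordList N m) (λ ω → length (picks (policyOf (augmentRule (cut m) ω)) σ)) +
                          Y * (length (wordList N m) * gr)) (↭-length p) (runSize≡ N σ)
    bound : Ω * ((α + 4 * Q) * k) ≤ 2 * (D * a) + V
    bound = subst (λ l → length (wordList N l) * ((α + 4 * Q) * k) ≤
                         2 * (D * ∑ (wordList N l) (λ ω → length (picks (policyOf (augmentRule (cut m) ω)) σ))) +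
                         length (wordList N l) * ((α + 4 * Q) * u σ + 2 * Q * d σ))
                  (↭-length p) (PerOrder.augment-bound N (cut m) σ O dO O⊆σ α α≡)
    greedy-half : k + π σ ≤ 2 * gr
    greedy-half = ≤-trans (≤-reflexive (trans (cong (_+ π σ) (sym (∑-length O))) (sym (∑-+ O (λ _ → 1) _))))
                          (greedy-bound dO (cut m) σ O⊆σ)
    regroup : ∀ D a V Y Ω g → 2 * (D * a) + V + D * Y * Ω * (2 * g) ≡ 2 * (D * (a + Y * (Ω * g))) + V
    regroup = solve-∀

  ps : List (List Edge)
  ps = perms es

  K Π total : ℕ
  K     = length ps * k
  Π     = ∑ ps π
  total = ∑ ps (runSize N m)

  summed : α + (2 * (N * (Z * Z)) + 16 * B + 3 * Q) ≡ D →
           Ω * ((α + 4 * Q) * K) + D * Y * Ω * (K + Π) ≤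
           2 * (D * total) + Ω * ((α + 4 * Q) * ∑ ps u + 2 * Q * ∑ ps d)
  summed α≡ = begin
    Ω * ((α + 4 * Q) * K) + D * Y * Ω * (K + Π)
      ≡⟨ pack Ω (α + 4 * Q) (D * Y) (length ps) k Π ⟩
    length ps * (Ω * ((α + 4 * Q) * k) + D * Y * Ω * k) + D * Y * Ω * Π
      ≡⟨ cong₂ _+_ (sym (∑-const ps _)) (sym (∑-*ˡ ps (D * Y * Ω) π)) ⟩
    ∑ ps (λ _ → Ω * ((α + 4 * Q) * k) + D * Y * Ω * k) + ∑ ps (λ σ → D * Y * Ω * π σ)
      ≡⟨ ∑-+ ps (λ _ → Ω * ((α + 4 * Q) * k) + D * Y * Ω * k) (λ σ → D * Y * Ω * π σ) ⟨
    ∑ ps (λ σ → Ω * ((α + 4 * Q) * k) + D * Y * Ω * k + D * Y * Ω * π σ)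
      ≡⟨ ∑-cong ps (λ {σ} _ → factor (Ω * ((α + 4 * Q) * k)) (D * Y * Ω) k (π σ)) ⟩
    ∑ ps (λ σ → Ω * ((α + 4 * Q) * k) + D * Y * Ω * (k + π σ))
      ≤⟨ ∑-mono ps (per-order α≡) ⟩
    ∑ ps (λ σ → 2 * (D * runSize N m σ) + Ω * ((α + 4 * Q) * u σ + 2 * Q * d σ))
      ≡⟨ trans (∑-+ ps (λ σ → 2 * (D * runSize N m σ)) (λ σ → Ω * ((α + 4 * Q) * u σ + 2 * Q * d σ)))
           (cong₂ _+_ (trans (∑-*ˡ ps 2 (λ σ → D * runSize N m σ)) (cong (2 *_) (∑-*ˡ ps D (runSize N m))))
                      (trans (∑-*ˡ ps Ω (λ σ → (α + 4 * Q) * u σ + 2 * Q * d σ)) (cong (Ω *_)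
                        (trans (∑-+ ps (λ σ → (α + 4 * Q) * u σ) (λ σ → 2 * Q * d σ))
                               (cong₂ _+_ (∑-*ˡ ps (α + 4 * Q) u) (∑-*ˡ ps (2 * Q) d)))))) ⟩
    2 * (D * total) + Ω * ((α + 4 * Q) * ∑ ps u + 2 * Q * ∑ ps d) ∎
    where
    open ≤-Reasoning
    factor : ∀ x e k p → x + e * k + e * p ≡ x + e * (k + p)
    factor = solve-∀
    pack : ∀ Ω c e p k Π → Ω * (c * (p * k)) + e * Ω * (p * k + Π) ≡ p * (Ω * (c * k) + e * Ω * k) + e * Ω * Π
    pack = solve-∀

  untouched-rare : ∑ ps u ≤ 64 * Π
  untouched-rare = begin
    ∑ ps u                                              ≡⟨ ∑-swap ps O (λ σ g → open-at (cut m) g σ) ⟩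
    ∑ O (λ g → ∑ ps (open-at (cut m) g))                ≤⟨ ∑-mono O (λ g∈ → hasty unique (O⊆es g∈)) ⟩
    ∑ O (λ g → 64 * ∑ ps (picked (cut m) g))            ≡⟨ ∑-*ˡ O 64 (λ g → ∑ ps (picked (cut m) g)) ⟩
    64 * ∑ O (λ g → ∑ ps (picked (cut m) g))            ≡⟨ cong (64 *_) (∑-swap ps O (λ σ g → picked (cut m) g σ)) ⟨
    64 * Π                                              ∎
    where open ≤-Reasoning

  early-rare : 64 * ∑ ps d ≤ 64 * Π + K
  early-rare = begin
    64 * ∑ ps d                                         ≡⟨ cong (64 *_) (∑-swap ps O (λ σ g → seen (cut m) g σ)) ⟩
    64 * ∑ O (λ g → ∑ ps (seen (cut m) g))              ≡⟨ ∑-*ˡ O 64 (λ g → ∑ ps (seen (cut m) g)) ⟨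
    ∑ O (λ g → 64 * ∑ ps (seen (cut m) g))              ≤⟨ ∑-mono O (λ g∈ → rarely-early unique (O⊆es g∈)) ⟩
    ∑ O (λ g → 64 * ∑ ps (picked (cut m) g) + length ps)
      ≡⟨ trans (∑-+ O (λ g → 64 * ∑ ps (picked (cut m) g)) (λ _ → length ps))
           (cong₂ _+_ (∑-*ˡ O 64 (λ g → ∑ ps (picked (cut m) g))) (trans (∑-const O (length ps)) (*-comm k (length ps)))) ⟩
    64 * ∑ O (λ g → ∑ ps (picked (cut m) g)) + K        ≡⟨ cong (λ x → 64 * x + K) (∑-swap ps O (λ σ g → picked (cut m) g σ)) ⟨
    64 * Π + K                                          ∎
    where open ≤-Reasoning

  total-bound : α + (2 * (N * (Z * Z)) + 16 * B + 3 * Q) ≡ D →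
                64 * (64 * (α + 4 * Q)) + 128 * Q ≤ 64 * (D * Y) →
                Ω * K * (64 * (α + 4 * Q) + 64 * (D * Y)) ≤ 128 * (D * total) + Ω * K * (2 * Q)
  total-bound α≡ Y-large = average-out {D} {Y} {Q} {α} {Ω} {K} {Π} {∑ ps u} {∑ ps d} {total}
    (summed α≡) untouched-rare early-rare Y-large

-- Expectations as fractions

open ℤ using (+_; +≤+)

opaque
  ratio : ℕ → ℕ → ℚ
  ratio a d = fromℚᵘ (mkℚᵘ (+ a) d)

  ratio≡ : ∀ a d → ratio a d ≡ + a ℚ./ suc d
  ratio≡ a d = refl

  ratio-0 : ∀ d → 0ℚ ≡ ratio 0 d
  ratio-0 d = ℚₚ.fromℚᵘ-cong {mkℚᵘ (+ 0) 0} {mkℚᵘ (+ 0) d} (*≡* refl)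

  ratio-+ : ∀ a b d → ratio a d ℚ.+ ratio b d ≡ ratio (a + b) d
  ratio-+ a b d = ℚₚ.toℚᵘ-injective (begin
    toℚᵘ (ratio a d ℚ.+ ratio b d)             ≈⟨ ℚₚ.toℚᵘ-homo-+ (ratio a d) (ratio b d) ⟩
    toℚᵘ (ratio a d) ℚᵘ.+ toℚᵘ (ratio b d)     ≈⟨ ℚᵘₚ.+-cong (ℚₚ.toℚᵘ-fromℚᵘ (mkℚᵘ (+ a) d)) (ℚₚ.toℚᵘ-fromℚᵘ (mkℚᵘ (+ b) d)) ⟩
    mkℚᵘ (+ a) d ℚᵘ.+ mkℚᵘ (+ b) d             ≈⟨ *≡* (common (+ a) (+ b) (+ suc d)) ⟩
    mkℚᵘ (+ (a + b)) d                         ≈⟨ ℚₚ.toℚᵘ-fromℚᵘ (mkℚᵘ (+ (a + b)) d) ⟨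
    toℚᵘ (ratio (a + b) d)                     ∎)
    where
    open ℚᵘₚ.≃-Reasoning
    common : ∀ a b d → (a ℤ.* d ℤ.+ b ℤ.* d) ℤ.* d ≡ (a ℤ.+ b) ℤ.* (d ℤ.* d)
    common = ℤ-solve-∀

  -- Denominators are stored as predecessors; `d + c * suc d` is that of `suc c * suc d`.
  ratio-* : ∀ a b c d → ratio a c ℚ.* ratio b d ≡ ratio (a * b) (d + c * suc d)
  ratio-* a b c d = ℚₚ.toℚᵘ-injective (begin
    toℚᵘ (ratio a c ℚ.* ratio b d)             ≈⟨ ℚₚ.toℚᵘ-homo-* (ratio a c) (ratio b d) ⟩
    toℚᵘ (ratio a c) ℚᵘ.* toℚᵘ (ratio b d)     ≈⟨ ℚᵘₚ.*-cong (ℚₚ.toℚᵘ-fromℚᵘ (mkℚᵘ (+ a) c)) (ℚₚ.toℚᵘ-fromℚᵘ (mkℚᵘ (+ b) d)) ⟩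
    mkℚᵘ (+ a) c ℚᵘ.* mkℚᵘ (+ b) d             ≈⟨ *≡* (cong (ℤ._* + (suc c * suc d)) (sym (ℤₚ.pos-* a b))) ⟩
    mkℚᵘ (+ (a * b)) (d + c * suc d)           ≈⟨ ℚₚ.toℚᵘ-fromℚᵘ (mkℚᵘ (+ (a * b)) (d + c * suc d)) ⟨
    toℚᵘ (ratio (a * b) (d + c * suc d))       ∎)
    where open ℚᵘₚ.≃-Reasoning

  ratio-≤ : ∀ a b c d → a * suc d ≤ b * suc c → ratio a c ℚ.≤ ratio b d
  ratio-≤ a b c d le = ℚₚ.toℚᵘ-cancel-≤ (begin
    toℚᵘ (ratio a c)   ≃⟨ ℚₚ.toℚᵘ-fromℚᵘ (mkℚᵘ (+ a) c) ⟩
    mkℚᵘ (+ a) c       ≤⟨ *≤* (subst₂ ℤ._≤_ (ℤₚ.pos-* a (suc d)) (ℤₚ.pos-* b (suc c)) (+≤+ le)) ⟩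
    mkℚᵘ (+ b) d       ≃⟨ ℚₚ.toℚᵘ-fromℚᵘ (mkℚᵘ (+ b) d) ⟨
    toℚᵘ (ratio b d)   ∎)
    where open ℚᵘₚ.≤-Reasoning

module _ {A : Set} where

  ∑-ratio : ∀ (xs : List A) f d → foldr ℚ._+_ 0ℚ (map (λ x → ratio (f x) d) xs) ≡ ratio (∑ xs f) d
  ∑-ratio []       f d = ratio-0 d
  ∑-ratio (x ∷ xs) f d = trans (cong (ratio (f x) d ℚ.+_) (∑-ratio xs f d)) (ratio-+ (f x) (∑ xs f) d)

  𝔼-cong : ∀ (xs : List⁺ A) {f g} → (∀ x → f x ≡ g x) → 𝔼 xs f ≡ 𝔼 xs g
  𝔼-cong xs h = cong (λ l → foldr ℚ._+_ 0ℚ l ℚ.* (+ 1 ℚ./ List⁺.length xs)) (map-cong h (toList xs))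

  𝔼-ratio : ∀ (xs : List⁺ A) f d → let l = length (List⁺.tail xs) in
            𝔼 xs (λ x → ratio (f x) d) ≡ ratio (∑ (toList xs) f) (l + d * suc l)
  𝔼-ratio xs f d = begin
    𝔼 xs (λ x → ratio (f x) d)                  ≡⟨ cong₂ ℚ._*_ (∑-ratio (toList xs) f d) (sym (ratio≡ 1 l)) ⟩
    ratio (∑ (toList xs) f) d ℚ.* ratio 1 l     ≡⟨ ratio-* (∑ (toList xs) f) 1 d l ⟩
    ratio (∑ (toList xs) f * 1) (l + d * suc l) ≡⟨ cong (λ a → ratio a (l + d * suc l)) (*-identityʳ (∑ (toList xs) f)) ⟩
    ratio (∑ (toList xs) f) (l + d * suc l)     ∎
    where
    open ≡-Reasoning
    l : ℕ
    l = length (List⁺.tail xs)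

expected≡ : ∀ N G → let m = length (E G) ; w = length (List⁺.tail (words N (suc m))) ; p = length (List⁺.tail (permutations (E G))) in
            expectedSize (algorithm N) G ≡ ratio (∑ (perms (E G)) (runSize N m)) (p + (w + 0) * suc p)
expected≡ N G = begin
  expectedSize (algorithm N) G
    ≡⟨ 𝔼-cong (permutations (E G)) inner ⟩
  𝔼 (permutations (E G)) (λ σ → ratio (runSize N m σ) (w + 0))
    ≡⟨ 𝔼-ratio (permutations (E G)) (runSize N m) (w + 0) ⟩
  ratio (∑ (toList (permutations (E G))) (runSize N m)) (p + (w + 0) * suc p)
    ≡⟨ cong (λ l → ratio (∑ l (runSize N m)) (p + (w + 0) * suc p)) (perms≡ (E G)) ⟨
  ratio (∑ (perms (E G)) (runSize N m)) (p + (w + 0) * suc p) ∎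
  where
  open ≡-Reasoning
  m w p : ℕ
  m = length (E G)
  w = length (List⁺.tail (words N (suc m)))
  p = length (List⁺.tail (permutations (E G)))
  size-of : List Edge → List Letter → ℕ
  size-of σ ω = length (picks (policyOf (choose (cut m) ω)) σ)
  inner : ∀ σ → 𝔼 (words N (suc m)) (λ ω → + size-of σ ω ℚ./ 1) ≡ ratio (runSize N m σ) (w + 0)
  inner σ = begin
    𝔼 (words N (suc m)) (λ ω → + size-of σ ω ℚ./ 1)          ≡⟨ 𝔼-cong (words N (suc m)) (λ ω → sym (ratio≡ (size-of σ ω) 0)) ⟩
    𝔼 (words N (suc m)) (λ ω → ratio (size-of σ ω) 0)        ≡⟨ 𝔼-ratio (words N (suc m)) (size-of σ) 0 ⟩
    ratio (∑ (toList (words N (suc m))) (size-of σ)) (w + 0)  ≡⟨ cong (λ l → ratio (∑ l (size-of σ)) (w + 0)) (wordList≡ N (suc m)) ⟨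
    ratio (runSize N m σ) (w + 0)                             ∎

-- The slack in the final inequality: with D = N Z³ and Q = N B the expected size
-- exceeds half of the optimum by the fraction (62 Q - 128 N Z² - 1024 B) / (128 D Z).
settle : ∀ {D Q α Y Z Ω p k total} a q .{{_ : NonZero D}} →
         Ω * (p * k) * (64 * (α + 4 * Q) + 64 * (D * Y)) ≤ 128 * (D * total) + Ω * (p * k) * (2 * Q) →
         a * Z * (128 * D) + q * (2 * Q) ≤ q * (64 * (α + 4 * Q) + 64 * (D * Y)) →
         a * k * (Z * Ω * p) ≤ total * q
settle {D} {Q} {α} {Y} {Z} {Ω} {p} {k} {total} a q bound slack =
  *-cancelˡ-≤ D (*-cancelˡ-≤ 128 (+-cancelʳ-≤ (q * (Ω * (p * k) * (2 * Q))) _ _ (begin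
    128 * (D * (a * k * (Z * Ω * p))) + q * (Ω * (p * k) * (2 * Q))
      ≡⟨ pack D a k Z Ω p q Q ⟩
    Ω * (p * k) * (a * Z * (128 * D) + q * (2 * Q))
      ≤⟨ *-monoʳ-≤ (Ω * (p * k)) slack ⟩
    Ω * (p * k) * (q * (64 * (α + 4 * Q) + 64 * (D * Y)))
      ≡⟨ exchange (Ω * (p * k)) q _ ⟩
    q * (Ω * (p * k) * (64 * (α + 4 * Q) + 64 * (D * Y)))
      ≤⟨ *-monoʳ-≤ q bound ⟩
    q * (128 * (D * total) + Ω * (p * k) * (2 * Q))
      ≡⟨ unpack q D total _ ⟩
    128 * (D * (total * q)) + q * (Ω * (p * k) * (2 * Q)) ∎)))
  where
  open ≤-Reasoning
  pack : ∀ D a k Z Ω p q Q → 128 * (D * (a * k * (Z * Ω * p))) + q * (Ω * (p * k) * (2 * Q)) ≡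
                             Ω * (p * k) * (a * Z * (128 * D) + q * (2 * Q))
  pack = solve-∀
  exchange : ∀ x q y → x * (q * y) ≡ q * (x * y)
  exchange = solve-∀
  unpack : ∀ q D t x → q * (128 * (D * t) + x) ≡ 128 * (D * (t * q)) + q * x
  unpack = solve-∀

-- z stands for the size 2 + 2 N of the alphabet.
record Parameters (N α a b z : ℕ) : Set where
  open Scale N z
  field
    nonZero : NonZero D
    α≡      : α + (2 * (N * (z * z)) + 16 * B + 3 * Q) ≡ D
    Y-large : 64 * (64 * (α + 4 * Q)) + 128 * Q ≤ 64 * (D * Y)
    slack   : a * z * (128 * D) + suc b * (2 * Q) ≤ suc b * (64 * (α + 4 * Q) + 64 * (D * Y))

competitive : ∀ {N α a b} → Parameters N α a b (size N) → Competitive (ratio a b) (algorithm N)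
competitive {N} {α} {a} {b} params G OPT ((OPT⊆E , disjoint) , _) =
  subst₂ ℚ._≤_ (sym (trans (cong (ratio a b ℚ.*_) (sym (ratio≡ k 0))) (ratio-* a k b 0))) (sym (expected≡ N G))
    (ratio-≤ (a * k) total (0 + b * 1) (p + (w + 0) * suc p) (begin
      a * k * (suc (w + 0) * suc p)   ≡⟨ cong (a * k *_) (cong₂ _*_ words≡ (sym perms-length)) ⟩
      a * k * (Z * Ω * length ps)     ≤⟨ settle {D} {Q} {α} {Y} {Z} {Ω} {length ps} {k} {total} a (suc b) (total-bound α≡ Y-large) slack ⟩
      total * suc b                   ≡⟨ cong (λ x → total * suc x) (*-identityʳ b) ⟨
      total * suc (0 + b * 1)         ∎))
  where
  open ≤-Reasoning
  open Parameters params using (nonZero; α≡; Y-large; slack)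
  open Totals N α (E G) OPT (E-unique G) disjoint OPT⊆E
  instance
    _ : NonZero D
    _ = nonZero
  w p : ℕ
  w = length (List⁺.tail (words N (suc m)))
  p = length (List⁺.tail (permutations (E G)))
  words≡ : suc (w + 0) ≡ Z * Ω
  words≡ = trans (cong suc (+-identityʳ w)) (trans (cong length (sym (wordList≡ N (suc m)))) (trans (sym (∑-length (wordList N (suc m))))
    (trans (∑-wordList N m (λ _ → 1)) (trans (∑-cong (alphabet N) (λ _ → ∑-length (wordList N m))) (∑-alphabet-const N Ω)))))
  perms-length : length ps ≡ suc p
  perms-length = cong length (perms≡ (E G))

-- The surplus turns positive a little above `N = 200`. For `N = 1000` it is about 1.78 in 10^8,
-- rounded down to the 1 in 10^8 by which 50000001 / 100000000 exceeds one half. The second number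
-- is the `α` forced by `α≡`, and `Y = 2001` is far above the required 64 or so.
parameters : Parameters 1000 7988815719872 50000001 99999999 2002
parameters = record
  { nonZero = _
  ; α≡      = refl
  ; Y-large = ≤ᵇ⇒≤ _ _ _
  ; slack   = ≤ᵇ⇒≤ _ _ _
  }

theorem2 : ∃ λ (δ′ : ℚ) → 0ℚ ℚ.< δ′ × Σ OnlineAlgorithm (λ A → Competitive (½ ℚ.+ δ′) A)
theorem2 = + 1 ℚ./ 100000000 , ℚₚ.positive⁻¹ (+ 1 ℚ./ 100000000) , algorithm 1000
  , subst (λ c → Competitive c (algorithm 1000)) (ratio≡ 50000001 99999999)
      (competitive (subst (Parameters 1000 7988815719872 50000001 99999999) (sym (size≡ 1000)) parameters))
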